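{- $h_{2\times 4}> 78.32$.
   Context: A $2\times 4$ block is a subset of $\mathbb{R}^3$ of the form $[x,x+2]\times[y,y+4]\times[z,z+1]$ or $[x,x+4]\times[y,y+2]\times[z,z+1]$ with $x,y,z\in\mathbb{Z}$. A building is a finite set of blocks with pairwise disjoint interiors. Two blocks of a building are attached if their $z$-coordinates differ by exactly $1$ and their projections to the $xy$-plane overlap in a set with nonempty interior (i.e. at least one stud of the lower block is inserted into the upper block). A building is contiguous if the graph on its blocks given by attachment is connected. Two buildings are identified if one is mapped onto the other by a composition of translations of $\mathbb{R}^3$ and rotations about vertical axes (rotations in the $xy$-plane, by multiples of $90^\circ$). $T_{2\times 4}(n)$ denotes the number of contiguous buildings consisting of exactly $n$ such blocks, counted up to this identification. The entropy is $s_{2\times 4}=\lim_{n\to\infty}\frac{\log(T_{2\times 4}(n))}{n}$ (this limit exists and is finite), and $h_{2\times 4}=\exp(s_{2\times 4})$. -}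

module Defs where

open import Level using (0ℓ)
open import Data.Bool.Base using (if_then_else_)
open import Data.Empty using (⊥-elim)
open import Data.Fin.Base using (Fin)
open import Data.Integer.Base as ℤ using (ℤ; +_; +[1+_])
import Data.Integer.Properties as ℤ
open import Data.Integer.Tactic.RingSolver using (solve-∀)
open import Data.Nat.Base as ℕ using (ℕ; zero; suc; z≤n; s≤s)
import Data.Nat.Properties as ℕ
import Data.Nat.Coprimality as C
open import Data.Product.Base using (Σ; ∃; ∃₂; _×_; _,_; proj₁; proj₂)
open import Data.Rational.Base
open import Data.Rational.Properties
open import Data.Rational.Solver using (module +-*-Solver)
open import Data.Sum.Base using (_⊎_; inj₁; inj₂; [_,_]′)
open import Function.Bundles using (Bijection)
open import Relation.Binary.Bundles using (Setoid)
open import Relation.Binary.Construct.Closure.ReflexiveTransitive using (Star)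
open import Relation.Binary.PropositionalEquality
  using (_≡_; _≢_; refl; sym; trans; cong; cong₂; subst; subst₂; setoid)
open import Relation.Nullary using (¬_; Dec; does; yes; no)

module RationalLemmas where

  ι : ℕ → ℚ
  ι n = + n / 1

  recip : ℕ → ℚ
  recip n = + 1 / suc n

  ι-mkℚ : ∀ n → ι n ≡ mkℚ (+ n) 0 (C.sym (C.1-coprimeTo n))
  ι-mkℚ n = normalize-coprime (C.sym (C.1-coprimeTo n))

  recip-mkℚ : ∀ n → recip n ≡ mkℚ (+ 1) n (C.1-coprimeTo (suc n))
  recip-mkℚ n = normalize-coprime (C.1-coprimeTo (suc n))

  ι-mono : ∀ {m n} → m ℕ.≤ n → ι m ≤ ι n
  ι-mono {m} {n} m≤n = subst₂ _≤_ (sym (ι-mkℚ m)) (sym (ι-mkℚ n))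
    (*≤* (ℤ.*-monoʳ-≤-nonNeg (+ 1) (ℤ.+≤+ m≤n)))

  0≤ι : ∀ n → 0ℚ ≤ ι n
  0≤ι n = ι-mono {0} {n} z≤n

  0<ι : ∀ n → 0ℚ < ι (suc n)
  0<ι n = subst (0ℚ <_) (sym (ι-mkℚ (suc n))) (positive⁻¹ (mkℚ +[1+ n ] 0 _))

  0<recip : ∀ n → 0ℚ < recip n
  0<recip n = subst (0ℚ <_) (sym (recip-mkℚ n)) (positive⁻¹ (mkℚ (+ 1) n _))

  0≤recip : ∀ n → 0ℚ ≤ recip n
  0≤recip n = <⇒≤ (0<recip n)

  ι*recip : ∀ n → ι (suc n) * recip n ≡ 1ℚ
  ι*recip n = trans (cong₂ _*_ (ι-mkℚ (suc n)) (recip-mkℚ n))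
    (*-inverseʳ (mkℚ +[1+ n ] 0 (C.sym (C.1-coprimeTo (suc n)))))

  ι-suc : ∀ n → ι (suc n) ≡ 1ℚ + ι n
  ι-suc n = sym (trans (cong (λ t → 1ℚ + t) (ι-mkℚ n))
    (cong (λ k → k / 1) (cong (λ k → + 1 ℤ.+ k) (ℤ.*-identityʳ (+ n)))))

  ι-* : ∀ m n → ι (m ℕ.* n) ≡ ι m * ι n
  ι-* m n = sym (trans (cong₂ _*_ (ι-mkℚ m) (ι-mkℚ n))
    (cong (λ k → k / 1) (sym (ℤ.pos-* m n))))

  mulʳ : ∀ {a b c} → 0ℚ ≤ c → a ≤ b → a * c ≤ b * c
  mulʳ {c = c} 0≤c = *-monoʳ-≤-nonNeg c {{nonNegative 0≤c}}

  mulˡ : ∀ {a b c} → 0ℚ ≤ c → a ≤ b → c * a ≤ c * b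
  mulˡ {c = c} 0≤c = *-monoˡ-≤-nonNeg c {{nonNegative 0≤c}}

  mul : ∀ {a b c d} → 0ℚ ≤ a → 0ℚ ≤ d → a ≤ b → c ≤ d → a * c ≤ b * d
  mul 0≤a 0≤d a≤b c≤d = ≤-trans (mulˡ 0≤a c≤d) (mulʳ 0≤d a≤b)

  mul<ʳ : ∀ {a b c} → 0ℚ < c → a < b → a * c < b * c
  mul<ʳ {c = c} 0<c = *-monoˡ-<-pos c {{positive 0<c}}

  0≤* : ∀ {a b} → 0ℚ ≤ a → 0ℚ ≤ b → 0ℚ ≤ a * b
  0≤* {a} {b} 0≤a 0≤b = subst (_≤ a * b) (*-zeroˡ b) (mulʳ 0≤b 0≤a)

  0<* : ∀ {a b} → 0ℚ < a → 0ℚ < b → 0ℚ < a * b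
  0<* {a} {b} 0<a 0<b = subst (_< a * b) (*-zeroˡ b) (mul<ʳ 0<b 0<a)

  0≤+ : ∀ {a b} → 0ℚ ≤ a → 0ℚ ≤ b → 0ℚ ≤ a + b
  0≤+ 0≤a 0≤b = +-mono-≤ 0≤a 0≤b

  recip≤1 : ∀ n → recip n ≤ 1ℚ
  recip≤1 n = subst₂ _≤_ (*-identityˡ (recip n)) (ι*recip n)
    (mulʳ (0≤recip n) (ι-mono {1} {suc n} (s≤s z≤n)))

  ∣-∣-sym : ∀ a b → ∣ a - b ∣ ≡ ∣ b - a ∣
  ∣-∣-sym a b = trans (sym (∣-p∣≡∣p∣ (a - b))) (cong ∣_∣
    (solve 2 (λ a b → :- (a :- b) := b :- a) refl a b))
    where open +-*-Solver

  ∣-∣-tri : ∀ a b c → ∣ a - c ∣ ≤ ∣ a - b ∣ + ∣ b - c ∣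
  ∣-∣-tri a b c = subst (λ t → ∣ t ∣ ≤ ∣ a - b ∣ + ∣ b - c ∣)
    (solve 3 (λ a b c → (a :- b) :+ (b :- c) := a :- c) refl a b c)
    (∣p+q∣≤∣p∣+∣q∣ (a - b) (b - c))
    where open +-*-Solver

  p≤∣p∣ : ∀ p → p ≤ ∣ p ∣
  p≤∣p∣ p with ≤-total 0ℚ p
  ... | inj₁ 0≤p = ≤-reflexive (sym (0≤p⇒∣p∣≡p 0≤p))
  ... | inj₂ p≤0 = ≤-trans p≤0 (0≤∣p∣ p)

  ∣∣-≤ : ∀ {p q} → p ≤ q → - p ≤ q → ∣ p ∣ ≤ q
  ∣∣-≤ {p} {q} p≤q -p≤q with ∣p∣≡p∨∣p∣≡-p p
  ... | inj₁ e = subst (_≤ q) (sym e) p≤q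
  ... | inj₂ e = subst (_≤ q) (sym e) -p≤q

  ≤⇒0≤- : ∀ {a b} → a ≤ b → 0ℚ ≤ b - a
  ≤⇒0≤- {a} {b} a≤b = subst (_≤ b - a) (+-inverseʳ a) (+-monoˡ-≤ (- a) a≤b)

  0≤-⇒≤ : ∀ {a b} → 0ℚ ≤ b - a → a ≤ b
  0≤-⇒≤ {a} {b} h = subst₂ _≤_ (+-identityˡ a)
    (solve 2 (λ a b → (b :- a) :+ a := b) refl a b) (+-monoˡ-≤ a h)
    where open +-*-Solver

  -∣∣-mono : ∀ a b → ∣ ∣ a ∣ - ∣ b ∣ ∣ ≤ ∣ a - b ∣
  -∣∣-mono a b = ∣∣-≤ (half a b)
    (subst₂ _≤_ (solve 2 (λ a b → b :- a := :- (a :- b)) refl ∣ a ∣ ∣ b ∣)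
      (∣-∣-sym b a) (half b a))
    where
    open +-*-Solver
    half : ∀ a b → ∣ a ∣ - ∣ b ∣ ≤ ∣ a - b ∣
    half a b = subst (∣ a ∣ - ∣ b ∣ ≤_)
      (solve 2 (λ d b → (d :+ b) :- b := d) refl ∣ a - b ∣ ∣ b ∣)
      (+-monoˡ-≤ (- ∣ b ∣) (subst (λ t → ∣ t ∣ ≤ ∣ a - b ∣ + ∣ b ∣)
        (solve 2 (λ a b → (a :- b) :+ b := a) refl a b)
        (∣p+q∣≤∣p∣+∣q∣ (a - b) b)))

  archimedean : ∀ q → ∃ λ n → q < ι (suc n)
  archimedean q@(mkℚ n d c) = ℤ.∣ n ∣ , ≤-<-trans q≤n (subst₂ _<_
      (+-identityˡ _) (sym (ι-suc ℤ.∣ n ∣))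
      (+-monoˡ-< (ι ℤ.∣ n ∣) (positive⁻¹ 1ℚ)))
    where
    lemma : ∀ n → n ℤ.* + 1 ℤ.≤ + ℤ.∣ n ∣ ℤ.* +[1+ d ]
    lemma (+ n) = ℤ.≤-trans (ℤ.*-monoˡ-≤-nonNeg (+ n) (ℤ.+≤+ (s≤s z≤n))) ℤ.≤-refl
    lemma ℤ.-[1+ n ] = ℤ.-≤+
    q≤n : q ≤ ι ℤ.∣ n ∣
    q≤n = subst (q ≤_) (sym (ι-mkℚ ℤ.∣ n ∣)) (*≤* (lemma n))

  third : ℚ
  third = + 1 / 3

  third-pos : ∀ {ε} → 0ℚ < ε → 0ℚ < ε * third
  third-pos 0<ε = 0<* 0<ε (positive⁻¹ third)

  thirds : ∀ ε → ε * third + (ε * third + ε * third) ≡ ε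
  thirds = solve 1 (λ e → e :* con third :+ (e :* con third :+ e :* con third) := e) refl
    where open +-*-Solver

  thirds₂ : ∀ {ε a b} → 0ℚ < ε → a < ε * third → b < ε * third → a + b < ε
  thirds₂ {ε} {a} {b} 0<ε a< b< = subst (a + b <_) (thirds ε)
    (+-mono-< a< (subst (_< ε * third + ε * third) (+-identityˡ b)
      (+-mono-< (third-pos 0<ε) b<)))

  shrink : ∀ B ε → 0ℚ < ε →
           ∃ λ δ → 0ℚ < δ × (∀ {d} → 0ℚ ≤ d → d < δ → B * d < ε)
  shrink B ε 0<ε with archimedean B
  ... | K , B<K = ε * recip K , 0<* 0<ε (0<recip K) , λ {d} 0≤d d<δ →
    ≤-<-trans (mulʳ 0≤d (<⇒≤ B<K))
      (subst₂ _<_ (*-comm d (ι (suc K))) (eq K)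
        (mul<ʳ (0<ι K) d<δ))
    where
    open +-*-Solver
    eq : ∀ K → ε * recip K * ι (suc K) ≡ ε
    eq K = trans (solve 3 (λ e r k → e :* r :* k := e :* (k :* r)) refl ε (recip K) (ι (suc K)))
      (trans (cong (ε *_) (ι*recip K)) (*-identityʳ ε))

  module Shrunk {δ : ℚ} (0<δ : 0ℚ < δ) where
    instance
      δ≢0 : NonZero δ
      δ≢0 = >-nonZero 0<δ

    N : ℕ
    N = proj₁ (archimedean (1/ δ))

    rearrange : ∀ k d r → k * (d * r) ≡ d * (k * r)
    rearrange = solve 3 (λ k d r → k :* (d :* r) := d :* (k :* r)) refl
      where open +-*-Solver

    recip< : ∀ n → N ℕ.≤ n → recip n < δ
    recip< n N≤n = subst₂ _<_ left right
      (mul<ʳ {1/ δ} {ι (suc n)} {δ * recip n} (0<* {δ} {recip n} 0<δ (0<recip n))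
        (<-≤-trans {1/ δ} {ι (suc N)} {ι (suc n)}
          (proj₂ (archimedean (1/ δ))) (ι-mono (s≤s N≤n))))
      where
      left : 1/ δ * (δ * recip n) ≡ recip n
      left = trans (sym (*-assoc (1/ δ) δ (recip n)))
        (trans (cong (_* recip n) (*-inverseˡ δ)) (*-identityˡ (recip n)))
      right : ι (suc n) * (δ * recip n) ≡ δ
      right = trans (rearrange (ι (suc n)) δ (recip n))
        (trans (cong (δ *_) (ι*recip n)) (*-identityʳ δ))

  recip-null : ∀ B ε → 0ℚ < ε → ∃ λ N → ∀ n → N ℕ.≤ n → B * recip n < ε
  recip-null B ε 0<ε =
    let δ , 0<δ , small = shrink B ε 0<ε
    in Shrunk.N 0<δ , λ n N≤n →
      small {recip n} (0≤recip n) (Shrunk.recip< 0<δ n N≤n)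

open RationalLemmas

Cauchy : (ℕ → ℚ) → Set
Cauchy f = ∀ ε → 0ℚ < ε →
  ∃ λ N → ∀ m n → N ℕ.≤ m → N ℕ.≤ n → ∣ f m - f n ∣ < ε

record ℝ : Set where
  constructor mkℝ
  field
    seq    : ℕ → ℚ
    cauchy : Cauchy seq

open ℝ public

infix 4 _≃ᴿ_ _<ᴿ_

_≃ᴿ_ : ℝ → ℝ → Set
x ≃ᴿ y = ∀ ε → 0ℚ < ε → ∃ λ N → ∀ n → N ℕ.≤ n → ∣ seq x n - seq y n ∣ < ε

_<ᴿ_ : ℝ → ℝ → Set
x <ᴿ y = ∃ λ ε → 0ℚ < ε × ∃ λ N → ∀ n → N ℕ.≤ n → seq x n + ε < seq y n

fromℚ : ℚ → ℝ
fromℚ q = mkℝ (λ _ → q) λ ε 0<ε → 0 , λ _ _ _ _ →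
  subst (_< ε) (sym (cong ∣_∣ (+-inverseʳ q))) 0<ε

infixl 6 _-ᴿ_
infixl 7 _÷ᴿ_

_-ᴿ_ : ℝ → ℝ → ℝ
seq    (x -ᴿ y) n = seq x n - seq y n
cauchy (x -ᴿ y) ε 0<ε
  with cauchy x (ε * third) (third-pos 0<ε) | cauchy y (ε * third) (third-pos 0<ε)
... | N₁ , h₁ | N₂ , h₂ = N₁ ℕ.⊔ N₂ , λ m n N≤m N≤n →
  let a = seq x m ; b = seq x n ; c = seq y m ; d = seq y n in
  ≤-<-trans
    (subst (λ t → ∣ t ∣ ≤ ∣ a - b ∣ + ∣ c - d ∣)
      (solve 4 (λ a b c d → (a :- b) :- (c :- d) := (a :- c) :- (b :- d)) refl a b c d)
      (∣p-q∣≤∣p∣+∣q∣ (a - b) (c - d)))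
    (thirds₂ 0<ε
      (h₁ m n (ℕ.m⊔n≤o⇒m≤o N₁ N₂ N≤m) (ℕ.m⊔n≤o⇒m≤o N₁ N₂ N≤n))
      (h₂ m n (ℕ.m⊔n≤o⇒n≤o N₁ N₂ N≤m) (ℕ.m⊔n≤o⇒n≤o N₁ N₂ N≤n)))
  where open +-*-Solver

∣_∣ᴿ : ℝ → ℝ
seq    ∣ x ∣ᴿ n = ∣ seq x n ∣
cauchy ∣ x ∣ᴿ ε 0<ε with cauchy x ε 0<ε
... | N , h = N , λ m n N≤m N≤n →
  ≤-<-trans (-∣∣-mono (seq x m) (seq x n)) (h m n N≤m N≤n)

_÷ᴿ_ : ℝ → (n : ℕ) → .{{ℕ.NonZero n}} → ℝ
seq    (x ÷ᴿ suc k) n = seq x n * (+ 1 / suc k)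
cauchy (x ÷ᴿ suc k) ε 0<ε with cauchy x ε 0<ε
... | N , h = N , λ m n N≤m N≤n → ≤-<-trans (le (seq x m) (seq x n)) (h m n N≤m N≤n)
  where
  open +-*-Solver
  le : ∀ a b → ∣ a * recip k - b * recip k ∣ ≤ ∣ a - b ∣
  le a b = subst₂ _≤_
    (trans (cong (∣ a - b ∣ *_) (sym (0≤p⇒∣p∣≡p (0≤recip k))))
      (trans (sym (∣p*q∣≡∣p∣*∣q∣ (a - b) (recip k)))
        (cong ∣_∣ (solve 3 (λ a b r → (a :- b) :* r := a :* r :- b :* r) refl a b (recip k)))))
    (*-identityʳ ∣ a - b ∣)
    (mulˡ (0≤∣p∣ (a - b)) (recip≤1 k))

infix 4 _⟶_

_⟶_ : (ℕ → ℝ) → ℝ → Set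
a ⟶ s = ∀ ε → 0ℚ < ε → ∃ λ N → ∀ n → N ℕ.≤ n → ∣ a n -ᴿ s ∣ᴿ <ᴿ fromℚ ε

-- expTerm j q = qʲ / j!
expTerm : ℕ → ℚ → ℚ
expTerm zero    q = 1ℚ
expTerm (suc j) q = expTerm j q * q * (+ 1 / suc j)

expSum : ℕ → ℚ → ℚ
expSum zero    q = expTerm zero q
expSum (suc n) q = expSum n q + expTerm (suc n) q

module ExpLemmas where

  open +-*-Solver

  term-nonNeg : ∀ j {q} → 0ℚ ≤ q → 0ℚ ≤ expTerm j q
  term-nonNeg zero    0≤q = nonNegative⁻¹ 1ℚ
  term-nonNeg (suc j) 0≤q = 0≤* (0≤* (term-nonNeg j 0≤q) 0≤q) (0≤recip j)

  term-mono : ∀ j {a b} → 0ℚ ≤ a → a ≤ b → expTerm j a ≤ expTerm j b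
  term-mono zero    0≤a a≤b = ≤-refl
  term-mono (suc j) 0≤a a≤b = mulʳ (0≤recip j)
    (mul (term-nonNeg j 0≤a) (≤-trans 0≤a a≤b) (term-mono j 0≤a a≤b) a≤b)

  term-abs : ∀ j {q M} → ∣ q ∣ ≤ M → ∣ expTerm j q ∣ ≤ expTerm j M
  term-abs zero    q≤M = ≤-refl
  term-abs (suc j) {q} {M} q≤M = subst (_≤ expTerm (suc j) M)
    (sym (trans (∣p*q∣≡∣p∣*∣q∣ (expTerm j q * q) (recip j))
      (cong₂ _*_ (∣p*q∣≡∣p∣*∣q∣ (expTerm j q) q) (0≤p⇒∣p∣≡p (0≤recip j)))))
    (mulʳ (0≤recip j)
      (mul (0≤∣p∣ (expTerm j q)) (≤-trans (0≤∣p∣ q) q≤M) (term-abs j q≤M) q≤M))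

  derivTerm : ℕ → ℚ → ℚ
  derivTerm zero    q = 0ℚ
  derivTerm (suc j) q = expTerm j q

  derivTerm-* : ∀ j q → derivTerm j q * q ≡ ι j * expTerm j q
  derivTerm-* zero    q = trans (*-zeroˡ q) (sym (*-zeroˡ 1ℚ))
  derivTerm-* (suc j) q = sym (trans
    (solve 3 (λ i t r → i :* (t :* r) := t :* (i :* r)) refl
      (ι (suc j)) (expTerm j q * q) (recip j))
    (trans (cong (expTerm j q * q *_) (ι*recip j)) (*-identityʳ _)))

  term-lip : ∀ j {a b M} → ∣ a ∣ ≤ M → ∣ b ∣ ≤ M →
             ∣ expTerm j a - expTerm j b ∣ ≤ derivTerm j M * ∣ a - b ∣
  term-lip zero {a} {b} a≤M b≤M = ≤-reflexive (sym (*-zeroˡ ∣ a - b ∣))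
  term-lip (suc j) {a} {b} {M} a≤M b≤M = subst₂ _≤_ (sym lhs) rhs
    (mulʳ (0≤recip j) (≤-trans (∣p+q∣≤∣p∣+∣q∣ (ta * (a - b)) ((ta - tb) * b)) bound))
    where
    ta = expTerm j a
    tb = expTerm j b
    tM = expTerm j M
    d  = ∣ a - b ∣
    0≤M : 0ℚ ≤ M
    0≤M = ≤-trans (0≤∣p∣ a) a≤M
    lhs : ∣ expTerm (suc j) a - expTerm (suc j) b ∣
          ≡ ∣ ta * (a - b) + (ta - tb) * b ∣ * recip j
    lhs = trans (cong ∣_∣
        (solve 5 (λ a b s t r → s :* a :* r :- t :* b :* r
                                := (s :* (a :- b) :+ (s :- t) :* b) :* r)
          refl a b ta tb (recip j)))
      (trans (∣p*q∣≡∣p∣*∣q∣ (ta * (a - b) + (ta - tb) * b) (recip j))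
        (cong (∣ ta * (a - b) + (ta - tb) * b ∣ *_) (0≤p⇒∣p∣≡p (0≤recip j))))
    bound : ∣ ta * (a - b) ∣ + ∣ (ta - tb) * b ∣ ≤ tM * d + derivTerm j M * d * M
    bound = +-mono-≤
      (subst (_≤ tM * d) (sym (∣p*q∣≡∣p∣*∣q∣ ta (a - b)))
        (mulʳ (0≤∣p∣ (a - b)) (term-abs j a≤M)))
      (subst (_≤ derivTerm j M * d * M) (sym (∣p*q∣≡∣p∣*∣q∣ (ta - tb) b))
        (mul (0≤∣p∣ (ta - tb)) 0≤M (term-lip j a≤M b≤M) b≤M))
    rhs : (tM * d + derivTerm j M * d * M) * recip j ≡ tM * d
    rhs = trans
      (solve 5 (λ t d e m r → (t :* d :+ e :* d :* m) :* r
                              := (t :+ e :* m) :* d :* r)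
        refl tM d (derivTerm j M) M (recip j))
      (trans (cong (λ u → (tM + u) * d * recip j) (derivTerm-* j M))
      (trans (solve 4 (λ t d i r → (t :+ i :* t) :* d :* r
                                   := t :* d :* ((con 1ℚ :+ i) :* r))
               refl tM d (ι j) (recip j))
      (trans (cong (λ u → tM * d * (u * recip j)) (sym (ι-suc j)))
      (trans (cong (tM * d *_) (ι*recip j)) (*-identityʳ _)))))

  sum-step : ∀ n {M} → 0ℚ ≤ M → expSum n M ≤ expSum (suc n) M
  sum-step n {M} 0≤M = subst (_≤ expSum (suc n) M) (+-identityʳ _)
    (+-monoʳ-≤ (expSum n M) (term-nonNeg (suc n) 0≤M))

  sum-up : ∀ k n {M} → 0ℚ ≤ M → expSum n M ≤ expSum (k ℕ.+ n) M
  sum-up zero    n 0≤M = ≤-refl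
  sum-up (suc k) n 0≤M = ≤-trans (sum-up k n 0≤M) (sum-step (k ℕ.+ n) 0≤M)

  derivSum : ℕ → ℚ → ℚ
  derivSum zero    q = 0ℚ
  derivSum (suc n) q = derivSum n q + derivTerm (suc n) q

  derivSum-suc : ∀ n q → derivSum (suc n) q ≡ expSum n q
  derivSum-suc zero    q = refl
  derivSum-suc (suc n) q = cong (_+ expTerm (suc n) q) (derivSum-suc n q)

  derivSum≤ : ∀ n {M} → 0ℚ ≤ M → derivSum n M ≤ expSum n M
  derivSum≤ zero    0≤M = nonNegative⁻¹ 1ℚ
  derivSum≤ (suc n) {M} 0≤M =
    subst (_≤ expSum (suc n) M) (sym (derivSum-suc n M)) (sum-step n 0≤M)

  sum-lip′ : ∀ n {a b M} → ∣ a ∣ ≤ M → ∣ b ∣ ≤ M →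
             ∣ expSum n a - expSum n b ∣ ≤ derivSum n M * ∣ a - b ∣
  sum-lip′ zero {a} {b} a≤M b≤M = ≤-reflexive (sym (*-zeroˡ ∣ a - b ∣))
  sum-lip′ (suc n) {a} {b} {M} a≤M b≤M = subst₂ _≤_
    (cong ∣_∣ (solve 4 (λ s t u v → (s :- t) :+ (u :- v) := (s :+ u) :- (t :+ v)) refl
      (expSum n a) (expSum n b) (expTerm (suc n) a) (expTerm (suc n) b)))
    (sym (*-distribʳ-+ ∣ a - b ∣ (derivSum n M) (derivTerm (suc n) M)))
    (≤-trans (∣p+q∣≤∣p∣+∣q∣ (expSum n a - expSum n b) (expTerm (suc n) a - expTerm (suc n) b))
      (+-mono-≤ (sum-lip′ n a≤M b≤M) (term-lip (suc n) a≤M b≤M)))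

  sum-diff : ∀ k n {q M} → ∣ q ∣ ≤ M →
             ∣ expSum (k ℕ.+ n) q - expSum n q ∣ ≤ expSum (k ℕ.+ n) M - expSum n M
  sum-diff zero n {q} {M} q≤M = ≤-reflexive
    (trans (cong ∣_∣ (+-inverseʳ (expSum n q))) (sym (+-inverseʳ (expSum n M))))
  sum-diff (suc k) n {q} {M} q≤M = subst₂ _≤_
    (cong ∣_∣ (shuffle (expSum (k ℕ.+ n) q) (expSum n q) (expTerm (suc (k ℕ.+ n)) q)))
    (shuffle (expSum (k ℕ.+ n) M) (expSum n M) (expTerm (suc (k ℕ.+ n)) M))
    (≤-trans (∣p+q∣≤∣p∣+∣q∣ (expSum (k ℕ.+ n) q - expSum n q) (expTerm (suc (k ℕ.+ n)) q))
      (+-mono-≤ (sum-diff k n q≤M) (term-abs (suc (k ℕ.+ n)) q≤M)))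
    where
    shuffle : ∀ s t u → (s - t) + u ≡ (s + u) - t
    shuffle = solve 3 (λ s t u → (s :- t) :+ u := (s :+ u) :- t) refl

  module Bounds (M : ℚ) (0≤M : 0ℚ ≤ M) where

    J : ℕ
    J = suc (proj₁ (archimedean (M + M)))

    2M≤J : M + M ≤ ι J
    2M≤J = <⇒≤ (proj₂ (archimedean (M + M)))

    term-half : ∀ n → J ℕ.≤ n → expTerm (suc n) M + expTerm (suc n) M ≤ expTerm n M
    term-half n J≤n = subst₂ _≤_
      (solve 3 (λ t m r → t :* ((m :+ m) :* r) := t :* m :* r :+ t :* m :* r) refl
        (expTerm n M) M (recip n))
      (trans (cong (expTerm n M *_) (ι*recip n)) (*-identityʳ _))
      (mulˡ (term-nonNeg n 0≤M)
        (mulʳ (0≤recip n) (≤-trans 2M≤J (ι-mono (ℕ.m≤n⇒m≤1+n J≤n)))))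

    bracket : ∀ k n → J ℕ.≤ n →
              expSum (k ℕ.+ n) M + expTerm (k ℕ.+ n) M ≤ expSum n M + expTerm n M
    bracket zero    n J≤n = ≤-refl
    bracket (suc k) n J≤n = ≤-trans
      (subst (_≤ expSum (k ℕ.+ n) M + expTerm (k ℕ.+ n) M)
        (sym (+-assoc (expSum (k ℕ.+ n) M) (expTerm (suc (k ℕ.+ n)) M) _))
        (+-monoʳ-≤ (expSum (k ℕ.+ n) M)
          (term-half (k ℕ.+ n) (ℕ.≤-trans J≤n (ℕ.m≤n+m n k)))))
      (bracket k n J≤n)

    sum≤ : ∀ k n → J ℕ.≤ n → expSum (k ℕ.+ n) M ≤ expSum n M + expTerm n M
    sum≤ k n J≤n = ≤-trans
      (subst (_≤ expSum (k ℕ.+ n) M + expTerm (k ℕ.+ n) M) (+-identityʳ _)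
        (+-monoʳ-≤ (expSum (k ℕ.+ n) M) (term-nonNeg (k ℕ.+ n) 0≤M)))
      (bracket k n J≤n)

    B : ℚ
    B = expSum J M + expTerm J M

    sum≤B : ∀ n → expSum n M ≤ B
    sum≤B n = ≤-trans (sum-up J n 0≤M)
      (subst (λ k → expSum k M ≤ B) (ℕ.+-comm n J) (sum≤ n J ℕ.≤-refl))

    lip : ∀ n {a b} → ∣ a ∣ ≤ M → ∣ b ∣ ≤ M →
          ∣ expSum n a - expSum n b ∣ ≤ B * ∣ a - b ∣
    lip n {a} {b} a≤M b≤M = ≤-trans (sum-lip′ n a≤M b≤M)
      (mulʳ (0≤∣p∣ (a - b)) (≤-trans (derivSum≤ n 0≤M) (sum≤B n)))

    tail′ : ∀ k n {q} → J ℕ.≤ n → ∣ q ∣ ≤ M →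
            ∣ expSum (k ℕ.+ n) q - expSum n q ∣ ≤ expTerm n M
    tail′ k n J≤n q≤M = ≤-trans (sum-diff k n q≤M)
      (subst (expSum (k ℕ.+ n) M - expSum n M ≤_)
        (solve 2 (λ s t → (s :+ t) :- s := t) refl (expSum n M) (expTerm n M))
        (+-monoˡ-≤ (- expSum n M) (sum≤ k n J≤n)))

    term≤B : ∀ n → expTerm n M ≤ B
    term≤B zero    = sum≤B zero
    term≤B (suc n) = ≤-trans
      (subst (_≤ expSum (suc n) M) (+-identityˡ _)
        (+-monoˡ-≤ (expTerm (suc n) M) (≤-trans (nonNegative⁻¹ 1ℚ)
          (subst (λ k → 1ℚ ≤ expSum k M) (ℕ.+-identityʳ n) (sum-up n 0 0≤M)))))
      (sum≤B (suc n))

    term-null : ∀ ε → 0ℚ < ε → ∃ λ N → ∀ n → N ℕ.≤ n → expTerm n M < ε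
    term-null ε 0<ε = suc (proj₁ null) , small
      where
      null = recip-null (B * M) ε 0<ε
      small : ∀ n → suc (proj₁ null) ℕ.≤ n → expTerm n M < ε
      small (suc n) (s≤s N≤n) = ≤-<-trans
        {expTerm n M * M * recip n} {B * M * recip n} {ε}
        (mulʳ {expTerm n M * M} {B * M} {recip n} (0≤recip n)
          (mulʳ {expTerm n M} {B} {M} 0≤M (term≤B n)))
        (proj₂ null n N≤n)

    tail : ∀ ε → 0ℚ < ε → ∃ λ N → ∀ m n → N ℕ.≤ m → N ℕ.≤ n →
           ∀ {q} → ∣ q ∣ ≤ M → ∣ expSum m q - expSum n q ∣ < ε
    tail ε 0<ε = J ℕ.⊔ N , go
      where
      N = proj₁ (term-null ε 0<ε)
      h = proj₂ (term-null ε 0<ε)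
      up : ∀ m n → J ℕ.⊔ N ℕ.≤ n → n ℕ.≤ m →
           ∀ {q} → ∣ q ∣ ≤ M → ∣ expSum m q - expSum n q ∣ < ε
      up m n N≤n n≤m {q} q≤M = ≤-<-trans
        (subst (λ k → ∣ expSum k q - expSum n q ∣ ≤ expTerm n M) (ℕ.m∸n+n≡m n≤m)
          (tail′ (m ℕ.∸ n) n (ℕ.m⊔n≤o⇒m≤o J N N≤n) q≤M))
        (h n (ℕ.m⊔n≤o⇒n≤o J N N≤n))
      go : ∀ m n → J ℕ.⊔ N ℕ.≤ m → J ℕ.⊔ N ℕ.≤ n →
           ∀ {q} → ∣ q ∣ ≤ M → ∣ expSum m q - expSum n q ∣ < ε
      go m n N≤m N≤n {q} q≤M = [ (λ n≤m → up m n N≤n n≤m q≤M)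
        , (λ m≤n → subst (_< ε) (∣-∣-sym (expSum n q) (expSum m q)) (up n m N≤m m≤n q≤M))
        ]′ (ℕ.≤-total n m)

  exp-cauchy : ∀ x → Cauchy (λ n → expSum n (seq x n))
  exp-cauchy x ε 0<ε = N₁ ℕ.⊔ (N₂ ℕ.⊔ N₃) , main
    where
    t₁ = cauchy x 1ℚ (positive⁻¹ 1ℚ)
    N₁ = proj₁ t₁
    h₁ = proj₂ t₁
    M : ℚ
    M = ∣ seq x N₁ ∣ + 1ℚ
    open Bounds M (0≤+ (0≤∣p∣ (seq x N₁)) (nonNegative⁻¹ 1ℚ))
    bounded : ∀ n → N₁ ℕ.≤ n → ∣ seq x n ∣ ≤ M
    bounded n N₁≤n = subst (λ t → ∣ t ∣ ≤ M)
      (solve 2 (λ a b → a :+ (b :- a) := b) refl (seq x N₁) (seq x n))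
      (≤-trans (∣p+q∣≤∣p∣+∣q∣ (seq x N₁) (seq x n - seq x N₁))
        (+-monoʳ-≤ ∣ seq x N₁ ∣ (<⇒≤ (h₁ n N₁ N₁≤n ℕ.≤-refl))))
    t₂ = tail (ε * third) (third-pos 0<ε)
    N₂ = proj₁ t₂
    sh = shrink B (ε * third) (third-pos 0<ε)
    t₃ = cauchy x (proj₁ sh) (proj₁ (proj₂ sh))
    N₃ = proj₁ t₃
    main : ∀ m n → N₁ ℕ.⊔ (N₂ ℕ.⊔ N₃) ℕ.≤ m → N₁ ℕ.⊔ (N₂ ℕ.⊔ N₃) ℕ.≤ n →
           ∣ expSum m (seq x m) - expSum n (seq x n) ∣ < ε
    main m n N≤m N≤n = ≤-<-trans
      (∣-∣-tri (expSum m (seq x m)) (expSum n (seq x m)) (expSum n (seq x n)))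
      (thirds₂ 0<ε
        (proj₂ t₂ m n (ℕ.m⊔n≤o⇒m≤o N₂ N₃ m₂₃) (ℕ.m⊔n≤o⇒m≤o N₂ N₃ n₂₃) bm)
        (≤-<-trans (lip n bm bn)
          (proj₂ (proj₂ sh) (0≤∣p∣ (seq x m - seq x n))
            (proj₂ t₃ m n (ℕ.m⊔n≤o⇒n≤o N₂ N₃ m₂₃) (ℕ.m⊔n≤o⇒n≤o N₂ N₃ n₂₃)))))
      where
      m₂₃ = ℕ.m⊔n≤o⇒n≤o N₁ (N₂ ℕ.⊔ N₃) N≤m
      n₂₃ = ℕ.m⊔n≤o⇒n≤o N₁ (N₂ ℕ.⊔ N₃) N≤n
      bm = bounded m (ℕ.m⊔n≤o⇒m≤o N₁ (N₂ ℕ.⊔ N₃) N≤m)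
      bn = bounded n (ℕ.m⊔n≤o⇒m≤o N₁ (N₂ ℕ.⊔ N₃) N≤n)

exp : ℝ → ℝ
exp x = mkℝ (λ n → expSum n (seq x n)) (ExpLemmas.exp-cauchy x)

module LogLemmas where

  open ExpLemmas

  grid : ℕ → ℕ → ℚ
  grid k i = (+ i / 1) * (+ 1 / suc k)

  search : ℕ → ℕ → ℕ → ℕ
  search m k zero    = zero
  search m k (suc i) =
    if does (expSum k (grid k (suc i)) ≤? (+ m / 1)) then suc i else search m k i

  logSeq : ℕ → ℕ → ℚ
  logSeq m k = grid k (search m k (m ℕ.* suc k))

  grid-nonNeg : ∀ k i → 0ℚ ≤ grid k i
  grid-nonNeg k i = 0≤* {ι i} {recip k} (0≤ι i) (0≤recip k)

  grid-max : ∀ m k → grid k (m ℕ.* suc k) ≡ ι m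
  grid-max m k = trans (cong (_* recip k) (ι-* m (suc k)))
    (trans (*-assoc (ι m) (ι (suc k)) (recip k))
      (trans (cong (ι m *_) (ι*recip k)) (*-identityʳ (ι m))))

  grid-mono : ∀ k {i j} → i ℕ.≤ j → grid k i ≤ grid k j
  grid-mono k {i} {j} i≤j = mulʳ {ι i} {ι j} {recip k} (0≤recip k) (ι-mono i≤j)

  grid-suc : ∀ k i → grid k (suc i) ≡ recip k + grid k i
  grid-suc k i = trans (cong (_* recip k) (ι-suc i))
    (trans (*-distribʳ-+ (recip k) 1ℚ (ι i))
      (cong (_+ grid k i) (*-identityˡ (recip k))))

  expTerm-0 : ∀ j → expTerm (suc j) 0ℚ ≡ 0ℚ
  expTerm-0 j = trans (cong (_* recip j) (*-zeroʳ (expTerm j 0ℚ))) (*-zeroˡ (recip j))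

  expSum-0 : ∀ k → expSum k 0ℚ ≡ 1ℚ
  expSum-0 zero    = refl
  expSum-0 (suc k) = trans (cong₂ _+_ (expSum-0 k) (expTerm-0 k)) (+-identityʳ 1ℚ)

  record Found (m k bound i : ℕ) : Set where
    field
      i≤bound : i ℕ.≤ bound
      below   : i ≡ 0 ⊎ expSum k (grid k i) ≤ ι m
      above   : i ≡ bound ⊎ ι m < expSum k (grid k (suc i))

  found-step : ∀ m k b s (d : Dec (expSum k (grid k (suc b)) ≤ ι m)) →
               Found m k b s → Found m k (suc b) (if does d then suc b else s)
  found-step m k b s (yes p) f = record
    { i≤bound = ℕ.≤-refl ; below = inj₂ p ; above = inj₁ refl }
  found-step m k b s (no ¬p) f = record
    { i≤bound = ℕ.m≤n⇒m≤1+n (Found.i≤bound f)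
    ; below   = Found.below f
    ; above   = inj₂ ([ (λ e → subst (λ i → ι m < expSum k (grid k (suc i))) (sym e) (≰⇒> ¬p))
                      , (λ h → h) ]′ (Found.above f))
    }

  search-found : ∀ m k bound → Found m k bound (search m k bound)
  search-found m k zero = record
    { i≤bound = z≤n ; below = inj₁ refl ; above = inj₁ refl }
  search-found m k (suc b) = found-step m k b (search m k b)
    (expSum k (grid k (suc b)) ≤? ι m) (search-found m k b)

  1+q≤expSum : ∀ k {q} → 0ℚ ≤ q → 1ℚ + q ≤ expSum (suc k) q
  1+q≤expSum zero {q} 0≤q = ≤-reflexive (cong (λ t → 1ℚ + t)
    (sym (trans (*-identityʳ (1ℚ * q)) (*-identityˡ q))))
  1+q≤expSum (suc k) {q} 0≤q = ≤-trans (1+q≤expSum k 0≤q) (sum-step (suc k) 0≤q)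

  slope : ∀ k {a b} → 0ℚ ≤ a → a ≤ b →
          b - a ≤ expSum (suc k) b - expSum (suc k) a
  slope zero {a} {b} 0≤a a≤b = ≤-reflexive (sym (trans
    (cong₂ (λ s t → (1ℚ + s) - (1ℚ + t)) (one b) (one a))
    (solve 2 (λ a b → (con 1ℚ :+ b) :- (con 1ℚ :+ a) := b :- a) refl a b)))
    where
    open +-*-Solver
    one : ∀ q → 1ℚ * q * 1ℚ ≡ q
    one q = trans (*-identityʳ (1ℚ * q)) (*-identityˡ q)
  slope (suc k) {a} {b} 0≤a a≤b = ≤-trans (slope k 0≤a a≤b) (subst₂ _≤_
    (+-identityʳ (expSum (suc k) b - expSum (suc k) a))
    (rearrange (expSum (suc k) b) (expSum (suc k) a)
      (expTerm (suc (suc k)) b) (expTerm (suc (suc k)) a))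
    (+-monoʳ-≤ (expSum (suc k) b - expSum (suc k) a)
      (≤⇒0≤- (term-mono (suc (suc k)) 0≤a a≤b))))
    where
    open +-*-Solver
    rearrange : ∀ s t u v → (s - t) + (u - v) ≡ (s + u) - (t + v)
    rearrange = solve 4 (λ s t u v → (s :- t) :+ (u :- v) := (s :+ u) :- (t :+ v)) refl

  expSum-expands : ∀ k {a b} → 0ℚ ≤ a → 0ℚ ≤ b →
                   ∣ a - b ∣ ≤ ∣ expSum (suc k) a - expSum (suc k) b ∣
  expSum-expands k {a} {b} 0≤a 0≤b = [ up a b 0≤a , down ]′ (≤-total a b)
    where
    up : ∀ a b → 0ℚ ≤ a → a ≤ b → ∣ a - b ∣ ≤ ∣ expSum (suc k) a - expSum (suc k) b ∣
    up a b 0≤a a≤b = subst₂ _≤_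
      (trans (sym (0≤p⇒∣p∣≡p (≤⇒0≤- a≤b))) (∣-∣-sym b a))
      (∣-∣-sym (expSum (suc k) b) (expSum (suc k) a))
      (≤-trans (slope k 0≤a a≤b) (p≤∣p∣ (expSum (suc k) b - expSum (suc k) a)))
    down : b ≤ a → ∣ a - b ∣ ≤ ∣ expSum (suc k) a - expSum (suc k) b ∣
    down b≤a = subst₂ _≤_ (∣-∣-sym b a) (∣-∣-sym (expSum (suc k) b) (expSum (suc k) a))
      (up b a 0≤b b≤a)

  module Approximation (m′ : ℕ) where

    m : ℕ
    m = suc m′

    open Bounds (ι (suc m)) (0≤ι (suc m))

    module _ (k : ℕ) where

      i = search m k (m ℕ.* suc k)

      open Found (search-found m k (m ℕ.* suc k)) public

      log≤m : logSeq m k ≤ ι m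
      log≤m = subst (logSeq m k ≤_) (grid-max m k) (grid-mono k i≤bound)

      log≤M : logSeq m k ≤ ι (suc m)
      log≤M = ≤-trans log≤m (ι-mono (ℕ.n≤1+n m))

      0≤log : 0ℚ ≤ logSeq m k
      0≤log = grid-nonNeg k i

      ∣log∣≤M : ∣ logSeq m k ∣ ≤ ι (suc m)
      ∣log∣≤M = subst (_≤ ι (suc m)) (sym (0≤p⇒∣p∣≡p 0≤log)) log≤M

      ∣next∣≤M : ∣ grid k (suc i) ∣ ≤ ι (suc m)
      ∣next∣≤M = subst₂ _≤_
        (trans (sym (grid-suc k i)) (sym (0≤p⇒∣p∣≡p (grid-nonNeg k (suc i)))))
        (sym (ι-suc m))
        (+-mono-≤ (recip≤1 k) log≤m)

      exp≤m : expSum k (logSeq m k) ≤ ι m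
      exp≤m = [ (λ e → subst (_≤ ι m) (sym (trans
                    (cong (λ i → expSum k (grid k i)) e)
                    (trans (cong (expSum k) (*-zeroˡ (recip k))) (expSum-0 k))))
                  (ι-mono {1} {m} (s≤s z≤n)))
              , (λ h → h) ]′ below

    m<next : ∀ k → ι m < expSum (suc k) (grid (suc k) (suc (i (suc k))))
    m<next k = [ (λ e → ⊥-elim (<-irrefl refl (<-≤-trans m<exp-m
                   (subst (λ i → expSum (suc k) (grid (suc k) i) ≤ ι m) e (exp≤m (suc k))))))
               , (λ h → h) ]′ (above (suc k))
      where
      m<exp-m : ι m < expSum (suc k) (grid (suc k) (m ℕ.* suc (suc k)))
      m<exp-m = subst (λ q → ι m < expSum (suc k) q) (sym (grid-max m (suc k)))
        (<-≤-trans (subst (_< 1ℚ + ι m) (+-identityˡ (ι m))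
            (+-monoˡ-< (ι m) (positive⁻¹ 1ℚ)))
          (1+q≤expSum k (0≤ι m)))

    close : ∀ k → ∣ expSum (suc k) (logSeq m (suc k)) - ι m ∣ ≤ B * recip (suc k)
    close k = begin
      ∣ E₀ - ι m ∣            ≡⟨ ∣-∣-sym E₀ (ι m) ⟩
      ∣ ι m - E₀ ∣            ≡⟨ 0≤p⇒∣p∣≡p (≤⇒0≤- (exp≤m (suc k))) ⟩
      ι m - E₀                ≤⟨ +-monoˡ-≤ (- E₀) (<⇒≤ (m<next k)) ⟩
      E₁ - E₀                 ≤⟨ p≤∣p∣ (E₁ - E₀) ⟩
      ∣ E₁ - E₀ ∣             ≤⟨ lip (suc k) (∣next∣≤M (suc k)) (∣log∣≤M (suc k)) ⟩
      B * ∣ r₁ - r₀ ∣         ≡⟨ cong (B *_) gap ⟩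
      B * recip (suc k)       ∎
      where
      open ≤-Reasoning
      r₀ = logSeq m (suc k)
      r₁ = grid (suc k) (suc (i (suc k)))
      E₀ = expSum (suc k) r₀
      E₁ = expSum (suc k) r₁
      cancel : ∀ a b → (a + b) - b ≡ a
      cancel = solve 2 (λ a b → (a :+ b) :- b := a) refl
        where open +-*-Solver
      gap : ∣ r₁ - r₀ ∣ ≡ recip (suc k)
      gap = trans (cong (λ q → ∣ q - r₀ ∣) (grid-suc (suc k) (i (suc k))))
        (trans (cong ∣_∣ (cancel (recip (suc k)) r₀)) (0≤p⇒∣p∣≡p (0≤recip (suc k))))

    converges : ∀ ε → 0ℚ < ε →
                ∃ λ N → ∀ k → N ℕ.≤ k → ∣ expSum k (logSeq m k) - ι m ∣ < ε
    converges ε 0<ε = suc (proj₁ null) , small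
      where
      null = recip-null B ε 0<ε
      small : ∀ k → suc (proj₁ null) ℕ.≤ k → ∣ expSum k (logSeq m k) - ι m ∣ < ε
      small (suc k) (s≤s N≤k) =
        ≤-<-trans {∣ expSum (suc k) (logSeq m (suc k)) - ι m ∣} {B * recip (suc k)} {ε}
          (close k) (proj₂ null (suc k) (ℕ.m≤n⇒m≤1+n N≤k))

    log-cauchy : Cauchy (logSeq m)
    log-cauchy ε 0<ε = suc (N₁ ℕ.⊔ N₂) , main
      where
      t₁ = tail (ε * third) (third-pos 0<ε)
      N₁ = proj₁ t₁
      t₂ = converges (ε * third) (third-pos 0<ε)
      N₂ = proj₁ t₂
      main : ∀ k l → suc (N₁ ℕ.⊔ N₂) ℕ.≤ k → suc (N₁ ℕ.⊔ N₂) ℕ.≤ l →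
             ∣ logSeq m k - logSeq m l ∣ < ε
      main (suc k) (suc l) (s≤s N≤k) (s≤s N≤l) = begin-strict
        ∣ a - b ∣                                   ≤⟨ expSum-expands l (0≤log (suc k)) (0≤log (suc l)) ⟩
        ∣ F a - F b ∣                               ≤⟨ ∣-∣-tri (F a) (E a) (F b) ⟩
        ∣ F a - E a ∣ + ∣ E a - F b ∣               ≤⟨ +-monoʳ-≤ ∣ F a - E a ∣ (∣-∣-tri (E a) (ι m) (F b)) ⟩
        ∣ F a - E a ∣ + (∣ E a - ι m ∣ + ∣ ι m - F b ∣)
          <⟨ +-mono-< (proj₂ t₁ (suc l) (suc k) (N₁≤ N≤l) (N₁≤ N≤k) {a} (∣log∣≤M (suc k)))
               (+-mono-< (proj₂ t₂ (suc k) (N₂≤ N≤k))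
                 (subst (_< ε * third) (∣-∣-sym (F b) (ι m)) (proj₂ t₂ (suc l) (N₂≤ N≤l)))) ⟩
        ε * third + (ε * third + ε * third)         ≡⟨ thirds ε ⟩
        ε                                           ∎
        where
        open ≤-Reasoning
        a = logSeq m (suc k)
        b = logSeq m (suc l)
        E = expSum (suc k)
        F = expSum (suc l)
        N₁≤ : ∀ {n} → N₁ ℕ.⊔ N₂ ℕ.≤ n → N₁ ℕ.≤ suc n
        N₁≤ h = ℕ.m≤n⇒m≤1+n (ℕ.m⊔n≤o⇒m≤o N₁ N₂ h)
        N₂≤ : ∀ {n} → N₁ ℕ.⊔ N₂ ℕ.≤ n → N₂ ℕ.≤ suc n
        N₂≤ h = ℕ.m≤n⇒m≤1+n (ℕ.m⊔n≤o⇒n≤o N₁ N₂ h)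

-- The k-th approximation to log m is the largest i/(k+1) ≤ m at which the
-- k-th partial sum of the exponential series does not exceed m; exp-log
-- shows that this gives the inverse of exp.  By convention log 0 = 0.
log : ℕ → ℝ
log zero    = fromℚ 0ℚ
log (suc m) = mkℝ (LogLemmas.logSeq (suc m)) (LogLemmas.Approximation.log-cauchy m)

exp-log : ∀ m → .{{ℕ.NonZero m}} → exp (log m) ≃ᴿ fromℚ (+ m / 1)
exp-log (suc m) = LogLemmas.Approximation.converges m

data Orientation : Set where
  alongX alongY : Orientation

-- Minimal corner (x , y , z); alongX is [x,x+4]×[y,y+2]×[z,z+1] and
-- alongY is [x,x+2]×[y,y+4]×[z,z+1].
record Block : Set where
  constructor block
  field
    orientation : Orientation
    x y z       : ℤ

lengthX lengthY : Orientation → ℤ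
lengthX alongX = + 4
lengthX alongY = + 2
lengthY alongX = + 2
lengthY alongY = + 4

-- Stud (i , j) is the unit square [i,i+1]×[j,j+1].
HasStud : Block → ℤ → ℤ → Set
HasStud (block o x y _) i j =
  (x ℤ.≤ i × i ℤ.< x ℤ.+ lengthX o) × (y ℤ.≤ j × j ℤ.< y ℤ.+ lengthY o)

-- The corners being integral, the xy-projections of two blocks overlap in a
-- set with nonempty interior iff both contain a common unit square.
ProjectionsOverlap : Block → Block → Set
ProjectionsOverlap b c = ∃₂ λ i j → HasStud b i j × HasStud c i j

InteriorsDisjoint : Block → Block → Set
InteriorsDisjoint b c = ¬ (Block.z b ≡ Block.z c × ProjectionsOverlap b c)

Attached : Block → Block → Set
Attached b c = ℤ.∣ Block.z b ℤ.- Block.z c ∣ ≡ 1 × ProjectionsOverlap b c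

-- A set of n blocks, listed in some order; disjointness makes the listing
-- injective, and _≅_ below forgets the order.
record Building (n : ℕ) : Set where
  field
    blocks   : Fin n → Block
    disjoint : ∀ i j → i ≢ j → InteriorsDisjoint (blocks i) (blocks j)

open Building public

Contiguous : ∀ {n} → Building n → Set
Contiguous b = ∀ i j → Star (λ k l → Attached (blocks b k) (blocks b l)) i j

ContiguousBuilding : ℕ → Set
ContiguousBuilding n = Σ (Building n) Contiguous

-- Only integral translations can carry a nonempty building to a building,
-- and a rotation by a multiple of 90° about another vertical axis is a
-- translation composed with a power of the quarter turn about the origin.
data Motion : Set where
  translate   : (u v w : ℤ) → Motion
  quarterTurn : Motion
  _∘ᴹ_        : Motion → Motion → Motion

turn : Orientation → Orientation
turn alongX = alongY
turn alongY = alongX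

-- The quarter turn (p , q) ↦ (- q , p) maps [x,x+a]×[y,y+b] to
-- [-(y+b),-y]×[x,x+a].
_·_ : Motion → Block → Block
translate u v w · block o x y z = block o (x ℤ.+ u) (y ℤ.+ v) (z ℤ.+ w)
quarterTurn     · block o x y z = block (turn o) (ℤ.- (y ℤ.+ lengthY o)) x z
(g ∘ᴹ h)        · b             = g · (h · b)

inverse : Motion → Motion
inverse (translate u v w) = translate (ℤ.- u) (ℤ.- v) (ℤ.- w)
inverse quarterTurn       = quarterTurn ∘ᴹ (quarterTurn ∘ᴹ quarterTurn)
inverse (g ∘ᴹ h)          = inverse h ∘ᴹ inverse g

block-cong : ∀ {o x x′ y y′ z z′} → x ≡ x′ → y ≡ y′ → z ≡ z′ →
             block o x y z ≡ block o x′ y′ z′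
block-cong refl refl refl = refl

inverse-· : ∀ g b → inverse g · (g · b) ≡ b
inverse-· (translate u v w) (block o x y z) = block-cong (cancel x u) (cancel y v) (cancel z w)
  where
  cancel : ∀ a b → (a ℤ.+ b) ℤ.+ (ℤ.- b) ≡ a
  cancel = solve-∀
inverse-· quarterTurn (block o x y z) = go o
  where
  cancel : ∀ a b → ℤ.- (ℤ.- (a ℤ.+ b) ℤ.+ b) ≡ a
  cancel = solve-∀
  go : ∀ o → inverse quarterTurn · (quarterTurn · block o x y z) ≡ block o x y z
  go alongX = block-cong (cancel x (+ 4)) (cancel y (+ 2)) refl
  go alongY = block-cong (cancel x (+ 2)) (cancel y (+ 4)) refl
inverse-· (g ∘ᴹ h) b = trans (cong (inverse h ·_) (inverse-· g (h · b))) (inverse-· h b)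

-- The image of one set of blocks under some motion is the other set.
_≅_ : ∀ {n} → Building n → Building n → Set
b ≅ c = ∃ λ g → (∀ i → ∃ λ j → g · blocks b i ≡ blocks c j)
              × (∀ j → ∃ λ i → g · blocks b i ≡ blocks c j)

≅-refl : ∀ {n} (b : Building n) → b ≅ b
≅-refl b = translate (+ 0) (+ 0) (+ 0) , (λ i → i , fix (blocks b i)) , (λ i → i , fix (blocks b i))
  where
  fix : ∀ c → translate (+ 0) (+ 0) (+ 0) · c ≡ c
  fix (block o x y z) = block-cong (ℤ.+-identityʳ x) (ℤ.+-identityʳ y) (ℤ.+-identityʳ z)

≅-sym : ∀ {n} (b c : Building n) → b ≅ c → c ≅ b
≅-sym b c (g , f , h) = inverse g
  , (λ j → let i , e = h j in i , back e)
  , (λ i → let j , e = f i in j , back e)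
  where
  back : ∀ {p q} → g · p ≡ q → inverse g · q ≡ p
  back {p} refl = inverse-· g p

≅-trans : ∀ {n} (b c d : Building n) → b ≅ c → c ≅ d → b ≅ d
≅-trans b c d (g , f , h) (g′ , f′ , h′) = g′ ∘ᴹ g
  , (λ i → let j , e = f i ; k , e′ = f′ j in k , trans (cong (g′ ·_) e) e′)
  , (λ k → let j , e′ = h′ k ; i , e = h j in i , trans (cong (g′ ·_) e) e′)

contiguousBuildings : ℕ → Setoid 0ℓ 0ℓ
contiguousBuildings n = record
  { Carrier       = ContiguousBuilding n
  ; _≈_           = λ b c → proj₁ b ≅ proj₁ c
  ; isEquivalence = record
    { refl  = λ {b} → ≅-refl (proj₁ b)
    ; sym   = λ {b} {c} → ≅-sym (proj₁ b) (proj₁ c)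
    ; trans = λ {b} {c} {d} → ≅-trans (proj₁ b) (proj₁ c) (proj₁ d)
    }
  }

HasCardinality : Setoid 0ℓ 0ℓ → ℕ → Set
HasCardinality S t = Bijection (setoid (Fin t)) S

{-# OPTIONS --safe #-}
-- Towers all of whose layers consist of one or two bricks already grow fast
-- enough.  A tower is built layer by layer from a single brick; up to plane
-- isometries its top layer is a single brick or a pair of bricks, and for a
-- pair one records whether its bricks are already connected through lower
-- layers.  Restricting the centres of a pair to differ by at most 7 in both
-- coordinates leaves finitely many states.  A non-negative function v on states with
--   78.4² v(s) ≤ 78.4 Σ v(one-brick continuations) + Σ v(two-brick continuations)
-- forces the number of towers with n bricks to grow at least like 78.4ⁿ.  Towers
-- are determined by their set of bricks, and at most four of them are congruent.
-- Finally exp α is located between 78.32 and 78.4 for α = 4.3616, through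
-- (1 + 1/M)^N ≤ exp (N/M) ≤ (1 - 1/M)^(-N).
module Submission where

open import Defs
open import Data.Nat.Base using (ℕ; suc)
open import Data.Integer.Base using (+_)
open import Data.Rational.Base using (_/_)

open import Level using (0ℓ)
open import Data.Bool.Base using (Bool; true; false; T; not; _∧_; _∨_; if_then_else_)
open import Data.Bool.ListAction using (any)
open import Data.Bool.Properties using (T?; T-∧; T-∨; T-≡; T-irrelevant; ∧-comm)
open import Data.Empty using (⊥-elim)
open import Data.Fin.Base as Fin using (Fin)
import Data.Fin.Properties as Fin
open import Data.Integer.Base as ℤ using (ℤ; -[1+_]; _⊖_)
import Data.Integer.Properties as ℤ
import Data.Integer.Tactic.RingSolver as ℤ-Solver
open import Data.List.Base hiding (any; find)
import Data.List.Membership.DecPropositional as DecMembership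
open import Data.List.Membership.Propositional using (_∈_; _∉_; find)
open import Data.List.Membership.Propositional.Properties
import Data.List.Properties as List
open import Data.List.Relation.Unary.All as All using (All; []; _∷_)
import Data.List.Relation.Unary.All.Properties as All
open import Data.List.Relation.Unary.AllPairs as AllPairs using (AllPairs; []; _∷_)
import Data.List.Relation.Unary.AllPairs.Properties as AllPairs
open import Data.List.Relation.Unary.Any using (here; there; index; satisfied)
open import Data.List.Relation.Unary.Any.Properties using (any⁻; lookup-index)
open import Data.List.Relation.Unary.Unique.Propositional using (Unique)
import Data.List.Relation.Unary.Unique.Propositional.Properties as Unique
open import Data.Nat.Base as ℕ using (zero; z≤n; s≤s)
import Data.Nat.DivMod as ℕ
import Data.Nat.Properties as ℕ
import Data.Nat.Tactic.RingSolver as ℕ-Solver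
open import Algebra.Properties.CommutativeSemigroup ℕ.+-commutativeSemigroup
  using (interchange; x∙yz≈y∙xz)
open import Data.Product.Base using (Σ; ∃; ∃₂; _×_; _,_; proj₁; proj₂)
import Data.Rational.Base as ℚ
import Data.Rational.Properties as ℚ
open import Data.Sum.Base using (_⊎_; inj₁; inj₂; [_,_]′; swap)
open import Data.Unit.Base using (tt)
open import Function.Base using (_∘_; id)
open import Function.Bundles using (Bijection; Equivalence)
open import Relation.Binary.Construct.Closure.ReflexiveTransitive as Star using (Star; _◅_; _◅◅_)
open import Relation.Binary.Core using (Rel)
open import Relation.Binary.Definitions using (DecidableEquality; Symmetric)
open import Relation.Binary.PropositionalEquality
open import Relation.Nullary using (¬_; Dec; yes; no; ¬?; contradiction; decidable-stable; toWitness)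
open import Relation.Nullary.Decidable using (map′; _×-dec_)
open import Relation.Unary using (Decidable)

-- The function `v` need not be an exact eigenvector: rounded weights do, as long as 257 states pass
-- a test by evaluation. Pairs whose bricks are not yet connected are kept because a higher layer
-- may still connect them. Such a pair might be impossible to complete, and then the inequality
-- would say nothing about actual towers; hence the test also asks for a completion wherever the
-- weight is positive. A tower is coded by choices relative to the normal form of its top layer, and
-- normalising uses reflections, which are not among the allowed motions. This does no harm: a code
-- is realised as a set of bricks in fixed position, distinct codes give distinct sets, and motions
-- enter only afterwards. Once the rotation is known, the single brick at the bottom leaves no
-- freedom for a translation, whence the factor four. This factor, like every other constant, is
-- swallowed by the strict inequality between the two growth rates.

module Exponential where

  open import Data.Rational.Base
  open import Data.Rational.Properties
  open import Data.Rational.Solver using (module +-*-Solver)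

  open RationalLemmas
  open ExpLemmas
  open LogLemmas
  open +-*-Solver

  -- Partial sums of the exponential series compared with powers, and bounds for logarithms.

  ι-pos : ∀ {n} → 1 ℕ.≤ n → 0ℚ < ι n
  ι-pos {suc n} _ = 0<ι n

  sum-mono : ∀ k {x y} → 0ℚ ≤ x → x ≤ y → expSum k x ≤ expSum k y
  sum-mono zero    0≤x x≤y = ≤-refl
  sum-mono (suc k) 0≤x x≤y = +-mono-≤ (sum-mono k 0≤x x≤y) (term-mono (suc k) 0≤x x≤y)

  sum-nonNeg : ∀ k {x} → 0ℚ ≤ x → 0ℚ ≤ expSum k x
  sum-nonNeg zero    0≤x = nonNegative⁻¹ 1ℚ
  sum-nonNeg (suc k) 0≤x = ≤-trans (sum-nonNeg k 0≤x) (sum-step k 0≤x)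

  -- The derivative of a partial sum is at most the sum itself, so the increment over `d` is at most
  -- `d` times the value at the right end. This is `(1 - d) exp (x + d) ≤ exp x`.
  sum-upper : ∀ k {x d} → 0ℚ ≤ x → 0ℚ ≤ d → expSum k (x + d) ≤ expSum k x + expSum k (x + d) * d
  sum-upper k {x} {d} 0≤x 0≤d = begin
    expSum k y                          ≡⟨ solve 2 (λ a b → a := b :+ (a :- b)) refl (expSum k y) (expSum k x) ⟩
    expSum k x + (expSum k y - expSum k x) ≤⟨ +-monoʳ-≤ (expSum k x) (p≤∣p∣ (expSum k y - expSum k x)) ⟩
    expSum k x + ∣ expSum k y - expSum k x ∣ ≤⟨ +-monoʳ-≤ (expSum k x) (sum-lip′ k (≤-reflexive (0≤p⇒∣p∣≡p 0≤y)) (subst (_≤ y) (sym (0≤p⇒∣p∣≡p 0≤x)) x≤y)) ⟩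
    expSum k x + derivSum k y * ∣ y - x ∣ ≤⟨ +-monoʳ-≤ (expSum k x) (mulʳ (0≤∣p∣ (y - x)) (derivSum≤ k 0≤y)) ⟩
    expSum k x + expSum k y * ∣ y - x ∣  ≡⟨ cong (λ t → expSum k x + expSum k y * t) gap≡ ⟩
    expSum k x + expSum k y * d         ∎
    where
    open ≤-Reasoning
    y = x + d
    0≤y : 0ℚ ≤ y
    0≤y = 0≤+ 0≤x 0≤d
    x≤y : x ≤ y
    x≤y = subst (_≤ y) (+-identityʳ x) (+-monoʳ-≤ x 0≤d)
    gap≡ : ∣ y - x ∣ ≡ d
    gap≡ = trans (cong ∣_∣ (solve 2 (λ x d → (x :+ d) :- x := d) refl x d)) (0≤p⇒∣p∣≡p 0≤d)

  -- Tangent line of the convex function `expTerm j`, by induction on the degree; the part dropped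
  -- in each step is quadratic in `d`.
  term-lower : ∀ j {x d} → 0ℚ ≤ x → 0ℚ ≤ d → expTerm j x + d * derivTerm j x ≤ expTerm j (x + d)
  term-lower zero    {x} {d} _   _   = ≤-reflexive (trans (cong (λ t → 1ℚ + t) (*-zeroʳ d)) (+-identityʳ 1ℚ))
  term-lower (suc j) {x} {d} 0≤x 0≤d = begin
    t * x * r + d * t                          ≡⟨ cong (λ u → t * x * r + d * u) (sym (trans (cong (t *_) (ι*recip j)) (*-identityʳ t))) ⟩
    t * x * r + d * (t * (ι (suc j) * r))      ≡⟨ cong (λ u → t * x * r + d * (t * (u * r))) (ι-suc j) ⟩
    t * x * r + d * (t * ((1ℚ + ι j) * r))     ≡⟨ solve 5 (λ t x d r i → t :* x :* r :+ d :* (t :* ((con 1ℚ :+ i) :* r)) := (t :* (x :+ d) :+ d :* (i :* t)) :* r) refl t x d r (ι j) ⟩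
    (t * (x + d) + d * (ι j * t)) * r          ≡⟨ cong (λ u → (t * (x + d) + d * u) * r) (sym (derivTerm-* j x)) ⟩
    (t * (x + d) + d * (t′ * x)) * r           ≤⟨ mulʳ (0≤recip j) (+-monoʳ-≤ (t * (x + d)) (mulˡ 0≤d (mulˡ 0≤t′ x≤x+d))) ⟩
    (t * (x + d) + d * (t′ * (x + d))) * r     ≡⟨ cong (_* r) (solve 4 (λ t y d t′ → t :* y :+ d :* (t′ :* y) := (t :+ d :* t′) :* y) refl t (x + d) d t′) ⟩
    (t + d * t′) * (x + d) * r                 ≤⟨ mulʳ (0≤recip j) (mulʳ (0≤+ 0≤x 0≤d) (term-lower j 0≤x 0≤d)) ⟩
    expTerm j (x + d) * (x + d) * r            ∎
    where
    open ≤-Reasoning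
    t  = expTerm j x
    t′ = derivTerm j x
    r  = recip j
    x≤x+d : x ≤ x + d
    x≤x+d = subst (_≤ x + d) (+-identityʳ x) (+-monoʳ-≤ x 0≤d)
    0≤t′ : 0ℚ ≤ t′
    0≤t′ = deriv-nonNeg j
      where
      deriv-nonNeg : ∀ j → 0ℚ ≤ derivTerm j x
      deriv-nonNeg zero    = ≤-refl
      deriv-nonNeg (suc j) = term-nonNeg j 0≤x

  sum-lower′ : ∀ k {x d} → 0ℚ ≤ x → 0ℚ ≤ d → expSum k x + d * derivSum k x ≤ expSum k (x + d)
  sum-lower′ zero    {x} {d} _   _   = ≤-reflexive (trans (cong (λ t → 1ℚ + t) (*-zeroʳ d)) (+-identityʳ 1ℚ))
  sum-lower′ (suc k) {x} {d} 0≤x 0≤d = subst (_≤ expSum (suc k) (x + d))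
    (solve 5 (λ s t d u v → (s :+ d :* u) :+ (t :+ d :* v) := (s :+ t) :+ d :* (u :+ v)) refl
      (expSum k x) (expTerm (suc k) x) d (derivSum k x) (derivTerm (suc k) x))
    (+-mono-≤ (sum-lower′ k 0≤x 0≤d) (term-lower (suc k) 0≤x 0≤d))

  -- The derivative of the sum of order `suc k` is the sum of order `k`, so the tangent inequality
  -- raises the order by one.
  sum-lower : ∀ k {x d} → 0ℚ ≤ x → 0ℚ ≤ d → expSum k x * (1ℚ + d) ≤ expSum (suc k) (x + d)
  sum-lower k {x} {d} 0≤x 0≤d = begin
    expSum k x * (1ℚ + d)                          ≡⟨ solve 2 (λ s d → s :* (con 1ℚ :+ d) := s :+ d :* s) refl (expSum k x) d ⟩
    expSum k x + d * expSum k x                    ≤⟨ +-monoˡ-≤ (d * expSum k x) (sum-step k 0≤x) ⟩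
    expSum (suc k) x + d * expSum k x              ≡⟨ cong (λ u → expSum (suc k) x + d * u) (derivSum-suc k x) ⟨
    expSum (suc k) x + d * derivSum (suc k) x      ≤⟨ sum-lower′ (suc k) 0≤x 0≤d ⟩
    expSum (suc k) (x + d)                         ∎
    where open ≤-Reasoning

  -- Here `I` is `1/δ` and `i` is `I - 1`: multiplying `S′ (1 - δ) ≤ S` by `I` gives `S′ i ≤ S I`,
  -- which contributes one more factor to each of the two powers `y` and `Y`.
  upper-step : ∀ {S S′ δ i I y Y} → 0ℚ ≤ y → 0ℚ ≤ I → I ≡ 1ℚ + i → I * δ ≡ 1ℚ →
               S′ ≤ S + S′ * δ → S * y ≤ Y → S′ * (i * y) ≤ I * Y
  upper-step {S} {S′} {δ} {i} {I} {y} {Y} 0≤y 0≤I I≡1+i Iδ≡1 bound ih = begin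
    S′ * (i * y)                      ≡⟨ solve 3 (λ s i y → s :* (i :* y) := (s :* (con 1ℚ :+ i) :- s) :* y) refl S′ i y ⟩
    (S′ * (1ℚ + i) - S′) * y          ≡⟨ cong (λ i → (S′ * i - S′) * y) I≡1+i ⟨
    (S′ * I - S′) * y                 ≤⟨ mulʳ {S′ * I - S′} {(S + S′ * δ) * I - S′} 0≤y (+-monoˡ-≤ (- S′) (mulʳ {S′} {S + S′ * δ} 0≤I bound)) ⟩
    ((S + S′ * δ) * I - S′) * y       ≡⟨ solve 5 (λ s t d i y → ((s :+ t :* d) :* i :- t) :* y := (s :* i :+ t :* (i :* d) :- t) :* y) refl S S′ δ I y ⟩
    (S * I + S′ * (I * δ) - S′) * y   ≡⟨ cong (λ t → (S * I + S′ * t - S′) * y) Iδ≡1 ⟩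
    (S * I + S′ * 1ℚ - S′) * y        ≡⟨ solve 4 (λ s i t y → (s :* i :+ t :* con 1ℚ :- t) :* y := i :* (s :* y)) refl S I S′ y ⟩
    I * (S * y)                       ≤⟨ mulˡ {S * y} {Y} 0≤I ih ⟩
    I * Y                             ∎
    where open ≤-Reasoning

  -- Multiplying `S (1 + δ) ≤ S′` by `I = 1/δ` gives `S J ≤ S′ I`.
  lower-step : ∀ {S S′ δ I J y Y} → 0ℚ ≤ y → 0ℚ ≤ I → 0ℚ ≤ J → J ≡ 1ℚ + I → I * δ ≡ 1ℚ →
               S * (1ℚ + δ) ≤ S′ → Y ≤ S * y → J * Y ≤ S′ * (I * y)
  lower-step {S} {S′} {δ} {I} {J} {y} {Y} 0≤y 0≤I 0≤J J≡1+I Iδ≡1 bound ih = begin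
    J * Y                             ≤⟨ mulˡ {Y} {S * y} 0≤J ih ⟩
    J * (S * y)                       ≡⟨ cong (_* (S * y)) J≡1+I ⟩
    (1ℚ + I) * (S * y)                ≡⟨ cong (λ t → (t + I) * (S * y)) Iδ≡1 ⟨
    (I * δ + I) * (S * y)             ≡⟨ solve 4 (λ i d s y → (i :* d :+ i) :* (s :* y) := (s :* (con 1ℚ :+ d)) :* (i :* y)) refl I δ S y ⟩
    S * (1ℚ + δ) * (I * y)            ≤⟨ mulʳ {S * (1ℚ + δ)} {S′} (0≤* {I} {y} 0≤I 0≤y) bound ⟩
    S′ * (I * y)                      ∎
    where open ≤-Reasoning

  module _ (m : ℕ) where

    grid-step : ∀ j → grid m (suc j) ≡ grid m j + recip m
    grid-step j = trans (grid-suc m j) (+-comm (recip m) (grid m j))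

    exp-grid-0 : ∀ k → expSum k (grid m 0) * 1ℚ ≡ 1ℚ
    exp-grid-0 k = trans (*-identityʳ (expSum k (grid m 0)))
      (trans (cong (expSum k) (*-zeroˡ (recip m))) (expSum-0 k))

    -- (1 - 1/(m+1)) exp (x + 1/(m+1)) ≤ exp x, iterated.
    exp-grid-upper : ∀ k j → expSum k (grid m j) * ι (m ℕ.^ j) ≤ ι (suc m ℕ.^ j)
    exp-grid-upper k zero    = ≤-reflexive (exp-grid-0 k)
    exp-grid-upper k (suc j) = subst₂ _≤_
      (cong (expSum k (grid m (suc j)) *_) (sym (ι-* m (m ℕ.^ j)))) (sym (ι-* (suc m) (suc m ℕ.^ j)))
      (upper-step {expSum k (grid m j)} {expSum k (grid m (suc j))} {recip m} {ι m} {ι (suc m)}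
        {ι (m ℕ.^ j)} {ι (suc m ℕ.^ j)}
        (0≤ι (m ℕ.^ j)) (0≤ι (suc m)) (ι-suc m) (ι*recip m)
        (subst (λ t → expSum k t ≤ expSum k (grid m j) + expSum k t * recip m) (sym (grid-step j))
          (sum-upper k {grid m j} {recip m} (grid-nonNeg m j) (0≤recip m)))
        (exp-grid-upper k j))

    -- This is `(1 + 1/(m+1))^j ≤ exp (j/(m+1))` with denominators cleared. Each of the `j` steps
    -- uses up one order of the partial sum, hence `j + k`.
    exp-grid-lower : ∀ k j → ι ((2 ℕ.+ m) ℕ.^ j) ≤ expSum (j ℕ.+ k) (grid m j) * ι (suc m ℕ.^ j)
    exp-grid-lower k zero    = ≤-reflexive (sym (exp-grid-0 k))
    exp-grid-lower k (suc j) = subst₂ _≤_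
      (sym (ι-* (2 ℕ.+ m) ((2 ℕ.+ m) ℕ.^ j))) (cong (expSum (suc j ℕ.+ k) (grid m (suc j)) *_) (sym (ι-* (suc m) (suc m ℕ.^ j))))
      (lower-step {expSum (j ℕ.+ k) (grid m j)} {expSum (suc j ℕ.+ k) (grid m (suc j))} {recip m} {ι (suc m)} {ι (2 ℕ.+ m)}
        {ι (suc m ℕ.^ j)} {ι ((2 ℕ.+ m) ℕ.^ j)}
        (0≤ι (suc m ℕ.^ j)) (0≤ι (suc m)) (0≤ι (2 ℕ.+ m)) (ι-suc (suc m)) (ι*recip m)
        (subst (λ t → expSum (j ℕ.+ k) (grid m j) * (1ℚ + recip m) ≤ expSum (suc j ℕ.+ k) t) (sym (grid-step j))
          (sum-lower (j ℕ.+ k) {grid m j} {recip m} (grid-nonNeg m j) (0≤recip m)))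
        (exp-grid-lower k j))

  half-gap : ∀ {L S c} → L ≤ S → S + S ≤ c → 1ℚ ≤ c → 1ℚ ≤ (c - L) + (c - L)
  half-gap {L} {S} {c} L≤S 2S≤c 1≤c = begin
    1ℚ                       ≤⟨ 1≤c ⟩
    c                        ≡⟨ solve 1 (λ c → c := (c :+ c) :+ (:- c)) refl c ⟩
    (c + c) - c              ≤⟨ +-monoʳ-≤ (c + c) (neg-antimono-≤ 2S≤c) ⟩
    (c + c) - (S + S)        ≤⟨ +-monoʳ-≤ (c + c) (neg-antimono-≤ (+-mono-≤ L≤S L≤S)) ⟩
    (c + c) - (L + L)        ≡⟨ solve 2 (λ c l → (c :+ c) :- (l :+ l) := (c :- l) :+ (c :- l)) refl c L ⟩
    (c - L) + (c - L)        ∎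
    where open ≤-Reasoning

  -- The terms of `log M` only approximate a logarithm, and the factor 2 in the hypothesis absorbs
  -- the error. Eventually the term `l` has `expSum k l` closer than 1/2 to `M`; but `l ≤ x` would
  -- put `expSum k l` below `M/2`, at distance at least 1/2.
  ≤log : ∀ M {x} → 1 ℕ.≤ M → 0ℚ ≤ x → (∀ k → expSum k x + expSum k x ≤ ι M) →
         ∃ λ N → ∀ k → N ℕ.≤ k → x ≤ seq (log M) k
  ≤log (suc M) {x} _ 0≤x small =
    let N , close = Approximation.converges M ½ (positive⁻¹ ½)
    in N , λ k N≤k → decide k (close k N≤k)
    where
    decide : ∀ k → ∣ expSum k (logSeq (suc M) k) - ι (suc M) ∣ < ½ → x ≤ logSeq (suc M) k
    decide k close = [ (λ x≤l → x≤l) , (λ l≤x → ⊥-elim (absurd l≤x)) ]′ (≤-total x l)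
      where
      l = logSeq (suc M) k
      L = expSum k l
      d = ι (suc M) - L
      d<½ : d < ½
      d<½ = ≤-<-trans {d} {∣ d ∣} {½} (p≤∣p∣ d) (subst (_< ½) (∣-∣-sym L (ι (suc M))) close)
      absurd : l ≤ x → _
      absurd l≤x = <-irrefl {1ℚ} {1ℚ} refl (≤-<-trans {1ℚ} {d + d} {1ℚ}
        (half-gap {L} {expSum k x} {ι (suc M)} (sum-mono k {l} {x} (Approximation.0≤log M k) l≤x) (small k) (ι-mono {1} {suc M} (s≤s z≤n)))
        (+-mono-< {d} {½} {d} {½} d<½ d<½))

  module _ (m A : ℕ) (T : ℕ → ℕ) (n : ℕ) (large : 2 ℕ.* (suc m ℕ.^ A) ℕ.^ suc n ℕ.≤ T (suc n) ℕ.* (m ℕ.^ A) ℕ.^ suc n)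
           (m-pos : 1 ℕ.≤ m) where

    private
      j = A ℕ.* suc n
      b = m ℕ.^ j
      0<b : 1 ℕ.≤ b
      0<b = ℕ.m^n>0 m {{ℕ.>-nonZero m-pos}} j
      large′ : 2 ℕ.* suc m ℕ.^ j ℕ.≤ T (suc n) ℕ.* b
      large′ = subst₂ (λ u v → 2 ℕ.* u ℕ.≤ T (suc n) ℕ.* v) (ℕ.^-*-assoc (suc m) A (suc n)) (ℕ.^-*-assoc m A (suc n)) large

      positive-T : ∀ t → 2 ℕ.* suc m ℕ.^ j ℕ.≤ t ℕ.* b → 1 ℕ.≤ t
      positive-T zero    h = ⊥-elim (ℕ.<⇒≱ (ℕ.*-mono-≤ (s≤s (z≤n {1})) (ℕ.m^n>0 (suc m) j)) h)
      positive-T (suc t) _ = s≤s z≤n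

      double-cancel : ∀ {S B a t} → 0ℚ < B → S * B ≤ a → ι 2 * a ≤ t * B → S + S ≤ t
      double-cancel {S} {B} {a} {t} 0<B SB≤a 2a≤tB = *-cancelʳ-≤-pos {S + S} {t} B {{positive 0<B}} (begin
        (S + S) * B     ≡⟨ solve 2 (λ s b → (s :+ s) :* b := con (ι 2) :* (s :* b)) refl S B ⟩
        ι 2 * (S * B)   ≤⟨ mulˡ {S * B} {a} (0≤ι 2) SB≤a ⟩
        ι 2 * a         ≤⟨ 2a≤tB ⟩
        t * B           ∎)
        where open ≤-Reasoning

      exp≤ : ∀ k → expSum k (grid m j) + expSum k (grid m j) ≤ ι (T (suc n))
      exp≤ k = double-cancel {expSum k (grid m j)} {ι b} {ι (suc m ℕ.^ j)} {ι (T (suc n))} (ι-pos 0<b) (exp-grid-upper m k j)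
        (subst₂ _≤_ (ι-* 2 (suc m ℕ.^ j)) (ι-* (T (suc n)) b) (ι-mono large′))

      rescale : grid m j * recip n ≡ grid m A
      rescale = trans (cong (λ t → t * recip m * recip n) (ι-* A (suc n)))
        (trans (arrange (ι A) (ι (suc n)) (recip m) (recip n))
          (trans (cong (grid m A *_) (ι*recip n)) (*-identityʳ (grid m A))))
        where
        arrange : ∀ a n r s → a * n * r * s ≡ a * r * (n * s)
        arrange = solve 4 (λ a n r s → a :* n :* r :* s := a :* r :* (n :* s)) refl

    -- `large` bounds `T (suc n)` below by twice `(1 - 1/(m+1))^(-j)`, and this power dominates
    -- `exp (j/(m+1))`. Dividing the exponent by `suc n` leaves `A/(m+1)`.
    log-average : ∃ λ N → ∀ k → N ℕ.≤ k → grid m A ≤ seq (log (T (suc n)) ÷ᴿ suc n) k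
    log-average =
      let N , below = ≤log (T (suc n)) {grid m j} (positive-T (T (suc n)) large′) (grid-nonNeg m j) exp≤
      in N , λ k N≤k → subst (_≤ seq (log (T (suc n))) k * recip n) rescale
        (mulʳ {grid m j} {seq (log (T (suc n))) k} {recip n} (0≤recip n) (below k N≤k))

  module _ (m A : ℕ) (a : ℕ → ℝ) (s : ℝ) (a⟶s : a ⟶ s)
           (below : ∃ λ N → ∀ n → N ℕ.≤ n → ∃ λ K → ∀ k → K ℕ.≤ k → grid m (suc A) ≤ seq (a n) k)
    where

    -- Passing to the limit costs one grid step, which is why two consecutive numerators appear in
    -- the numerical bounds.
    limit-lower : ∃ λ K → ∀ k → K ℕ.≤ k → grid m A ≤ seq s k
    limit-lower =
      let N₁ , close = a⟶s (recip m) (0<recip m)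
          N₂ , low = below
          n = N₁ ℕ.+ N₂
          ε , 0<ε , K₁ , near = close n (ℕ.m≤m+n N₁ N₂)
          K₂ , high = low n (ℕ.m≤n+m N₂ N₁)
      in K₁ ℕ.+ K₂ , λ k K≤k → conclude {seq (a n) k} {seq s k} {ε} 0<ε
           (near k (ℕ.≤-trans (ℕ.m≤m+n K₁ K₂) K≤k)) (high k (ℕ.≤-trans (ℕ.m≤n+m K₂ K₁) K≤k))
      where
      conclude : ∀ {u v ε} → 0ℚ < ε → ∣ u - v ∣ + ε < recip m → grid m (suc A) ≤ u → grid m A ≤ v
      conclude {u} {v} {ε} 0<ε near high = begin
        grid m A                         ≡⟨ solve 2 (λ g r → g := (g :+ r) :+ (:- r)) refl (grid m A) (recip m) ⟩
        (grid m A + recip m) - recip m   ≡⟨ cong (_- recip m) (grid-step m A) ⟨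
        grid m (suc A) - recip m         ≤⟨ +-mono-≤ high (neg-antimono-≤ (<⇒≤ {u - v} {recip m} u-v<)) ⟩
        u - (u - v)                      ≡⟨ solve 2 (λ u v → u :- (u :- v) := v) refl u v ⟩
        v                                ∎
        where
        open ≤-Reasoning
        u-v< : u - v < recip m
        u-v< = ≤-<-trans {u - v} {∣ u - v ∣ + ε} {recip m}
          (≤-trans {u - v} {∣ u - v ∣} (p≤∣p∣ (u - v)) (subst (_≤ ∣ u - v ∣ + ε) (+-identityʳ ∣ u - v ∣) (+-monoʳ-≤ ∣ u - v ∣ (<⇒≤ 0<ε))))
          near

  module _ (m A c d : ℕ) (q ε : ℚ) (0<ε : 0ℚ < ε) (big : c ℕ.* suc m ℕ.^ A ℕ.≤ suc d ℕ.* (2 ℕ.+ m) ℕ.^ A)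
           (gap : (q + ε) * ι (suc d) < ι c) (s : ℝ)
           (low : ∃ λ K → ∀ k → K ℕ.≤ k → grid m A ≤ seq s k) where

    -- The chain is `q + ε < c/(d+1) ≤ (1 + 1/(m+1))^A ≤ exp (A/(m+1)) ≤ exp s`, read for partial
    -- sums of order at least `A`.
    exp-lower : fromℚ q <ᴿ exp s
    exp-lower = ε , 0<ε , A ℕ.+ proj₁ low , λ k N≤k →
      *-cancelʳ-<-nonNeg (ι (suc d)) {{nonNegative (0≤ι (suc d))}} {q + ε} {expSum k (seq s k)}
        (<-≤-trans {(q + ε) * ι (suc d)} {ι c} {expSum k (seq s k) * ι (suc d)} gap
          (≤-trans {ι c} {expSum k (grid m A) * ι (suc d)} (grid-bound k (ℕ.≤-trans (ℕ.m≤m+n A (proj₁ low)) N≤k))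
            (mulʳ {expSum k (grid m A)} {expSum k (seq s k)} {ι (suc d)} (0≤ι (suc d))
              (sum-mono k {grid m A} {seq s k} (grid-nonNeg m A) (proj₂ low k (ℕ.≤-trans (ℕ.m≤n+m (proj₁ low) A) N≤k))))))
      where
      y = suc m ℕ.^ A
      cancel : ∀ {S D Y C Z} → 0ℚ < Y → 0ℚ ≤ D → Z ≤ S * Y → C * Y ≤ D * Z → C ≤ S * D
      cancel {S} {D} {Y} {C} {Z} 0<Y 0≤D Z≤ CY≤ = *-cancelʳ-≤-pos {C} {S * D} Y {{positive 0<Y}} (begin
        C * Y         ≤⟨ CY≤ ⟩
        D * Z         ≤⟨ mulˡ {Z} {S * Y} 0≤D Z≤ ⟩
        D * (S * Y)   ≡⟨ solve 3 (λ s d y → d :* (s :* y) := s :* d :* y) refl S D Y ⟩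
        S * D * Y     ∎)
        where open ≤-Reasoning
      grid-bound : ∀ k → A ℕ.≤ k → ι c ≤ expSum k (grid m A) * ι (suc d)
      grid-bound k A≤k = subst (λ k → ι c ≤ expSum k (grid m A) * ι (suc d)) (ℕ.m+[n∸m]≡n A≤k)
        (cancel {expSum (A ℕ.+ (k ℕ.∸ A)) (grid m A)} {ι (suc d)} {ι y} {ι c} {ι ((2 ℕ.+ m) ℕ.^ A)}
          (ι-pos (ℕ.m^n>0 (suc m) A)) (0≤ι (suc d)) (exp-grid-lower m (k ℕ.∸ A) A)
          (subst₂ _≤_ (ι-* c y) (ι-* (suc d) ((2 ℕ.+ m) ℕ.^ A)) (ι-mono big)))

open Exponential
open import Data.Nat.Base hiding (_/_)

-- Sums over lists

Σ[_] : ∀ {A : Set} → List A → (A → ℕ) → ℕ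
Σ[ []     ] f = 0
Σ[ x ∷ xs ] f = f x + Σ[ xs ] f

module _ {A : Set} where

  Σ-++ : ∀ xs {ys} (f : A → ℕ) → Σ[ xs ++ ys ] f ≡ Σ[ xs ] f + Σ[ ys ] f
  Σ-++ []       f = refl
  Σ-++ (x ∷ xs) f = trans (cong (λ t → f x + t) (Σ-++ xs f)) (sym (ℕ.+-assoc (f x) _ _))

  Σ-mono : ∀ xs {f g : A → ℕ} → (∀ x → f x ≤ g x) → Σ[ xs ] f ≤ Σ[ xs ] g
  Σ-mono []       f≤g = z≤n
  Σ-mono (x ∷ xs) f≤g = ℕ.+-mono-≤ (f≤g x) (Σ-mono xs f≤g)

  Σ-cong : ∀ xs {f g : A → ℕ} → (∀ x → f x ≡ g x) → Σ[ xs ] f ≡ Σ[ xs ] g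
  Σ-cong []       f≡g = refl
  Σ-cong (x ∷ xs) f≡g = cong₂ _+_ (f≡g x) (Σ-cong xs f≡g)

  Σ-+ : ∀ xs (f g : A → ℕ) → Σ[ xs ] (λ x → f x + g x) ≡ Σ[ xs ] f + Σ[ xs ] g
  Σ-+ []       f g = refl
  Σ-+ (x ∷ xs) f g = trans (cong (λ t → f x + g x + t) (Σ-+ xs f g)) (interchange (f x) (g x) _ _)

  Σ-*ˡ : ∀ c xs (f : A → ℕ) → Σ[ xs ] (λ x → c * f x) ≡ c * Σ[ xs ] f
  Σ-*ˡ c []       f = sym (ℕ.*-zeroʳ c)
  Σ-*ˡ c (x ∷ xs) f = trans (cong (λ t → c * f x + t) (Σ-*ˡ c xs f)) (sym (ℕ.*-distribˡ-+ c (f x) _))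

  Σ-const : ∀ xs c → Σ[ xs ] (λ (_ : A) → c) ≡ length xs * c
  Σ-const []       c = refl
  Σ-const (x ∷ xs) c = cong (λ t → c + t) (Σ-const xs c)

  Σ-filter : ∀ {P : A → Set} (P? : Decidable P) xs (f : A → ℕ) →
             Σ[ xs ] f ≡ Σ[ filter P? xs ] f + Σ[ filter (¬? ∘ P?) xs ] f
  Σ-filter P? []       f = refl
  Σ-filter P? (x ∷ xs) f with P? x | Σ-filter P? xs f
  ... | yes _ | ih = trans (cong (λ t → f x + t) ih) (sym (ℕ.+-assoc (f x) _ _))
  ... | no  _ | ih = trans (cong (λ t → f x + t) ih) (x∙yz≈y∙xz (f x) (Σ[ filter P? xs ] f) _)

  Σ-tabulate : ∀ (xs : List A) (f : A → ℕ) → Σ[ allFin (length xs) ] (f ∘ lookup xs) ≡ Σ[ xs ] f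
  Σ-tabulate xs f = trans (go (length xs) (λ i → i) (f ∘ lookup xs)) (sum-lookup xs)
    where
    go : ∀ n {m} (g : Fin n → Fin m) (h : Fin m → ℕ) → Σ[ tabulate g ] h ≡ Σ[ tabulate (h ∘ g) ] (λ k → k)
    go zero    g h = refl
    go (suc n) g h = cong (λ t → h (g Fin.zero) + t) (go n (g ∘ Fin.suc) h)
    sum-lookup : ∀ xs → Σ[ tabulate (f ∘ lookup xs) ] (λ k → k) ≡ Σ[ xs ] f
    sum-lookup []       = refl
    sum-lookup (x ∷ xs) = cong (λ t → f x + t) (sum-lookup xs)

module _ {A B : Set} where

  Σ-map : ∀ (g : A → B) xs (f : B → ℕ) → Σ[ map g xs ] f ≡ Σ[ xs ] (f ∘ g)
  Σ-map g []       f = refl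
  Σ-map g (x ∷ xs) f = cong (λ t → f (g x) + t) (Σ-map g xs f)

  Σ-concatMap : ∀ (g : A → List B) xs (f : B → ℕ) → Σ[ concatMap g xs ] f ≡ Σ[ xs ] (λ x → Σ[ g x ] f)
  Σ-concatMap g []       f = refl
  Σ-concatMap g (x ∷ xs) f = trans (Σ-++ (g x) f) (cong (λ t → Σ[ g x ] f + t) (Σ-concatMap g xs f))

  length-concatMap : ∀ (g : A → List B) xs → length (concatMap g xs) ≡ Σ[ xs ] (length ∘ g)
  length-concatMap g []       = refl
  length-concatMap g (x ∷ xs) = trans (List.length-++ (g x)) (cong (λ t → length (g x) + t) (length-concatMap g xs))

  -- The induction deletes `g x` from `ys`; injectivity and uniqueness keep the remaining images
  -- inside what is left.
  Σ-inclusion : ∀ {g : A → B} → (∀ {x y} → g x ≡ g y → x ≡ y) →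
                ∀ {xs ys} → Unique xs → All (λ x → g x ∈ ys) xs →
                ∀ f → Σ[ xs ] (f ∘ g) ≤ Σ[ ys ] f
  Σ-inclusion     inj {[]}     _           _           f = z≤n
  Σ-inclusion {g} inj {x ∷ xs} {ys} (x∉xs ∷ u) (gx∈ys ∷ i) f with ∈-∃++ gx∈ys
  ... | us , vs , refl = begin
      f (g x) + Σ[ xs ] (f ∘ g)             ≤⟨ ℕ.+-monoʳ-≤ (f (g x)) (Σ-inclusion inj u rest f) ⟩
      f (g x) + Σ[ us ++ vs ] f             ≡⟨ cong (λ t → f (g x) + t) (Σ-++ us f) ⟩
      f (g x) + (Σ[ us ] f + Σ[ vs ] f)     ≡⟨ x∙yz≈y∙xz (f (g x)) (Σ[ us ] f) (Σ[ vs ] f) ⟩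
      Σ[ us ] f + (f (g x) + Σ[ vs ] f)     ≡⟨ Σ-++ us f ⟨
      Σ[ us ++ g x ∷ vs ] f                 ∎
    where
    open ℕ.≤-Reasoning
    remove : ∀ {y} us {vs} → y ≢ g x → y ∈ us ++ g x ∷ vs → y ∈ us ++ vs
    remove []       y≢ (here y≡)  = contradiction y≡ y≢
    remove []       y≢ (there y∈) = y∈
    remove (u ∷ us) y≢ (here y≡)  = here y≡
    remove (u ∷ us) y≢ (there y∈) = there (remove us y≢ y∈)
    rest : All (λ y → g y ∈ us ++ vs) xs
    rest = All.zipWith (λ (x≢y , gy∈) → remove us (λ e → x≢y (sym (inj e))) gy∈) (x∉xs , i)

module _ {A : Set} {R : Rel A 0ℓ} (R-sym : Symmetric R) where

  AllPairs-lookup : ∀ {xs} → AllPairs R xs → ∀ i j → i ≢ j → R (lookup xs i) (lookup xs j)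
  AllPairs-lookup (r ∷ rs) Fin.zero    Fin.zero    i≢j = contradiction refl i≢j
  AllPairs-lookup (r ∷ rs) Fin.zero    (Fin.suc j) i≢j = All.lookup r (∈-lookup j)
  AllPairs-lookup (r ∷ rs) (Fin.suc i) Fin.zero    i≢j = R-sym (All.lookup r (∈-lookup i))
  AllPairs-lookup (r ∷ rs) (Fin.suc i) (Fin.suc j) i≢j = AllPairs-lookup rs i j (i≢j ∘ cong Fin.suc)

-- States, steps and their weights

-- A tile is a brick seen from above, given by its centre.
record Tile (A : Set) : Set where
  constructor tile
  field
    dir   : Orientation
    cx cy : A

open Tile public

-- Sum of the half-lengths of both bricks in the given direction: projections overlap exactly when
-- the centres are closer than this in both directions.
reachX reachY : Orientation → Orientation → ℕ
reachX alongX alongX = 4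
reachX alongX alongY = 3
reachX alongY alongX = 3
reachX alongY alongY = 2
reachY o o′ = reachX (turn o) (turn o′)

gap : ℕ → ℕ → ℕ
gap m n = (m ∸ n) + (n ∸ m)

meets : Tile ℕ → Tile ℕ → Bool
meets (tile o x y) (tile o′ x′ y′) = (gap x x′ <ᵇ reachX o o′) ∧ (gap y y′ <ᵇ reachY o o′)

-- The top layer of an unfinished tower, up to plane isometry; "linked" means
-- that the bricks of that layer are known to be connected through lower layers.
data State : Set where
  single : State
  double : (l : Bool) (o : Orientation) (dx dy : ℕ) → State

linked : State → Bool
linked single           = true
linked (double l _ _ _) = l

-- The origin (16 , 16) keeps all coordinates that occur non-negative.
foot₁ : Tile ℕ
foot₁ = tile alongX 16 16

foot₂ : Orientation → ℕ → ℕ → Tile ℕ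
foot₂ o dx dy = tile o (16 + dx) (16 + dy)

feet : State → List (Tile ℕ)
feet single            = foot₁ ∷ []
feet (double _ o dx dy) = foot₁ ∷ foot₂ o dx dy ∷ []

someFoot allFeet : State → (Tile ℕ → Bool) → Bool
someFoot single             P = P foot₁
someFoot (double _ o dx dy) P = P foot₁ ∨ P (foot₂ o dx dy)
allFeet single             P = P foot₁
allFeet (double _ o dx dy) P = P foot₁ ∧ P (foot₂ o dx dy)

interval : ℕ → ℕ → List ℕ
interval start size = applyUpTo (λ t → start + t) size

tile′ : Orientation → ℕ × ℕ → Tile ℕ
tile′ o (x , y) = tile o x y

-- Opaque so that the lists of steps remain symbolic in the general arguments; the enumeration
-- happens only in the blocks that unfold `square`.
opaque
  square : ℕ → ℕ → List (Tile ℕ)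
  square start size = cartesianProductWith tile′
    (alongX ∷ alongY ∷ []) (cartesianProduct (interval start size) (interval start size))

offset : Tile ℕ → Tile ℕ → Tile ℕ
offset (tile _ x y) (tile o′ x′ y′) = tile o′ (x + x′) (y + y′)

-- Offsets up to 7 in both directions are represented by offset p r with r in
-- square 0 15, so the tile p itself becomes offset p (tile _ 7 7).
centre : Tile ℕ → Tile ℕ
centre p = offset p (tile (dir p) 7 7)

-- Coordinates of feet lie between 16 and 23 in the states of interest, and touching centres differ
-- by at most 3. So 13 to 26 suffices, which is the range 6 to 19 of `square 6 14` moved by 7.
touching : State → List (Tile ℕ)
touching s = filter (λ q → T? (someFoot s (meets q))) (map centre (square 6 14))

-- Meant for the only brick that touches the present layer from above: it must meet both bricks of
-- an unlinked pair, since no later brick can reach them.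
covering : State → Tile ℕ → Bool
covering s p = if linked s then someFoot s (meets p) else allFeet s (meets p)

anchors : State → List (Tile ℕ)
anchors s = filter (λ p → T? (covering s (centre p))) (square 6 14)

steps₁ : State → List (Tile ℕ)
steps₁ s = map centre (anchors s)

-- The normal form has an `alongX` brick at the origin. Reflections make the offsets non-negative, a
-- mixed pair is reordered, and two `alongY` bricks are brought into place by exchanging the axes.
key : Bool → Tile ℕ → Tile ℕ → State
key l (tile alongX x y) (tile o      x′ y′) = double l o (gap x x′) (gap y y′)
key l (tile alongY x y) (tile alongX x′ y′) = double l alongY (gap x x′) (gap y y′)
key l (tile alongY x y) (tile alongY x′ y′) = double l alongX (gap y y′) (gap x x′)

pairs : ∀ {A : Set} → List A → List (A × A)
pairs []       = []
pairs (x ∷ xs) = map (x ,_) xs ++ pairs xs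

compatible : State → Tile ℕ × Tile ℕ → Bool
compatible s (p , q) = not (meets p q) ∧ (linked s ∨ allFeet s (λ f → meets p f ∨ meets q f))

links : State → Tile ℕ → Tile ℕ → Bool
links s p q = linked s ∨ someFoot s (λ f → meets p f ∧ meets q f)

record Step : Set where
  constructor step
  field
    fst snd : Tile ℕ
    joined  : Bool

  target : State
  target = key joined fst snd

open Step public

_≟ᵒ_ : DecidableEquality Orientation
alongX ≟ᵒ alongX = yes refl
alongX ≟ᵒ alongY = no λ ()
alongY ≟ᵒ alongX = no λ ()
alongY ≟ᵒ alongY = yes refl

_≟_ : DecidableEquality (Tile ℕ)
tile o x y ≟ tile o′ x′ y′ = map′ (λ { (refl , refl , refl) → refl }) (λ { refl → refl , refl , refl })
  ((o ≟ᵒ o′) ×-dec ((x ℕ.≟ x′) ×-dec (y ℕ.≟ y′)))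

open DecMembership _≟_ using (_∈?_)

around : Orientation → List (Tile ℕ)
around o = filter (λ r → T? (not (meets (tile o 7 7) r))) (square 0 15)

toStep : State → Tile ℕ × Tile ℕ → Step
toStep s (p , q) = step p q (links s p q)

compatiblePairs : State → List (Tile ℕ) → List (Tile ℕ × Tile ℕ)
compatiblePairs s A = filter (λ pq → T? (compatible s pq)) (pairs A)

-- The second brick of a float touches nothing below and has to be connected by
-- a later layer.
float : Tile ℕ → Tile ℕ → Step
float p r = step (centre p) (offset p r) false

free : State → Tile ℕ → List (Tile ℕ)
free s p = filter (λ r → ¬? (offset p r ∈? touching s)) (around (dir p))

floats : State → Tile ℕ → List Step
floats s p = map (float p) (free s p)

steps₂ : State → List Step
steps₂ s = map (toStep s) (compatiblePairs s (touching s)) ++ concatMap (floats s) (anchors s)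

-- An approximate eigenvector, for the eigenvalue 78.4 = 392/5, of the
-- transfer operator given by steps₁ and steps₂.
weights : Bool → Orientation → List (List ℕ)
weights true alongX =
    (0 ∷ 0 ∷ 1746 ∷ 2205 ∷ 2460 ∷ 2675 ∷ 2631 ∷ 2499 ∷ [])
  ∷ (0 ∷ 0 ∷ 1891 ∷ 2288 ∷ 2507 ∷ 2682 ∷ 2635 ∷ 2501 ∷ [])
  ∷ (0 ∷ 0 ∷ 2054 ∷ 2386 ∷ 2566 ∷ 2697 ∷ 2642 ∷ 2503 ∷ [])
  ∷ (0 ∷ 0 ∷ 2218 ∷ 2484 ∷ 2619 ∷ 2704 ∷ 2639 ∷ 2497 ∷ [])
  ∷ (2047 ∷ 2196 ∷ 2370 ∷ 2565 ∷ 2651 ∷ 2688 ∷ 2615 ∷ 2474 ∷ [])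
  ∷ (2319 ∷ 2402 ∷ 2505 ∷ 2621 ∷ 2654 ∷ 2642 ∷ 2567 ∷ 2434 ∷ [])
  ∷ (2390 ∷ 2438 ∷ 2499 ∷ 2567 ∷ 2585 ∷ 2565 ∷ 2494 ∷ 2376 ∷ [])
  ∷ (2429 ∷ 2436 ∷ 2453 ∷ 2471 ∷ 2479 ∷ 2458 ∷ 2397 ∷ 2301 ∷ [])
  ∷ []
weights true alongY =
    (0 ∷ 0 ∷ 0 ∷ 2063 ∷ 2375 ∷ 2488 ∷ 2552 ∷ 2460 ∷ [])
  ∷ (0 ∷ 0 ∷ 0 ∷ 2073 ∷ 2385 ∷ 2496 ∷ 2559 ∷ 2463 ∷ [])
  ∷ (0 ∷ 0 ∷ 0 ∷ 2243 ∷ 2487 ∷ 2557 ∷ 2575 ∷ 2472 ∷ [])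
  ∷ (2063 ∷ 2073 ∷ 2243 ∷ 2426 ∷ 2596 ∷ 2620 ∷ 2592 ∷ 2479 ∷ [])
  ∷ (2375 ∷ 2385 ∷ 2487 ∷ 2596 ∷ 2687 ∷ 2663 ∷ 2588 ∷ 2470 ∷ [])
  ∷ (2488 ∷ 2496 ∷ 2557 ∷ 2620 ∷ 2663 ∷ 2628 ∷ 2549 ∷ 2435 ∷ [])
  ∷ (2552 ∷ 2559 ∷ 2575 ∷ 2592 ∷ 2588 ∷ 2549 ∷ 2475 ∷ 2373 ∷ [])
  ∷ (2460 ∷ 2463 ∷ 2472 ∷ 2479 ∷ 2470 ∷ 2435 ∷ 2373 ∷ 2292 ∷ [])
  ∷ []
weights false alongX =
    (0 ∷ 0 ∷ 641 ∷ 347 ∷ 209 ∷ 35 ∷ 22 ∷ 11 ∷ [])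
  ∷ (0 ∷ 0 ∷ 546 ∷ 287 ∷ 174 ∷ 33 ∷ 21 ∷ 11 ∷ [])
  ∷ (0 ∷ 0 ∷ 454 ∷ 231 ∷ 140 ∷ 30 ∷ 19 ∷ 9 ∷ [])
  ∷ (0 ∷ 0 ∷ 352 ∷ 171 ∷ 104 ∷ 25 ∷ 15 ∷ 7 ∷ [])
  ∷ (475 ∷ 354 ∷ 238 ∷ 106 ∷ 65 ∷ 19 ∷ 11 ∷ 5 ∷ [])
  ∷ (231 ∷ 164 ∷ 101 ∷ 28 ∷ 21 ∷ 13 ∷ 7 ∷ 3 ∷ [])
  ∷ (133 ∷ 96 ∷ 61 ∷ 19 ∷ 14 ∷ 8 ∷ 4 ∷ 2 ∷ [])
  ∷ (18 ∷ 17 ∷ 15 ∷ 12 ∷ 8 ∷ 4 ∷ 2 ∷ 1 ∷ [])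
  ∷ []
weights false alongY =
    (0 ∷ 0 ∷ 0 ∷ 457 ∷ 228 ∷ 136 ∷ 25 ∷ 16 ∷ [])
  ∷ (0 ∷ 0 ∷ 0 ∷ 467 ∷ 232 ∷ 137 ∷ 24 ∷ 15 ∷ [])
  ∷ (0 ∷ 0 ∷ 0 ∷ 355 ∷ 169 ∷ 101 ∷ 21 ∷ 13 ∷ [])
  ∷ (457 ∷ 467 ∷ 355 ∷ 239 ∷ 104 ∷ 63 ∷ 17 ∷ 10 ∷ [])
  ∷ (228 ∷ 232 ∷ 169 ∷ 104 ∷ 28 ∷ 20 ∷ 12 ∷ 7 ∷ [])
  ∷ (136 ∷ 137 ∷ 101 ∷ 63 ∷ 20 ∷ 14 ∷ 8 ∷ 4 ∷ [])
  ∷ (25 ∷ 24 ∷ 21 ∷ 17 ∷ 12 ∷ 8 ∷ 4 ∷ 2 ∷ [])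
  ∷ (16 ∷ 15 ∷ 13 ∷ 10 ∷ 7 ∷ 4 ∷ 2 ∷ 1 ∷ [])
  ∷ []

entry : ∀ {A : Set} → A → List A → ℕ → A
entry d []       _       = d
entry d (x ∷ xs) zero    = x
entry d (x ∷ xs) (suc n) = entry d xs n

weight : State → ℕ
weight single             = 1000
weight (double l o dx dy) = entry 0 (entry [] (weights l o) dx) dy

floatWeight : Tile ℕ → Tile ℕ → ℕ
floatWeight p r = weight (target (float p r))

floatTotal : Orientation → ℕ
floatTotal o = Σ[ around o ] λ r → weight (key false (tile o 7 7) r)

opaque
  unfolding square

  floatTotal≡ : ∀ o → floatTotal o ≡ 39192
  floatTotal≡ alongX = refl
  floatTotal≡ alongY = refl

-- The floats are too many to be enumerated: those at an anchor p have the constant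
-- total weight 39192, except that positions in touching s are excluded; excess
-- bounds the weight of these exceptions.
excess : List (Tile ℕ) → List (Tile ℕ) → ℕ
excess P A = Σ[ P ] λ p → Σ[ A ] λ q → weight (key false p q)

pairTotal : State → List (Tile ℕ) → ℕ
pairTotal s A = Σ[ compatiblePairs s A ] λ pq → weight (target (toStep s pq))

balance : State → List (Tile ℕ) → List (Tile ℕ) → Bool
balance s P A = 392 * 392 * weight s + 5 * 5 * excess P A
  ≤ᵇ 392 * 5 * (length P * weight single) + 5 * 5 * (pairTotal s A + length P * 39192)

-- These two conditions guarantee that an unlinked pair can be completed to a
-- connected tower at all: in two layers, by passing through a pair so close that
-- a single brick covers it (which is the case from weight 60 on).
coverable : State → List (Tile ℕ) → Bool
coverable s P = (weight s <ᵇ 60) ∨ (0 <ᵇ length P)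

improvable : State → List (Tile ℕ) → Bool
improvable s A = any (λ pq → 60 ≤ᵇ weight (target (toStep s pq))) (compatiblePairs s A)

-- The lists are arguments so that they are evaluated only once.
checkWith : State → List (Tile ℕ) → List (Tile ℕ) → Bool
checkWith s P A = (weight s ≡ᵇ 0) ∨ (balance s P A ∧ (coverable s P ∧ improvable s A))

check : State → Bool
check s = checkWith s (steps₁ s) (touching s)

-- From the test to the subharmonic inequality.

gap-shift : ∀ a m n → gap (a + m) (a + n) ≡ gap m n
gap-shift a m n = cong₂ _+_ (ℕ.[m+n]∸[m+o]≡n∸o a m n) (ℕ.[m+n]∸[m+o]≡n∸o a n m)

-- Only differences of coordinates enter `key`, so the weights of the floats at `p` depend on
-- `dir p` alone. This makes their total a constant.
key-offset : ∀ p r → target (float p r) ≡ key false (tile (dir p) 7 7) r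
key-offset (tile alongX x y) (tile o      x′ y′) = cong₂ (double false o) (gap-shift x 7 x′) (gap-shift y 7 y′)
key-offset (tile alongY x y) (tile alongX x′ y′) = cong₂ (double false alongY) (gap-shift x 7 x′) (gap-shift y 7 y′)
key-offset (tile alongY x y) (tile alongY x′ y′) = cong₂ (double false alongX) (gap-shift y 7 y′) (gap-shift x 7 x′)

meets-offset : ∀ p r → meets (centre p) (offset p r) ≡ meets (tile (dir p) 7 7) r
meets-offset (tile o x y) (tile o′ x′ y′) = cong₂ (λ a b → (a <ᵇ reachX o o′) ∧ (b <ᵇ reachY o o′))
  (gap-shift x 7 x′) (gap-shift y 7 y′)

offset-injective : ∀ p {r r′} → offset p r ≡ offset p r′ → r ≡ r′
offset-injective (tile _ x y) {tile o a b} {tile o′ a′ b′} eq with ℕ.+-cancelˡ-≡ x a a′ (cong cx eq) | ℕ.+-cancelˡ-≡ y b b′ (cong cy eq) | cong dir eq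
... | refl | refl | refl = refl

centre-injective : ∀ {p p′} → centre p ≡ centre p′ → p ≡ p′
centre-injective {tile o x y} {tile o′ x′ y′} eq with ℕ.+-cancelʳ-≡ 7 x x′ (cong cx eq) | ℕ.+-cancelʳ-≡ 7 y y′ (cong cy eq) | cong dir eq
... | refl | refl | refl = refl

opaque
  unfolding square

  square-unique : ∀ start size → Unique (square start size)
  square-unique start size = Unique.cartesianProductWith⁺ tile′ (λ { refl → refl , refl })
    (((λ ()) ∷ []) ∷ [] ∷ []) (Unique.cartesianProduct⁺ side side)
    where
    side : Unique (interval start size)
    side = Unique.applyUpTo⁺₁ (λ t → start + t) size (λ i<j _ e → ℕ.<⇒≢ i<j (ℕ.+-cancelˡ-≡ start _ _ e))

touching-unique : ∀ s → Unique (touching s)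
touching-unique s = Unique.filter⁺ (λ q → T? (someFoot s (meets q))) (Unique.map⁺ {f = centre} centre-injective (square-unique 6 14))

anchors-unique : ∀ s → Unique (anchors s)
anchors-unique s = Unique.filter⁺ (λ p → T? (covering s (centre p))) (square-unique 6 14)

around-unique : ∀ o → Unique (around o)
around-unique o = Unique.filter⁺ (λ r → T? (not (meets (tile o 7 7) r))) (square-unique 0 15)

-- The candidates around `p` that are not free are carried injectively into `touching s` by
-- `offset p`, so the second sum dominates their weight.
floats-total : ∀ s p → 39192 ≤ Σ[ floats s p ] (weight ∘ target)
                               + Σ[ touching s ] (λ q → weight (key false (centre p) q))
floats-total s p = begin
  39192                                                   ≡⟨ floatTotal≡ (dir p) ⟨
  Σ[ around (dir p) ] (λ r → weight (key false (tile (dir p) 7 7) r))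
    ≡⟨ Σ-cong (around (dir p)) (λ r → cong weight (key-offset p r)) ⟨
  Σ[ around (dir p) ] (floatWeight p)                     ≡⟨ Σ-filter hit? (around (dir p)) (floatWeight p) ⟩
  Σ[ filter hit? (around (dir p)) ] (floatWeight p) + Σ[ free s p ] (floatWeight p)
    ≤⟨ ℕ.+-monoˡ-≤ (Σ[ free s p ] (floatWeight p)) (Σ-inclusion (offset-injective p)
         (Unique.filter⁺ hit? (around-unique (dir p))) (All.all-filter hit? (around (dir p)))
         (λ q → weight (key false (centre p) q))) ⟩
  Σ[ touching s ] (λ q → weight (key false (centre p) q)) + Σ[ free s p ] (floatWeight p)
    ≡⟨ ℕ.+-comm (Σ[ touching s ] (λ q → weight (key false (centre p) q))) _ ⟩
  Σ[ free s p ] (floatWeight p) + Σ[ touching s ] (λ q → weight (key false (centre p) q))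
    ≡⟨ cong (_+ Σ[ touching s ] (λ q → weight (key false (centre p) q))) (Σ-map (float p) (free s p) (weight ∘ target)) ⟨
  Σ[ floats s p ] (weight ∘ target) + Σ[ touching s ] (λ q → weight (key false (centre p) q)) ∎
  where
  open ℕ.≤-Reasoning
  hit? = λ r → offset p r ∈? touching s

Subharmonic : State → Set
Subharmonic s = 392 * 392 * weight s ≤ 392 * 5 * (length (steps₁ s) * weight single) + 5 * 5 * Σ[ steps₂ s ] (weight ∘ target)

-- The value 39192 per anchor overstates the floats by at most `E` altogether; `balance` has `E` on
-- its left side for this reason, and it cancels.
balance⇒subharmonic : ∀ s → T (balance s (steps₁ s) (touching s)) → Subharmonic s
balance⇒subharmonic s ok = ℕ.+-cancelʳ-≤ (5 * 5 * E) _ _ (begin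
    392 * 392 * weight s + 5 * 5 * E                        ≤⟨ ℕ.≤ᵇ⇒≤ _ _ ok ⟩
    M + 5 * 5 * (B + len * 39192)      ≤⟨ ℕ.+-monoʳ-≤ M (ℕ.*-monoʳ-≤ (5 * 5) (ℕ.+-monoʳ-≤ B bound)) ⟩
    M + 5 * 5 * (B + (F + E))          ≡⟨ arrange (5 * 5) M B F E ⟩
    M + 5 * 5 * (B + F) + 5 * 5 * E       ≡⟨ cong (λ t → M + 5 * 5 * t + 5 * 5 * E) total ⟨
    M + 5 * 5 * Σ[ steps₂ s ] (weight ∘ target) + 5 * 5 * E ∎)
  where
  open ℕ.≤-Reasoning
  E = excess (steps₁ s) (touching s)
  B = pairTotal s (touching s)
  F = Σ[ anchors s ] λ p → Σ[ floats s p ] (weight ∘ target)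
  len = length (steps₁ s)
  M = 392 * 5 * (len * weight single)
  arrange : ∀ k a b c d → a + k * (b + (c + d)) ≡ a + k * (b + c) + k * d
  arrange = ℕ-Solver.solve-∀
  bound : len * 39192 ≤ F + E
  bound = begin
    len * 39192                          ≡⟨ cong (_* 39192) (List.length-map centre (anchors s)) ⟩
    length (anchors s) * 39192           ≡⟨ Σ-const (anchors s) 39192 ⟨
    Σ[ anchors s ] (λ _ → 39192)         ≤⟨ Σ-mono (anchors s) (floats-total s) ⟩
    Σ[ anchors s ] (λ p → Σ[ floats s p ] (weight ∘ target) + Σ[ touching s ] (λ q → weight (key false (centre p) q)))
      ≡⟨ Σ-+ (anchors s) _ _ ⟩
    F + Σ[ anchors s ] (λ p → Σ[ touching s ] (λ q → weight (key false (centre p) q)))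
      ≡⟨ cong (λ t → F + t) (Σ-map centre (anchors s) (λ p → Σ[ touching s ] (λ q → weight (key false p q)))) ⟨
    F + E                                ∎
  total : Σ[ steps₂ s ] (weight ∘ target) ≡ B + F
  total = trans (Σ-++ (map (toStep s) (compatiblePairs s (touching s))) (weight ∘ target))
    (cong₂ _+_ (Σ-map (toStep s) (compatiblePairs s (touching s)) (weight ∘ target))
      (Σ-concatMap (floats s) (anchors s) (weight ∘ target)))

-- Evaluation of the test on all states.

allBelow : ℕ → (ℕ → Bool) → Bool
allBelow zero    P = true
allBelow (suc n) P = P n ∧ allBelow n P

allBelow⇒ : ∀ n {P} → T (allBelow n P) → ∀ {i} → i < n → T (P i)
allBelow⇒ (suc n) {P} ok {i} i<1+n with Equivalence.to T-∧ ok | ℕ.m<1+n⇒m<n∨m≡n i<1+n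
... | _  , ok′ | inj₁ i<n  = allBelow⇒ n ok′ i<n
... | pn , _   | inj₂ refl = pn

entry-overflow : ∀ {A : Set} (d : A) xs {n} → length xs ≤ n → entry d xs n ≡ d
entry-overflow d []       _         = refl
entry-overflow d (x ∷ xs) (s≤s len) = entry-overflow d xs len

entry-All : ∀ {A : Set} {P : A → Set} {d xs} → P d → All P xs → ∀ n → P (entry d xs n)
entry-All pd []         _       = pd
entry-All pd (px ∷ pxs) zero    = px
entry-All pd (px ∷ pxs) (suc n) = entry-All pd pxs n

rows-short : ∀ l o → All (λ row → length row ≤ 8) (weights l o)
rows-short true  alongX = toWitness {a? = All.all? (λ row → length row ℕ.≤? 8) (weights true  alongX)} tt
rows-short true  alongY = toWitness {a? = All.all? (λ row → length row ℕ.≤? 8) (weights true  alongY)} tt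
rows-short false alongX = toWitness {a? = All.all? (λ row → length row ℕ.≤? 8) (weights false alongX)} tt
rows-short false alongY = toWitness {a? = All.all? (λ row → length row ℕ.≤? 8) (weights false alongY)} tt

few-rows : ∀ l o → length (weights l o) ≤ 8
few-rows true  alongX = ℕ.≤-refl
few-rows true  alongY = ℕ.≤-refl
few-rows false alongX = ℕ.≤-refl
few-rows false alongY = ℕ.≤-refl

weight-far : ∀ l o dx dy → ¬ (dx < 8 × dy < 8) → weight (double l o dx dy) ≡ 0
weight-far l o dx dy far with ℕ.<-≤-connex dx 8 | ℕ.<-≤-connex dy 8
... | inj₁ dx<8 | inj₁ dy<8 = contradiction (dx<8 , dy<8) far
... | inj₂ 8≤dx | _         = cong (λ row → entry 0 row dy) (entry-overflow [] (weights l o) (ℕ.≤-trans (few-rows l o) 8≤dx))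
... | inj₁ _    | inj₂ 8≤dy = entry-overflow 0 (entry [] (weights l o) dx)
  (ℕ.≤-trans (entry-All {P = λ row → length row ≤ 8} z≤n (rows-short l o) dx) 8≤dy)

record Checked (s : State) : Set where
  field
    subharmonic : Subharmonic s
    covers      : 60 ≤ weight s → 0 < length (steps₁ s)
    improves    : 0 < weight s → ∃ λ st → st ∈ steps₂ s × 60 ≤ weight (target st)

-- This takes care of the states without a meaning in the table: overlapping pairs, where it holds
-- 0, and pairs beyond its range, where `entry` defaults to 0.
weightless : ∀ s → weight s ≡ 0 → Checked s
weightless s w≡0 = record
  { subharmonic = subst (λ w → 392 * 392 * w ≤ bound) (sym w≡0) z≤n
  ; covers      = λ 60≤w → contradiction (subst (60 ≤_) w≡0 60≤w) λ ()
  ; improves    = λ 0<w → contradiction (subst (0 <_) w≡0 0<w) λ ()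
  }
  where bound = 392 * 5 * (length (steps₁ s) * weight single) + 5 * 5 * Σ[ steps₂ s ] (weight ∘ target)

check⇒checked : ∀ s → T (check s) → Checked s
check⇒checked s ok with Equivalence.to T-∨ ok
... | inj₁ w≡0 = weightless s (ℕ.≡ᵇ⇒≡ _ _ w≡0)
... | inj₂ ok′ = record
    { subharmonic = balance⇒subharmonic s (proj₁ (Equivalence.to T-∧ ok′))
    ; covers      = λ 60≤w → [ (λ w<60 → contradiction (ℕ.<ᵇ⇒< _ _ w<60) (ℕ.≤⇒≯ 60≤w)) , ℕ.<ᵇ⇒< _ _ ]′
                      (Equivalence.to T-∨ (proj₁ (Equivalence.to T-∧ ok″)))
    ; improves    = λ _ →
        let pq , pq∈ , w = find (any⁻ (λ pq → 60 ≤ᵇ weight (target (toStep s pq)))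
                             (compatiblePairs s (touching s)) (proj₂ (Equivalence.to T-∧ ok″)))
        in toStep s pq , ∈-++⁺ˡ (∈-map⁺ (toStep s) pq∈) , ℕ.≤ᵇ⇒≤ _ _ w
    }
  where
  ok″ : T (coverable s (steps₁ s) ∧ improvable s (touching s))
  ok″ = proj₂ (Equivalence.to (T-∧ {balance s (steps₁ s) (touching s)}) ok′)

checkAll : Bool → Orientation → Bool
checkAll l o = allBelow 8 λ dx → allBelow 8 λ dy → check (double l o dx dy)

opaque
  unfolding square

  checked-all : ∀ l o → checkAll l o ≡ true
  checked-all true  alongX = refl
  checked-all true  alongY = refl
  checked-all false alongX = refl
  checked-all false alongY = refl

  checked-single : Checked single
  checked-single = check⇒checked single tt

checked : ∀ s → Checked s
checked single = checked-single
checked (double l o dx dy) with dx ℕ.<? 8 | dy ℕ.<? 8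
... | no 8≰dx | _       = weightless _ (weight-far l o dx dy (8≰dx ∘ proj₁))
... | yes _   | no 8≰dy = weightless _ (weight-far l o dx dy (8≰dy ∘ proj₂))
... | yes dx<8 | yes dy<8 = check⇒checked (double l o dx dy)
  (allBelow⇒ 8 {λ dy → check (double l o dx dy)}
    (allBelow⇒ 8 {λ dx → allBelow 8 λ dy → check (double l o dx dy)} (Equivalence.from (T-≡ {checkAll l o}) (checked-all l o)) dx<8) dy<8)

-- Soundness and distinctness of the steps

someFoot⇒ : ∀ s {P} → T (someFoot s P) → ∃ λ f → f ∈ feet s × T (P f)
someFoot⇒ single             h = _ , here refl , h
someFoot⇒ (double l o dx dy) h with Equivalence.to T-∨ h
... | inj₁ h₁ = _ , here refl , h₁
... | inj₂ h₂ = _ , there (here refl) , h₂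

allFeet⇒ : ∀ s {P} → T (allFeet s P) → ∀ {f} → f ∈ feet s → T (P f)
allFeet⇒ single             h (here refl)         = h
allFeet⇒ (double l o dx dy) h (here refl)         = proj₁ (Equivalence.to T-∧ h)
allFeet⇒ (double l o dx dy) h (there (here refl)) = proj₂ (Equivalence.to T-∧ h)

allFeet⇒someFoot : ∀ s {P} → T (allFeet s P) → T (someFoot s P)
allFeet⇒someFoot single             h = h
allFeet⇒someFoot (double l o dx dy) {P} h = Equivalence.from (T-∨ {P foot₁}) (inj₁ (proj₁ (Equivalence.to T-∧ h)))

Near : State → Tile ℕ → Tile ℕ → Set
Near s f f′ = f ≡ f′ ⊎ T (linked s)

-- In a linked layer one brick met from above serves for all; in an unlinked one `Near` is equality
-- and every foot must be met itself.
Covered : State → (Tile ℕ → Set) → Set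
Covered s Layer = ∀ {f} → f ∈ feet s →
  ∃ λ f′ → f′ ∈ feet s × Near s f f′ × ∃ λ t → Layer t × T (meets t f′)

covering⇒covered : ∀ s p {Layer} → Layer p → T (covering s p) → Covered s Layer
covering⇒covered s p lp c {f} f∈ with linked s
... | true  = let f′ , f′∈ , m = someFoot⇒ s c in f′ , f′∈ , inj₂ tt , p , lp , m
... | false = f , f∈ , inj₁ refl , p , lp , allFeet⇒ s c f∈

covering⇒some : ∀ s p → T (covering s p) → T (someFoot s (meets p))
covering⇒some s p c with linked s
... | true  = c
... | false = allFeet⇒someFoot s c

steps₁-covering : ∀ s {p} → p ∈ steps₁ s → T (covering s p)
steps₁-covering s p∈ with ∈-map⁻ centre p∈
... | a , a∈ , refl = proj₂ (∈-filter⁻ (λ p → T? (covering s (centre p))) {xs = square 6 14} a∈)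

steps₁-unique : ∀ s → Unique (steps₁ s)
steps₁-unique s = Unique.map⁺ {f = centre} centre-injective (anchors-unique s)

infix 4 _∈₂_

_∈₂_ : Tile ℕ → Step → Set
t ∈₂ st = t ≡ fst st ⊎ t ≡ snd st

record Sound (s : State) (st : Step) : Set where
  field
    apart   : T (not (meets (fst st) (snd st)))
    covered : Covered s (_∈₂ st)
    bridged : T (joined st) → ∃₂ λ f f′ → f ∈ feet s × f′ ∈ feet s × Near s f f′
                × T (meets (fst st) f) × T (meets (snd st) f′)

touching-some : ∀ s {q} → q ∈ touching s → T (someFoot s (meets q))
touching-some s q∈ = proj₂ (∈-filter⁻ (λ q → T? (someFoot s (meets q))) {xs = map centre (square 6 14)} q∈)

anchors-touching : ∀ s → All (λ p → centre p ∈ touching s) (anchors s)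
anchors-touching s = All.tabulate λ {p} p∈ →
  let p∈□ , c = ∈-filter⁻ (λ p → T? (covering s (centre p))) {xs = square 6 14} p∈
  in ∈-filter⁺ (λ q → T? (someFoot s (meets q))) (∈-map⁺ centre p∈□) (covering⇒some s (centre p) c)

pairs-⊆ : ∀ {A : Set} (xs : List A) {u v} → (u , v) ∈ pairs xs → u ∈ xs × v ∈ xs
pairs-⊆ (x ∷ xs) uv∈ with ∈-++⁻ (map (x ,_) xs) uv∈
... | inj₂ uv∈′ = let u∈ , v∈ = pairs-⊆ xs uv∈′ in there u∈ , there v∈
... | inj₁ uv∈′ with ∈-map⁻ (x ,_) uv∈′
...   | y , y∈ , refl = here refl , there y∈

record PairStep (s : State) (st : Step) : Set where
  constructor pairStep
  field
    p∈   : fst st ∈ touching s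
    q∈   : snd st ∈ touching s
    fits : T (compatible s (fst st , snd st))
    eq   : st ≡ toStep s (fst st , snd st)

record FloatStep (s : State) (ps : List (Tile ℕ)) (st : Step) : Set where
  constructor floatStep
  field
    p r : Tile ℕ
    p∈  : p ∈ ps
    r∈  : r ∈ around (dir p)
    q∉  : offset p r ∉ touching s
    eq  : st ≡ float p r

pairStep-view : ∀ s {st} → st ∈ map (toStep s) (compatiblePairs s (touching s)) → PairStep s st
pairStep-view s st∈ with ∈-map⁻ (toStep s) st∈
... | (p , q) , pq∈ , refl with ∈-filter⁻ (λ pq → T? (compatible s pq)) {xs = pairs (touching s)} pq∈
...   | pq∈′ , c = let p∈ , q∈ = pairs-⊆ (touching s) pq∈′ in pairStep p∈ q∈ c refl

floatStep-view : ∀ s ps {st} → st ∈ concatMap (floats s) ps → FloatStep s ps st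
floatStep-view s ps st∈ with find (∈-concatMap⁻ (floats s) {xs = ps} st∈)
... | p , p∈ , st∈′ with ∈-map⁻ (float p) st∈′
...   | r , r∈ , refl with ∈-filter⁻ _ {xs = around (dir p)} r∈
...     | r∈′ , q∉ = floatStep p r p∈ r∈′ q∉ refl

pairStep-sound : ∀ s {st} → PairStep s st → Sound s st
pairStep-sound s {step p q _} (pairStep p∈ q∈ fits refl) = record
  { apart   = proj₁ (Equivalence.to T-∧ fits)
  ; covered = cover (Equivalence.to T-∨ (proj₂ (Equivalence.to (T-∧ {not (meets p q)}) fits)))
  ; bridged = bridge ∘ Equivalence.to T-∨
  }
  where
  near : T (linked s) → ∃₂ λ f f′ → f ∈ feet s × f′ ∈ feet s × Near s f f′ × T (meets p f) × T (meets q f′)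
  near l = let f , f∈ , m = someFoot⇒ s (touching-some s p∈)
               f′ , f′∈ , m′ = someFoot⇒ s (touching-some s q∈)
           in f , f′ , f∈ , f′∈ , inj₂ l , m , m′
  cover : T (linked s) ⊎ T (allFeet s (λ f → meets p f ∨ meets q f)) → Covered s (_∈₂ step p q (links s p q))
  cover (inj₁ l) f∈ = let f′ , f′∈ , m = someFoot⇒ s (touching-some s p∈)
                      in f′ , f′∈ , inj₂ l , p , inj₁ refl , m
  cover (inj₂ h) {f} f∈ with Equivalence.to T-∨ (allFeet⇒ s h f∈)
  ... | inj₁ m = f , f∈ , inj₁ refl , p , inj₁ refl , m
  ... | inj₂ m = f , f∈ , inj₁ refl , q , inj₂ refl , m
  bridge : T (linked s) ⊎ T (someFoot s (λ f → meets p f ∧ meets q f)) → _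
  bridge (inj₁ l) = near l
  bridge (inj₂ h) = let f , f∈ , m = someFoot⇒ s h ; m₁ , m₂ = Equivalence.to T-∧ m
                    in f , f , f∈ , f∈ , inj₁ refl , m₁ , m₂

floatStep-sound : ∀ s {st} → FloatStep s (anchors s) st → Sound s st
floatStep-sound s (floatStep p r p∈ r∈ q∉ refl) = record
  { apart   = subst (T ∘ not) (sym (meets-offset p r))
                (proj₂ (∈-filter⁻ (λ r → T? (not (meets (tile (dir p) 7 7) r))) {xs = square 0 15} r∈))
  ; covered = covering⇒covered s (centre p) (inj₁ refl) (steps₁-covering s (∈-map⁺ centre p∈))
  ; bridged = λ ()
  }

steps₂-sound : ∀ s {st} → st ∈ steps₂ s → Sound s st
steps₂-sound s st∈ with ∈-++⁻ (map (toStep s) (compatiblePairs s (touching s))) st∈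
... | inj₁ st∈′ = pairStep-sound s (pairStep-view s st∈′)
... | inj₂ st∈′ = floatStep-sound s (floatStep-view s (anchors s) st∈′)

Within : ∀ {A : Set} → A × A → A × A → Set
Within (p , q) (p′ , q′) = (p ≡ p′ ⊎ p ≡ q′) × (q ≡ p′ ⊎ q ≡ q′)

-- Distinct as sets: a layer does not remember the order of its bricks, so a step must be
-- recognisable without it.
Distinct : ∀ {A : Set} → A × A → A × A → Set
Distinct pq pq′ = ¬ (Within pq pq′ × Within pq′ pq)

ends : Step → Tile ℕ × Tile ℕ
ends st = fst st , snd st

same-head : ∀ {A : Set} {x y y′ : A} → y ≢ y′ → Distinct (x , y) (x , y′)
same-head y≢y′ ((_ , inj₂ y≡y′) , _) = y≢y′ y≡y′
same-head y≢y′ (_ , (_ , inj₂ y′≡y)) = y≢y′ (sym y′≡y)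
same-head y≢y′ ((_ , inj₁ y≡x) , (_ , inj₁ y′≡x)) = y≢y′ (trans y≡x (sym y′≡x))

pairs-distinct : ∀ {A : Set} {xs : List A} → Unique xs → AllPairs Distinct (pairs xs)
pairs-distinct {xs = []}     _          = []
pairs-distinct {xs = x ∷ xs} (x∉ ∷ u) = AllPairs.++⁺
  (AllPairs.map⁺ (AllPairs.map same-head u)) (pairs-distinct u)
  (All.tabulate λ xy∈ → All.tabulate λ uv∈ → cross xy∈ uv∈)
  where
  cross : ∀ {xy uv} → xy ∈ map (x ,_) xs → uv ∈ pairs xs → Distinct xy uv
  cross xy∈ uv∈ ((x∈ , _) , _) with ∈-map⁻ (x ,_) xy∈ | pairs-⊆ xs uv∈
  ... | y , _ , refl | u∈ , v∈ = [ (λ e → All.lookup x∉ u∈ e) , (λ e → All.lookup x∉ v∈ e) ]′ x∈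

DistinctSteps : List Step → Set
DistinctSteps = AllPairs (λ st st′ → Distinct (ends st) (ends st′))

-- The anchor of a float is its only brick in `touching s`, so it can be read off from the unordered
-- layer.
floats-distinct : ∀ s {ps} → Unique ps → All (λ p → centre p ∈ touching s) ps →
                  DistinctSteps (concatMap (floats s) ps)
floats-distinct s {[]}     _        _           = []
floats-distinct s {p ∷ ps} (p∉ ∷ u) (c∈ ∷ cs∈) = AllPairs.++⁺
  (AllPairs.map⁺ (AllPairs.map (λ r≢r′ → same-head (r≢r′ ∘ offset-injective p)) free-unique))
  (floats-distinct s u cs∈)
  (All.tabulate λ st∈ → All.tabulate λ st′∈ → cross st∈ (floatStep-view s ps st′∈))
  where
  free-unique : Unique (free s p)
  free-unique = Unique.filter⁺ _ (around-unique (dir p))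
  cross : ∀ {st st′} → st ∈ map (float p) (free s p) → FloatStep s ps st′ → Distinct (ends st) (ends st′)
  cross st∈ (floatStep p′ r′ p′∈ r′∈ q′∉ refl) ((h , _) , _) with ∈-map⁻ (float p) st∈
  ... | r , r∈ , refl = [ (λ e → All.lookup p∉ p′∈ (centre-injective e))
                        , (λ e → q′∉ (subst (_∈ touching s) e c∈)) ]′ h

-- Both bricks of a pair step lie in `touching s`, but only one brick of a float does; this
-- separates the two kinds.
steps₂-distinct : ∀ s → DistinctSteps (steps₂ s)
steps₂-distinct s = AllPairs.++⁺
  (AllPairs.map⁺ (AllPairs.filter⁺ _ (pairs-distinct (touching-unique s))))
  (floats-distinct s (anchors-unique s) (anchors-touching s))
  (All.tabulate λ st∈ → All.tabulate λ st′∈ →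
    cross (pairStep-view s st∈) (floatStep-view s (anchors s) st′∈))
  where
  cross : ∀ {st st′} → PairStep s st → FloatStep s (anchors s) st′ → Distinct (ends st) (ends st′)
  cross (pairStep p∈ q∈ _ _) (floatStep p′ r′ _ _ q′∉ refl) (_ , (_ , h)) =
    [ (λ e → q′∉ (subst (_∈ touching s) (sym e) p∈))
    , (λ e → q′∉ (subst (_∈ touching s) (sym e) q∈)) ]′ h

-- Plane isometries

dist : ℤ → ℤ → ℕ
dist X Y = ℤ.∣ X ℤ.- Y ∣

dist-sym : ∀ X Y → dist X Y ≡ dist Y X
dist-sym = ℤ.∣i-j∣≡∣j-i∣

dist-0 : ∀ {X Y} → dist X Y ≡ 0 → X ≡ Y
dist-0 {X} {Y} e = ℤ.i-j≡0⇒i≡j X Y (ℤ.∣i∣≡0⇒i≡0 e)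

dist-self : ∀ X → dist X X ≡ 0
dist-self X = cong ℤ.∣_∣ (ℤ.+-inverseʳ X)

gap-≤ : ∀ {m n} → m ≤ n → gap m n ≡ n ∸ m
gap-≤ {m} {n} m≤n = cong (_+ (n ∸ m)) (ℕ.m≤n⇒m∸n≡0 m≤n)

gap-sym : ∀ m n → gap m n ≡ gap n m
gap-sym m n = ℕ.+-comm (m ∸ n) (n ∸ m)

dist-embed : ∀ m n → dist (+ m) (+ n) ≡ gap m n
dist-embed m n = trans (cong ℤ.∣_∣ (ℤ.m-n≡m⊖n m n)) ([ below m n , above ]′ (ℕ.≤-total m n))
  where
  below : ∀ m n → m ≤ n → ℤ.∣ m ⊖ n ∣ ≡ gap m n
  below m n m≤n = trans (ℤ.∣⊖∣-≤ m≤n) (sym (gap-≤ m≤n))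
  above : n ≤ m → ℤ.∣ m ⊖ n ∣ ≡ gap m n
  above n≤m = trans (ℤ.∣m⊖n∣≡∣n⊖m∣ m n) (trans (below n m n≤m) (gap-sym n m))

meetsᶻ : Tile ℤ → Tile ℤ → Bool
meetsᶻ (tile o x y) (tile o′ x′ y′) = (dist x x′ <ᵇ reachX o o′) ∧ (dist y y′ <ᵇ reachY o o′)

reachX-sym : ∀ o o′ → reachX o o′ ≡ reachX o′ o
reachX-sym alongX alongX = refl
reachX-sym alongX alongY = refl
reachX-sym alongY alongX = refl
reachX-sym alongY alongY = refl

meetsᶻ-sym : ∀ s t → meetsᶻ s t ≡ meetsᶻ t s
meetsᶻ-sym (tile o x y) (tile o′ x′ y′) = cong₂ _∧_
  (cong₂ _<ᵇ_ (dist-sym x x′) (reachX-sym o o′))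
  (cong₂ _<ᵇ_ (dist-sym y y′) (reachX-sym (turn o) (turn o′)))

embed : Tile ℕ → Tile ℤ
embed (tile o x y) = tile o (+ x) (+ y)

embed-injective : ∀ {s t} → embed s ≡ embed t → s ≡ t
embed-injective {tile _ _ _} {tile _ _ _} refl = refl

meets-embed : ∀ s t → meetsᶻ (embed s) (embed t) ≡ meets s t
meets-embed (tile o x y) (tile o′ x′ y′) = cong₂ (λ a b → (a <ᵇ reachX o o′) ∧ (b <ᵇ reachY o o′))
  (dist-embed x x′) (dist-embed y y′)

record Line : Set where
  field
    move : ℤ → ℤ
    pres : ∀ X Y → dist (move X) (move Y) ≡ dist X Y

  injective : ∀ {X Y} → move X ≡ move Y → X ≡ Y
  injective {X} {Y} e = dist-0 (trans (sym (pres X Y)) (trans (cong (dist (move X)) (sym e)) (dist-self (move X))))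

shift reflect : ℤ → Line
shift c = record { move = ℤ._+ c ; pres = λ X Y → cong ℤ.∣_∣ (cancel X Y c) }
  where
  cancel : ∀ X Y c → (X ℤ.+ c) ℤ.- (Y ℤ.+ c) ≡ X ℤ.- Y
  cancel = ℤ-Solver.solve-∀
reflect c = record { move = λ X → c ℤ.- X ; pres = λ X Y → trans (cong ℤ.∣_∣ (cancel X Y c)) (dist-sym Y X) }
  where
  cancel : ∀ X Y c → (c ℤ.- X) ℤ.- (c ℤ.- Y) ≡ Y ℤ.- X
  cancel = ℤ-Solver.solve-∀

-- One coordinate of the map from the normal form to an actual pair: 16 is the origin of the feet,
-- and the line is a shift or a reflection according to the order of `x` and `u`.
record LineThrough (x u : ℕ) : Set where
  field
    line   : Line
    origin : Line.move line (+ 16) ≡ + x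
    other  : Line.move line (+ (16 + gap x u)) ≡ + u

lineThrough : ∀ x u → LineThrough x u
lineThrough x u with ℕ.≤-total x u
... | inj₁ x≤u = record { line = shift (+ x ℤ.- + 16) ; origin = cancel (+ 16) (+ x) ; other = begin
    (+ 16 ℤ.+ + gap x u) ℤ.+ (+ x ℤ.- + 16) ≡⟨ rearrange (+ 16) (+ gap x u) (+ x) ⟩
    + x ℤ.+ + gap x u                       ≡⟨ cong (λ n → + (x + n)) (gap-≤ x≤u) ⟩
    + (x + (u ∸ x))                         ≡⟨ cong +_ (ℕ.m+[n∸m]≡n x≤u) ⟩
    + u                                     ∎ }
  where
  open ≡-Reasoning
  cancel : ∀ a b → a ℤ.+ (b ℤ.- a) ≡ b
  cancel = ℤ-Solver.solve-∀
  rearrange : ∀ a g x → (a ℤ.+ g) ℤ.+ (x ℤ.- a) ≡ x ℤ.+ g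
  rearrange = ℤ-Solver.solve-∀
... | inj₂ u≤x = record { line = reflect (+ x ℤ.+ + 16) ; origin = cancel (+ 16) (+ x) ; other = begin
    (+ x ℤ.+ + 16) ℤ.- (+ 16 ℤ.+ + gap x u) ≡⟨ rearrange (+ 16) (+ gap x u) (+ x) ⟩
    + x ℤ.- + gap x u                       ≡⟨ cong (λ n → + n ℤ.- + gap x u) (sym total) ⟩
    + (u + gap x u) ℤ.- + gap x u           ≡⟨ cancel′ (+ u) (+ gap x u) ⟩
    + u                                     ∎ }
  where
  open ≡-Reasoning
  cancel : ∀ a b → (b ℤ.+ a) ℤ.- a ≡ b
  cancel = ℤ-Solver.solve-∀
  cancel′ : ∀ a b → (a ℤ.+ b) ℤ.- b ≡ a
  cancel′ = ℤ-Solver.solve-∀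
  rearrange : ∀ a g x → (x ℤ.+ a) ℤ.- (a ℤ.+ g) ≡ x ℤ.- g
  rearrange = ℤ-Solver.solve-∀
  total : u + gap x u ≡ x
  total = trans (cong (λ g → u + g) (trans (gap-sym x u) (gap-≤ u≤x))) (ℕ.m+[n∸m]≡n u≤x)

tile-cong : ∀ {o o′ x x′ y y′} → o ≡ o′ → x ≡ x′ → y ≡ y′ → tile {ℤ} o x y ≡ tile o′ x′ y′
tile-cong refl refl refl = refl

record Iso : Set where
  field
    act       : Tile ℤ → Tile ℤ
    pres      : ∀ s t → meetsᶻ (act s) (act t) ≡ meetsᶻ s t
    injective : ∀ {s t} → act s ≡ act t → s ≡ t

open Iso public using (act)

straight crossed : Line → Line → Iso
straight φ ψ = record
  { act       = λ { (tile o x y) → tile o (φ.move x) (ψ.move y) }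
  ; pres      = λ { (tile o x y) (tile o′ x′ y′) →
      cong₂ (λ a b → (a <ᵇ reachX o o′) ∧ (b <ᵇ reachY o o′)) (φ.pres x x′) (ψ.pres y y′) }
  ; injective = λ { {tile _ _ _} {tile _ _ _} e → tile-cong (cong dir e) (φ.injective (cong cx e)) (ψ.injective (cong cy e)) }
  }
  where
  module φ = Line φ
  module ψ = Line ψ
crossed φ ψ = record
  { act       = λ { (tile o x y) → tile (turn o) (φ.move y) (ψ.move x) }
  ; pres      = λ { (tile o x y) (tile o′ x′ y′) → trans
      (cong₂ _∧_ (cong (_<ᵇ reachY o o′) (φ.pres y y′))
                 (cong₂ _<ᵇ_ (ψ.pres x x′) (cong₂ reachX (turn-turn o) (turn-turn o′))))
      (∧-comm (dist y y′ <ᵇ reachY o o′) (dist x x′ <ᵇ reachX o o′)) }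
  ; injective = λ { {tile o _ _} {tile o′ _ _} e → tile-cong (turn-injective o o′ (cong dir e)) (ψ.injective (cong cy e)) (φ.injective (cong cx e)) }
  }
  where
  module φ = Line φ
  module ψ = Line ψ
  turn-turn : ∀ o → turn (turn o) ≡ o
  turn-turn alongX = refl
  turn-turn alongY = refl
  turn-injective : ∀ o o′ → turn o ≡ turn o′ → o ≡ o′
  turn-injective o o′ e = trans (sym (turn-turn o)) (trans (cong turn e) (turn-turn o′))

-- `layer` lies over the feet of the present state, in its coordinates; `state` is the normal form
-- of that layer, and `iso` carries the one onto the other.
record Move : Set where
  field
    state : State
    layer : List (Tile ℕ)
    iso   : Iso
    onto  : ∀ {f} → f ∈ feet state → ∃ λ p → p ∈ layer × act iso (embed f) ≡ embed p
    from  : ∀ {p} → p ∈ layer → ∃ λ f → f ∈ feet state × act iso (embed f) ≡ embed p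

move₁ : Tile ℕ → Move
move₁ p = record
  { state = single
  ; layer = p ∷ []
  ; iso   = proj₁ (place p)
  ; onto  = λ { (here refl) → p , here refl , proj₂ (place p) }
  ; from  = λ { (here refl) → foot₁ , here refl , proj₂ (place p) }
  }
  where
  open LineThrough
  place : ∀ p → ∃ λ g → act g (embed foot₁) ≡ embed p
  place (tile alongX x y) = straight (line (lineThrough x x)) (line (lineThrough y y))
    , cong₂ (tile alongX) (origin (lineThrough x x)) (origin (lineThrough y y))
  place (tile alongY x y) = crossed (line (lineThrough x x)) (line (lineThrough y y))
    , cong₂ (tile alongY) (origin (lineThrough x x)) (origin (lineThrough y y))

record Placement (s : State) (p q : Tile ℕ) : Set where
  field
    iso      : Iso
    foot foot′ : Tile ℕ
    shape    : feet s ≡ foot ∷ foot′ ∷ []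
    images   : act iso (embed foot) ≡ embed p × act iso (embed foot′) ≡ embed q
             ⊎ act iso (embed foot) ≡ embed q × act iso (embed foot′) ≡ embed p

placement : ∀ l p q → Placement (key l p q) p q
placement l (tile alongX x y) (tile o x′ y′) = record
  { iso    = straight (line (lineThrough x x′)) (line (lineThrough y y′))
  ; shape  = refl
  ; images = inj₁ ( cong₂ (tile alongX) (origin (lineThrough x x′)) (origin (lineThrough y y′))
                  , cong₂ (tile o) (other (lineThrough x x′)) (other (lineThrough y y′)))
  }
  where open LineThrough
placement l (tile alongY x y) (tile alongX x′ y′) = record
  { iso    = g
  ; shape  = refl
  ; images = inj₂ ( cong₂ (tile alongX) (origin (lineThrough x′ x)) (origin (lineThrough y′ y))
                  , trans (cong₂ (λ a b → act g (tile alongY (+ (16 + a)) (+ (16 + b)))) (gap-sym x x′) (gap-sym y y′))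
                          (cong₂ (tile alongY) (other (lineThrough x′ x)) (other (lineThrough y′ y))))
  }
  where
  open LineThrough
  g = straight (line (lineThrough x′ x)) (line (lineThrough y′ y))
placement l (tile alongY x y) (tile alongY x′ y′) = record
  { iso    = crossed (line (lineThrough x x′)) (line (lineThrough y y′))
  ; shape  = refl
  ; images = inj₁ ( cong₂ (tile alongY) (origin (lineThrough x x′)) (origin (lineThrough y y′))
                  , cong₂ (tile alongY) (other (lineThrough x x′)) (other (lineThrough y y′)))
  }
  where open LineThrough

move₂ : Step → Move
move₂ (step p q l) = record
  { state = key l p q
  ; layer = p ∷ q ∷ []
  ; iso   = iso
  ; onto  = λ f∈ → onto (subst (_ ∈_) shape f∈) images
  ; from  = λ t∈ → let f , f∈ , e = from t∈ images in f , subst (f ∈_) (sym shape) f∈ , e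
  }
  where
  open Placement (placement l p q)
  Images = act iso (embed foot) ≡ embed p × act iso (embed foot′) ≡ embed q
         ⊎ act iso (embed foot) ≡ embed q × act iso (embed foot′) ≡ embed p
  onto : ∀ {f} → f ∈ foot ∷ foot′ ∷ [] → Images → ∃ λ t → t ∈ p ∷ q ∷ [] × act iso (embed f) ≡ embed t
  onto (here refl)         (inj₁ (e , _)) = p , here refl , e
  onto (here refl)         (inj₂ (e , _)) = q , there (here refl) , e
  onto (there (here refl)) (inj₁ (_ , e)) = q , there (here refl) , e
  onto (there (here refl)) (inj₂ (_ , e)) = p , here refl , e
  from : ∀ {t} → t ∈ p ∷ q ∷ [] → Images → ∃ λ f → f ∈ foot ∷ foot′ ∷ [] × act iso (embed f) ≡ embed t
  from (here refl)         (inj₁ (e , _)) = foot , here refl , e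
  from (here refl)         (inj₂ (_ , e)) = foot′ , there (here refl) , e
  from (there (here refl)) (inj₁ (_ , e)) = foot′ , there (here refl) , e
  from (there (here refl)) (inj₂ (e , _)) = foot , here refl , e

-- Towers of bricks

T-not : ∀ {b} → T (not b) → ¬ T b
T-not {false} _ ()

-- The index counts the bricks above the layer described by the state. A tower may stop only at a
-- linked layer, since nothing further up could connect it.
data Tower : ℕ → State → Set where
  top : ∀ {s} → T (linked s) → Tower 0 s
  up₁ : ∀ {n s} → Fin (length (steps₁ s)) → Tower n single → Tower (suc n) s
  up₂ : ∀ {n s} (i : Fin (length (steps₂ s))) → Tower n (target (lookup (steps₂ s) i)) → Tower (2 + n) s

Brick : Set
Brick = ℕ × Tile ℤ

base : State → List Brick
base s = map (λ f → 0 , embed f) (feet s)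

lift : Iso → Brick → Brick
lift g (z , t) = suc z , act g t

-- The bricks `xs` were built over the normal form; together with its feet they are carried to the
-- actual layer, one level up.
rise : Move → List Brick → List Brick
rise m xs = map (lift (Move.iso m)) (base (Move.state m) ++ xs)

above : ∀ {n s} → Tower n s → List Brick
above (top _)           = []
above {s = s} (up₁ i τ) = rise (move₁ (lookup (steps₁ s) i)) (above τ)
above {s = s} (up₂ i τ) = rise (move₂ (lookup (steps₂ s) i)) (above τ)

length-above : ∀ {n s} (τ : Tower n s) → length (above τ) ≡ n
length-above (top _)   = refl
length-above (up₁ i τ) = cong suc (trans (List.length-map _ (above τ)) (length-above τ))
length-above {s = s} (up₂ i τ) = trans (List.length-map _ (base t ++ above τ))
    (trans (List.length-++ (base t)) (cong₂ _+_ (two (lookup (steps₂ s) i)) (length-above τ)))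
  where
  t = target (lookup (steps₂ s) i)
  two : ∀ st → length (base (target st)) ≡ 2
  two (step (tile alongX _ _) (tile _      _ _) _) = refl
  two (step (tile alongY _ _) (tile alongX _ _) _) = refl
  two (step (tile alongY _ _) (tile alongY _ _) _) = refl

Raised : List Brick → Set
Raised xs = ∀ {t} → (0 , t) ∉ xs

above-raised : ∀ {n s} (τ : Tower n s) → Raised (above τ)
above-raised {s = s} (up₁ i τ) t∈ with ∈-map⁻ _ t∈
... | _ , _ , ()
above-raised {s = s} (up₂ i τ) t∈ with ∈-map⁻ _ t∈
... | _ , _ , ()

∈-base⁻ : ∀ s {b} → b ∈ base s → ∃ λ f → f ∈ feet s × b ≡ (0 , embed f)
∈-base⁻ s = ∈-map⁻ (λ f → 0 , embed f)

∈-base⁺ : ∀ s {f} → f ∈ feet s → (0 , embed f) ∈ base s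
∈-base⁺ s = ∈-map⁺ (λ f → 0 , embed f)

Apart : Brick → Brick → Set
Apart (z , t) (z′ , t′) = ¬ (z ≡ z′ × T (meetsᶻ t t′))

Apart-sym : ∀ {b c} → Apart b c → Apart c b
Apart-sym {z , t} {z′ , t′} a (e , m) = a (sym e , subst T (meetsᶻ-sym t′ t) m)

lift-apart : ∀ g {b c} → Apart b c → Apart (lift g b) (lift g c)
lift-apart g {z , t} {z′ , t′} a (e , m) = a (ℕ.suc-injective e , subst T (Iso.pres g t t′) m)

Joined : State → (Brick → Set) → Set
Joined s P = T (linked s) → ∀ {f f′} → f ∈ feet s → f′ ∈ feet s → P (0 , embed f) → P (0 , embed f′)

record SoundMove (s : State) (m : Move) : Set where
  open Move m
  field
    apart   : AllPairs Apart (base state)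
    covered : Covered s (_∈ layer)
    bridged : T (linked state) → ∀ {p q} → p ∈ layer → q ∈ layer →
              ∃₂ λ f f′ → f ∈ feet s × f′ ∈ feet s × Near s f f′ × T (meets p f) × T (meets q f′)

sound₁ : ∀ s {p} → p ∈ steps₁ s → SoundMove s (move₁ p)
sound₁ s {p} p∈ = record
  { apart   = [] ∷ []
  ; covered = covering⇒covered s p (here refl) (steps₁-covering s p∈)
  ; bridged = λ { _ (here refl) (here refl) →
      let f , f∈ , m = someFoot⇒ s (covering⇒some s p (steps₁-covering s p∈))
      in f , f , f∈ , f∈ , inj₁ refl , m , m }
  }

Near-sym : ∀ s {f f′} → Near s f f′ → Near s f′ f
Near-sym s (inj₁ e) = inj₁ (sym e)
Near-sym s (inj₂ l) = inj₂ l

meetsᶻ-self : ∀ t → T (meetsᶻ t t)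
meetsᶻ-self (tile o x y) = subst₂ (λ a b → T ((a <ᵇ reachX o o) ∧ (b <ᵇ reachY o o)))
  (sym (dist-self x)) (sym (dist-self y)) (positive o)
  where
  positive : ∀ o → T ((0 <ᵇ reachX o o) ∧ (0 <ᵇ reachY o o))
  positive alongX = tt
  positive alongY = tt

meets-self : ∀ t → T (meets t t)
meets-self t = subst T (meets-embed t t) (meetsᶻ-self (embed t))

module _ (s : State) (st : Step) (sound : Sound s st) where

  open Sound sound

  private
    p = fst st
    q = snd st
    m = move₂ st

  fst≢snd : p ≢ q
  fst≢snd p≡q = T-not apart (subst (λ q → T (meets p q)) p≡q (meets-self p))

  ∈-layer : ∀ {t} → t ∈₂ st → t ∈ Move.layer m
  ∈-layer (inj₁ refl) = here refl
  ∈-layer (inj₂ refl) = there (here refl)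

  sound₂ : SoundMove s m
  sound₂ = record
    { apart   = feet-apart
    ; covered = λ f∈ → let f′ , f′∈ , near , t , t∈ , h = covered f∈ in f′ , f′∈ , near , t , ∈-layer t∈ , h
    ; bridged = bridge
    }
    where
    other : ∀ {f} → T (linked (target st)) → T (joined st)
    other = go st
      where
      go : ∀ st → T (linked (target st)) → T (joined st)
      go (step (tile alongX _ _) (tile _      _ _) _) l = l
      go (step (tile alongY _ _) (tile alongX _ _) _) l = l
      go (step (tile alongY _ _) (tile alongY _ _) _) l = l
    bridge : T (linked (target st)) → ∀ {t u} → t ∈ Move.layer m → u ∈ Move.layer m →
      ∃₂ λ f f′ → f ∈ feet s × f′ ∈ feet s × Near s f f′ × T (meets t f) × T (meets u f′)
    bridge l t∈ u∈ with bridged (other {p} l) | t∈ | u∈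
    ... | f , f′ , f∈ , f′∈ , n , h , h′ | here refl         | here refl         = f , f , f∈ , f∈ , inj₁ refl , h , h
    ... | f , f′ , f∈ , f′∈ , n , h , h′ | here refl         | there (here refl) = f , f′ , f∈ , f′∈ , n , h , h′
    ... | f , f′ , f∈ , f′∈ , n , h , h′ | there (here refl) | here refl         = f′ , f , f′∈ , f∈ , Near-sym s n , h′ , h
    ... | f , f′ , f∈ , f′∈ , n , h , h′ | there (here refl) | there (here refl) = f′ , f′ , f′∈ , f′∈ , inj₁ refl , h′ , h′
    open Placement (placement (joined st) p q)
    feet-disjoint : ¬ T (meetsᶻ (embed foot) (embed foot′))
    feet-disjoint h = T-not apart (subst T (meets-embed p q) ([ (λ { (e , e′) → subst₂ (λ t u → T (meetsᶻ t u)) e e′ h′ })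
      , (λ { (e , e′) → subst T (meetsᶻ-sym (embed q) (embed p)) (subst₂ (λ t u → T (meetsᶻ t u)) e e′ h′) }) ]′ images))
      where
      h′ = subst T (sym (Iso.pres iso (embed foot) (embed foot′))) h
    feet-apart : AllPairs Apart (base (target st))
    feet-apart = subst (λ fs → AllPairs Apart (map (λ f → 0 , embed f) fs)) (sym shape)
      (((feet-disjoint ∘ proj₂) ∷ []) ∷ [] ∷ [])

rise-apart : ∀ {s m xs} → AllPairs Apart (base s) →
             AllPairs Apart (base (Move.state m) ++ xs) → AllPairs Apart (base s ++ rise m xs)
rise-apart {s} {m} {xs} ap ih = AllPairs.++⁺ ap (AllPairs.map⁺ (AllPairs.map (lift-apart (Move.iso m)) ih))
  (All.tabulate λ b∈ → All.tabulate λ c∈ → levels b∈ c∈)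
  where
  levels : ∀ {b c} → b ∈ base s → c ∈ rise m xs → Apart b c
  levels b∈ c∈ with ∈-base⁻ s b∈ | ∈-map⁻ (lift (Move.iso m)) c∈
  ... | _ , _ , refl | _ , _ , refl = λ ()

soundness₂ : ∀ s i → Sound s (lookup (steps₂ s) i)
soundness₂ s i = steps₂-sound s (∈-lookup {xs = steps₂ s} i)

soundMove₁ : ∀ s i → SoundMove s (move₁ (lookup (steps₁ s) i))
soundMove₁ s i = sound₁ s (∈-lookup {xs = steps₁ s} i)

soundMove₂ : ∀ s i → SoundMove s (move₂ (lookup (steps₂ s) i))
soundMove₂ s i = sound₂ s (lookup (steps₂ s) i) (soundness₂ s i)

tower-apart : ∀ {n s} → AllPairs Apart (base s) → (τ : Tower n s) → AllPairs Apart (base s ++ above τ)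
tower-apart {s = s} ap (top _)   = subst (AllPairs Apart) (sym (List.++-identityʳ (base s))) ap
tower-apart {s = s} ap (up₁ i τ) = rise-apart {s} {move₁ (lookup (steps₁ s) i)} ap (tower-apart (SoundMove.apart (soundMove₁ s i)) τ)
tower-apart {s = s} ap (up₂ i τ) = rise-apart {s} {move₂ (lookup (steps₂ s) i)} ap (tower-apart (SoundMove.apart (soundMove₂ s i)) τ)

-- Connectedness of towers.

Touch : Brick → Brick → Set
Touch (z , t) (z′ , t′) = (z ≡ suc z′ ⊎ z′ ≡ suc z) × T (meetsᶻ t t′)

Touch-sym : ∀ {b c} → Touch b c → Touch c b
Touch-sym {_ , t} {_ , t′} (d , m) = swap d , subst T (meetsᶻ-sym t t′) m

lift-touch : ∀ g {b c} → Touch b c → Touch (lift g b) (lift g c)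
lift-touch g {_ , t} {_ , t′} (d , m) = [ inj₁ ∘ cong suc , inj₂ ∘ cong suc ]′ d , subst T (sym (Iso.pres g t t′)) m

Closed : (Brick → Set) → List Brick → Set
Closed P xs = ∀ {b c} → b ∈ xs → c ∈ xs → Touch b c → P b → P c

-- Connectedness of xs on top of s, phrased through properties that spread
-- along touching bricks so that it can be pulled back along lift.
Connected : State → List Brick → Set₁
Connected s xs = ∀ P → Closed P (base s ++ xs) → Joined s P →
  ∀ {b c} → b ∈ base s ++ xs → c ∈ base s ++ xs → P b → P c

module _ (s : State) (m : Move) (sound : SoundMove s m) (xs : List Brick)
         (upper : Connected (Move.state m) xs) where

  open Move m
  open SoundMove sound

  -- By `covered`, `P` passes between each foot and some brick of the new layer, so it suffices to
  -- spread `P` among the lifted bricks. There connectedness of the upper part applies to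
  -- `P ∘ lift iso`, and `bridged` supplies what it assumes about the feet.
  rise-connected : Connected s (rise m xs)
  rise-connected P closed joined {b} {c} b∈ c∈ pb =
    let b′ , b′∈ , b→ , _ = reach b∈ ; c′ , c′∈ , _ , →c = reach c∈ in →c (across b′∈ c′∈ (b→ pb))
    where
    raised : ∀ {b} → b ∈ base state ++ xs → lift iso b ∈ base s ++ rise m xs
    raised b∈ = ∈-++⁺ʳ (base s) (∈-map⁺ (lift iso) b∈)
    foot∈ : ∀ {f} → f ∈ feet s → (0 , embed f) ∈ base s ++ rise m xs
    foot∈ f∈ = ∈-++⁺ˡ (∈-base⁺ s f∈)
    lowest : ∀ {p} → p ∈ layer → ∃ λ b → b ∈ base state ++ xs × lift iso b ≡ (1 , embed p)
    lowest p∈ = let f , f∈ , e = from p∈ in _ , ∈-++⁺ˡ (∈-base⁺ state f∈) , cong (1 ,_) e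
    layer∈ : ∀ {p} → p ∈ layer → (1 , embed p) ∈ base s ++ rise m xs
    layer∈ p∈ = let b , b∈ , e = lowest p∈ in subst (_∈ base s ++ rise m xs) e (raised b∈)
    down : ∀ {p f} → p ∈ layer → f ∈ feet s → T (meets p f) → P (1 , embed p) → P (0 , embed f)
    down {p} {f} p∈ f∈ h = closed (layer∈ p∈) (foot∈ f∈) (inj₁ refl , subst T (sym (meets-embed p f)) h)
    climb : ∀ {p f} → p ∈ layer → f ∈ feet s → T (meets p f) → P (0 , embed f) → P (1 , embed p)
    climb {p} {f} p∈ f∈ h = closed (foot∈ f∈) (layer∈ p∈)
      (Touch-sym {1 , embed p} {0 , embed f} (inj₁ refl , subst T (sym (meets-embed p f)) h))
    near : ∀ {f f′} → f ∈ feet s → f′ ∈ feet s → Near s f f′ → P (0 , embed f) → P (0 , embed f′)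
    near f∈ f′∈ (inj₁ refl) = id
    near f∈ f′∈ (inj₂ l)    = joined l f∈ f′∈
    -- A detour below: from one brick of the layer down to a foot, along the feet, and up to the
    -- other brick.
    joined′ : Joined state (P ∘ lift iso)
    joined′ l f∈ f′∈ pf with onto f∈ | onto f′∈
    ... | p , p∈ , e | q , q∈ , e′ with bridged l p∈ q∈
    ...   | h , h′ , h∈ , h′∈ , n , mp , mq = subst (λ t → P (1 , t)) (sym e′)
      (climb q∈ h′∈ mq (near h∈ h′∈ n (down p∈ h∈ mp (subst (λ t → P (1 , t)) e pf))))
    across : ∀ {b c} → b ∈ base state ++ xs → c ∈ base state ++ xs → P (lift iso b) → P (lift iso c)
    across = upper (P ∘ lift iso)
      (λ {b} {c} b∈ c∈ t → closed (raised b∈) (raised c∈) (lift-touch iso {b} {c} t)) joined′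
    reach : ∀ {b} → b ∈ base s ++ rise m xs →
            ∃ λ b′ → b′ ∈ base state ++ xs × (P b → P (lift iso b′)) × (P (lift iso b′) → P b)
    reach b∈ with ∈-++⁻ (base s) b∈
    ... | inj₂ b∈′ with ∈-map⁻ (lift iso) b∈′
    ...   | b′ , b′∈ , refl = b′ , b′∈ , id , id
    reach b∈ | inj₁ b∈′ with ∈-base⁻ s b∈′
    ...   | f , f∈ , refl with covered f∈
    ...     | f′ , f′∈ , n , p , p∈ , h with lowest p∈
    ...       | b′ , b′∈ , e = b′ , b′∈
      , (λ pf → subst P (sym e) (climb p∈ f′∈ h (near f∈ f′∈ n pf)))
      , (λ pb → near f′∈ f∈ (Near-sym s n) (down p∈ f′∈ h (subst P e pb)))

tower-connected : ∀ {n s} (τ : Tower n s) → Connected s (above τ)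
tower-connected {s = s} (top l) P closed joined b∈ c∈ pb
  with ∈-base⁻ s (subst (_ ∈_) (List.++-identityʳ (base s)) b∈) | ∈-base⁻ s (subst (_ ∈_) (List.++-identityʳ (base s)) c∈)
... | f , f∈ , refl | f′ , f′∈ , refl = joined l f∈ f′∈ pb
tower-connected {s = s} (up₁ i τ) = rise-connected s _ (soundMove₁ s i) (above τ) (tower-connected τ)
tower-connected {s = s} (up₂ i τ) = rise-connected s _ (soundMove₂ s i) (above τ) (tower-connected τ)

-- Recovering a tower from its set of bricks.

infix 4 _⊑_

record _⊑_ (xs ys : List Brick) : Set where
  constructor ⊑-intro
  field
    ⊑-elim : ∀ {b} → b ∈ xs → b ∈ ys

open _⊑_ public

-- Level 1 of `rise m′ xs′` holds nothing but the layer, because `xs′` has no brick at level 0.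
rise-layer : ∀ m m′ {xs xs′} → Raised xs′ → rise m xs ⊑ rise m′ xs′ →
             ∀ {p} → p ∈ Move.layer m → p ∈ Move.layer m′
rise-layer m m′ {xs} {xs′} raised sub {p} p∈ with Move.from m p∈
... | f , f∈ , e with ∈-map⁻ (lift (Move.iso m′)) (⊑-elim sub {1 , embed p} (subst (_∈ rise m xs) (cong (1 ,_) e)
                        (∈-map⁺ (lift (Move.iso m)) (∈-++⁺ˡ (∈-base⁺ (Move.state m) f∈)))))
...   | (z , t) , b∈ , eq with ℕ.suc-injective (cong proj₁ eq) | ∈-++⁻ (base (Move.state m′)) b∈
...     | refl | inj₂ b∈′ = contradiction b∈′ raised
...     | refl | inj₁ b∈′ with ∈-base⁻ (Move.state m′) b∈′
...       | f′ , f′∈ , refl with Move.onto m′ f′∈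
...         | q , q∈ , e′ = subst (_∈ Move.layer m′) (embed-injective (trans (sym e′) (sym (cong proj₂ eq)))) q∈

rise-⊑ : ∀ m {xs xs′} → Raised xs → rise m xs ⊑ rise m xs′ → xs ⊑ xs′
⊑-elim (rise-⊑ m {xs} {xs′} raised sub) {z , t} b∈ with ∈-map⁻ (lift (Move.iso m)) (⊑-elim sub (∈-map⁺ (lift (Move.iso m)) (∈-++⁺ʳ (base (Move.state m)) b∈)))
... | (z′ , t′) , c∈ , eq with ℕ.suc-injective (cong proj₁ eq) | Iso.injective (Move.iso m) (cong proj₂ eq)
...   | refl | refl with ∈-++⁻ (base (Move.state m)) c∈
...     | inj₂ c∈′ = c∈′
...     | inj₁ c∈′ with ∈-base⁻ (Move.state m) c∈′
...       | _ , _ , refl = contradiction b∈ raised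

within : ∀ st st′ → (∀ {p} → p ∈ Move.layer (move₂ st) → p ∈ Move.layer (move₂ st′)) → Within (ends st) (ends st′)
within st st′ sub = one (sub (here refl)) , one (sub (there (here refl)))
  where
  one : ∀ {t} → t ∈ Move.layer (move₂ st′) → t ≡ fst st′ ⊎ t ≡ snd st′
  one (here e)         = inj₁ e
  one (there (here e)) = inj₂ e

one≢two : ∀ s p st → Sound s st → ¬ (∀ {t} → t ∈ Move.layer (move₂ st) → t ∈ Move.layer (move₁ p))
one≢two s p st sound sub with sub (here refl) | sub (there (here refl))
... | here e | here e′ = fst≢snd s st sound (trans e (sym e′))

steps₁-index : ∀ s i j {p} → p ∈ Move.layer (move₁ (lookup (steps₁ s) j)) → p ≡ lookup (steps₁ s) i → i ≡ j
steps₁-index s i j (here refl) e = decidable-stable (i Fin.≟ j)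
  (λ i≢j → AllPairs-lookup ≢-sym (steps₁-unique s) i j i≢j (sym e))

steps₂-index : ∀ s i j → let m = move₂ (lookup (steps₂ s) i) ; m′ = move₂ (lookup (steps₂ s) j) in
               (∀ {p} → p ∈ Move.layer m → p ∈ Move.layer m′) →
               (∀ {p} → p ∈ Move.layer m′ → p ∈ Move.layer m) → i ≡ j
steps₂-index s i j sub sup = decidable-stable (i Fin.≟ j) λ i≢j →
  AllPairs-lookup (λ d (w , w′) → d (w′ , w)) (steps₂-distinct s) i j i≢j ( within (lookup (steps₂ s) i) (lookup (steps₂ s) j) sub , within (lookup (steps₂ s) j) (lookup (steps₂ s) i) sup)

unrise₁ : ∀ {n s} i (τ τ′ : Tower n single) → above (up₁ {s = s} i τ) ⊑ above (up₁ {s = s} i τ′) → above τ ⊑ above τ′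
unrise₁ {s = s} i τ τ′ = rise-⊑ (move₁ (lookup (steps₁ s) i)) {above τ} {above τ′} (above-raised τ)

unrise₂ : ∀ {n s} i (τ τ′ : Tower n (target (lookup (steps₂ s) i))) →
          above (up₂ {s = s} i τ) ⊑ above (up₂ {s = s} i τ′) → above τ ⊑ above τ′
unrise₂ {s = s} i τ τ′ = rise-⊑ (move₂ (lookup (steps₂ s) i)) {above τ} {above τ′} (above-raised τ)

index₁ : ∀ {n s} i j (τ τ′ : Tower n single) → above (up₁ {s = s} i τ) ⊑ above (up₁ {s = s} j τ′) → i ≡ j
index₁ {s = s} i j τ τ′ sub = steps₁-index s i j
  (rise-layer (move₁ (lookup (steps₁ s) i)) (move₁ (lookup (steps₁ s) j)) {above τ} {above τ′} (above-raised τ′) sub (here refl)) refl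

index₂ : ∀ {n s} i j (τ : Tower n (target (lookup (steps₂ s) i))) (τ′ : Tower n (target (lookup (steps₂ s) j))) →
         above (up₂ {s = s} i τ) ⊑ above (up₂ {s = s} j τ′) → above (up₂ {s = s} j τ′) ⊑ above (up₂ {s = s} i τ) → i ≡ j
index₂ {s = s} i j τ τ′ sub sup = steps₂-index s i j
  (rise-layer (move₂ (lookup (steps₂ s) i)) (move₂ (lookup (steps₂ s) j)) {above τ} {above τ′} (above-raised τ′) sub)
  (rise-layer (move₂ (lookup (steps₂ s) j)) (move₂ (lookup (steps₂ s) i)) {above τ′} {above τ} (above-raised τ) sup)

-- Two distinct bricks at level 1 cannot both be the single brick of a one-brick layer.
clash : ∀ {n s} i j (τ : Tower (suc n) single) (τ′ : Tower n (target (lookup (steps₂ s) j))) →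
        ¬ (above (up₂ {s = s} j τ′) ⊑ above (up₁ {s = s} i τ))
clash {s = s} i j τ τ′ sub = one≢two s (lookup (steps₁ s) i) (lookup (steps₂ s) j) (soundness₂ s j)
  (rise-layer (move₂ (lookup (steps₂ s) j)) (move₁ (lookup (steps₁ s) i)) {above τ′} {above τ} (above-raised τ) sub)

inject₁ : ∀ {n s i j} → i ≡ j → (τ τ′ : Tower n single) →
          (above τ ⊑ above τ′ → above τ′ ⊑ above τ → τ ≡ τ′) →
          above (up₁ {s = s} i τ) ⊑ above (up₁ {s = s} j τ′) → above (up₁ {s = s} j τ′) ⊑ above (up₁ {s = s} i τ) →
          up₁ {s = s} i τ ≡ up₁ {s = s} j τ′
inject₁ {s = s} {i} refl τ τ′ ih sub sup =
  cong (up₁ {s = s} i) (ih (unrise₁ {s = s} i τ τ′ sub) (unrise₁ {s = s} i τ′ τ sup))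

-- The types of `τ` and `τ′` depend on `i` and `j`, so the indices are identified before the towers
-- can be compared at all.
inject₂ : ∀ {n s i j} → i ≡ j →
          (τ : Tower n (target (lookup (steps₂ s) i))) (τ′ : Tower n (target (lookup (steps₂ s) j))) →
          (∀ τ′ → above τ ⊑ above τ′ → above τ′ ⊑ above τ → τ ≡ τ′) →
          above (up₂ {s = s} i τ) ⊑ above (up₂ {s = s} j τ′) → above (up₂ {s = s} j τ′) ⊑ above (up₂ {s = s} i τ) →
          up₂ {s = s} i τ ≡ up₂ {s = s} j τ′
inject₂ {s = s} {i} refl τ τ′ ih sub sup =
  cong (up₂ {s = s} i) (ih τ′ (unrise₂ {s = s} i τ τ′ sub) (unrise₂ {s = s} i τ′ τ sup))

-- Level 1 determines the first step; the isometry of that step is injective, so undoing it leaves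
-- the same comparison for the rest of the tower.
above-injective : ∀ {n s} (τ τ′ : Tower n s) → above τ ⊑ above τ′ → above τ′ ⊑ above τ → τ ≡ τ′
above-injective (top l) (top l′) _ _ = cong top (T-irrelevant l l′)
above-injective {s = s} (up₁ i τ) (up₁ j τ′) sub sup =
  inject₁ {s = s} (index₁ {s = s} i j τ τ′ sub) τ τ′ (above-injective τ τ′) sub sup
above-injective {s = s} (up₂ i τ) (up₂ j τ′) sub sup =
  inject₂ {s = s} (index₂ {s = s} i j τ τ′ sub sup) τ τ′ (above-injective τ) sub sup
above-injective {s = s} (up₁ i τ) (up₂ j τ′) _   sup = contradiction sup (clash {s = s} i j τ τ′)
above-injective {s = s} (up₂ i τ) (up₁ j τ′) sub _   = contradiction sub (clash {s = s} j i τ′ τ)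

-- Counting towers

concatMap-unique : ∀ {A B : Set} (g : A → List B) → (∀ x → Unique (g x)) →
                   (∀ {x y b} → b ∈ g x → b ∈ g y → x ≡ y) →
                   ∀ {xs} → Unique xs → Unique (concatMap g xs)
concatMap-unique g u tag uxs = Unique.concat⁺ (All.map⁺ (All.universal u _))
  (AllPairs.map⁺ {f = g} (AllPairs.map (λ x≢y {_} (b∈ , b∈′) → x≢y (tag b∈ b∈′)) uxs))

tops : ∀ {s} → Dec (T (linked s)) → List (Tower 0 s)
tops (yes l) = top l ∷ []
tops (no _)  = []

towers : ∀ n s → List (Tower n s)
via₁ : ∀ n s → Fin (length (steps₁ s)) → List (Tower (suc n) s)
via₂ : ∀ n s → Fin (length (steps₂ s)) → List (Tower (suc n) s)

towers zero    s = tops (T? (linked s))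
towers (suc n) s = concatMap (via₁ n s) (allFin _) ++ concatMap (via₂ n s) (allFin _)

via₁ n       s i = map (up₁ {s = s} i) (towers n single)
-- With one brick left there is no room for a two-brick layer.
via₂ zero    s i = []
via₂ (suc n) s i = map (up₂ {s = s} i) (towers n (target (lookup (steps₂ s) i)))

up₁-injective : ∀ {n s i} {τ τ′ : Tower n single} → up₁ {s = s} i τ ≡ up₁ {s = s} i τ′ → τ ≡ τ′
up₁-injective refl = refl

up₂-injective : ∀ {n s i} {τ τ′ : Tower n (target (lookup (steps₂ s) i))} → up₂ {s = s} i τ ≡ up₂ {s = s} i τ′ → τ ≡ τ′
up₂-injective refl = refl

towers-unique : ∀ n s → Unique (towers n s)
towers-unique zero s with T? (linked s)
... | yes _ = [] ∷ []
... | no _  = []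
towers-unique (suc n) s = Unique.++⁺
    (concatMap-unique (via₁ n s) (λ i → Unique.map⁺ (up₁-injective {s = s}) (towers-unique n single)) tag₁ (Unique.allFin⁺ _))
    (concatMap-unique (via₂ n s) (via₂-unique n) (tag₂ n) (Unique.allFin⁺ _))
    λ (τ∈ , τ∈′) → up₁≢up₂ n (find₁ τ∈) (find₂ n τ∈′)
  where
  via₂-unique : ∀ n i → Unique (via₂ n s i)
  via₂-unique zero    i = []
  via₂-unique (suc n) i = Unique.map⁺ (up₂-injective {s = s}) (towers-unique n (target (lookup (steps₂ s) i)))
  tag₁ : ∀ {i j b} → b ∈ via₁ n s i → b ∈ via₁ n s j → i ≡ j
  tag₁ {i} {j} b∈ b∈′ with ∈-map⁻ (up₁ {s = s} i) b∈ | ∈-map⁻ (up₁ {s = s} j) b∈′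
  ... | _ , _ , refl | _ , _ , refl = refl
  tag₂ : ∀ n {i j b} → b ∈ via₂ n s i → b ∈ via₂ n s j → i ≡ j
  tag₂ (suc n) {i} {j} b∈ b∈′ with ∈-map⁻ (up₂ {s = s} i) b∈ | ∈-map⁻ (up₂ {s = s} j) b∈′
  ... | _ , _ , refl | _ , _ , refl = refl
  -- The index equation is kept explicit because `n` is a variable and need not be a successor, as
  -- `up₂` would demand.
  Is₁ Is₂ : ∀ {n} → Tower n s → Set
  Is₁ {n} τ = ∃ λ m → Σ (n ≡ suc m) λ e → ∃₂ λ i τ′ → subst (λ n → Tower n s) e τ ≡ up₁ {s = s} i τ′
  Is₂ {n} τ = ∃ λ m → Σ (n ≡ 2 + m) λ e → ∃₂ λ i τ′ → subst (λ n → Tower n s) e τ ≡ up₂ {s = s} i τ′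
  find₁ : ∀ {τ} → τ ∈ concatMap (via₁ n s) (allFin _) → Is₁ τ
  find₁ τ∈ with satisfied (∈-concatMap⁻ (via₁ n s) {xs = allFin _} τ∈)
  ... | i , τ∈′ with ∈-map⁻ (up₁ {s = s} i) τ∈′
  ...   | τ′ , _ , refl = n , refl , i , τ′ , refl
  find₂ : ∀ n {τ} → τ ∈ concatMap (via₂ n s) (allFin _) → Is₂ τ
  find₂ n τ∈ with satisfied (∈-concatMap⁻ (via₂ n s) {xs = allFin _} τ∈)
  find₂ (suc n) τ∈ | i , τ∈′ with ∈-map⁻ (up₂ {s = s} i) τ∈′
  ...   | τ′ , _ , refl = n , refl , i , τ′ , refl
  up₁≢up₂ : ∀ n {τ : Tower (suc n) s} → Is₁ τ → ¬ Is₂ τ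
  up₁≢up₂ n (_ , refl , i , τ , refl) (_ , refl , j , τ′ , ())

count : ℕ → State → ℕ
count n s = length (towers n s)

length-via₁ : ∀ n s → length (concatMap (via₁ n s) (allFin _)) ≡ length (steps₁ s) * count n single
length-via₁ n s = begin
  length (concatMap (via₁ n s) (allFin _))             ≡⟨ length-concatMap (via₁ n s) (allFin _) ⟩
  Σ[ allFin k ] (λ i → length (via₁ n s i))            ≡⟨ Σ-cong (allFin k) (λ i → List.length-map (up₁ {s = s} i) (towers n single)) ⟩
  Σ[ allFin k ] (λ _ → count n single)                 ≡⟨ Σ-const (allFin k) (count n single) ⟩
  length (allFin k) * count n single                   ≡⟨ cong (_* count n single) (List.length-tabulate {n = k} id) ⟩
  k * count n single                                   ∎
  where
  open ≡-Reasoning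
  k = length (steps₁ s)

length-via₂ : ∀ n s → length (concatMap (via₂ (suc n) s) (allFin _)) ≡ Σ[ steps₂ s ] (λ st → count n (target st))
length-via₂ n s = begin
  length (concatMap (via₂ (suc n) s) (allFin _))          ≡⟨ length-concatMap (via₂ (suc n) s) (allFin _) ⟩
  Σ[ allFin k ] (λ i → length (via₂ (suc n) s i))         ≡⟨ Σ-cong (allFin k) (λ i → List.length-map (up₂ {s = s} i) (towers n (target (lookup (steps₂ s) i)))) ⟩
  Σ[ allFin k ] (λ i → count n (target (lookup (steps₂ s) i))) ≡⟨ Σ-tabulate (steps₂ s) (λ st → count n (target st)) ⟩
  Σ[ steps₂ s ] (λ st → count n (target st))              ∎
  where
  open ≡-Reasoning
  k = length (steps₂ s)

count-≥ : ∀ n s → length (steps₁ s) * count n single ≤ count (suc n) s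
count-≥ n s = begin
  length (steps₁ s) * count n single ≡⟨ length-via₁ n s ⟨
  length (concatMap (via₁ n s) (allFin _)) ≤⟨ ℕ.m≤m+n _ _ ⟩
  length (concatMap (via₁ n s) (allFin _)) + length (concatMap (via₂ n s) (allFin _)) ≡⟨ List.length-++ (concatMap (via₁ n s) (allFin _)) ⟨
  count (suc n) s ∎
  where open ℕ.≤-Reasoning

count-recurrence : ∀ n s → count (2 + n) s ≡ length (steps₁ s) * count (suc n) single
                                              + Σ[ steps₂ s ] (λ st → count n (target st))
count-recurrence n s = trans (List.length-++ (concatMap (via₁ (suc n) s) (allFin _)))
  (cong₂ _+_ (length-via₁ (suc n) s) (length-via₂ n s))

∈⇒≤Σ : ∀ {A : Set} {x : A} {xs} (f : A → ℕ) → x ∈ xs → f x ≤ Σ[ xs ] f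
∈⇒≤Σ f (here refl) = ℕ.m≤m+n (f _) _
∈⇒≤Σ {xs = y ∷ xs} f (there x∈) = ℕ.≤-trans (∈⇒≤Σ f x∈) (ℕ.m≤n+m _ (f y))

count-single : ∀ n → 0 < count n single
count-heavy  : ∀ n s → 60 ≤ weight s → 0 < count (suc n) s

count-single zero    = s≤s z≤n
count-single (suc n) = count-heavy n single (ℕ.m≤m+n 60 940)

count-heavy n s w = ℕ.≤-trans (ℕ.*-mono-≤ (Checked.covers (checked s) w) (count-single n)) (count-≥ n s)

-- Two bricks lead to a pair heavy enough to be covered, one brick covers it, and `n` single bricks
-- follow: hence `3 + n`.
count-positive : ∀ n s → 0 < weight s → 0 < count (3 + n) s
count-positive n s 0<w =
  let st , st∈ , w = Checked.improves (checked s) 0<w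
  in begin
    1                                                    ≤⟨ count-heavy n (target st) w ⟩
    count (suc n) (target st)                            ≤⟨ ∈⇒≤Σ (λ st → count (suc n) (target st)) st∈ ⟩
    Σ[ steps₂ s ] (λ st → count (suc n) (target st))     ≤⟨ ℕ.m≤n+m _ _ ⟩
    length (steps₁ s) * count (2 + n) single + Σ[ steps₂ s ] (λ st → count (suc n) (target st)) ≡⟨ count-recurrence (suc n) s ⟨
    count (3 + n) s                                      ∎
  where open ℕ.≤-Reasoning

rows-light : ∀ l o → All (All (_≤ 3000)) (weights l o)
rows-light true  alongX = toWitness {a? = All.all? (All.all? (ℕ._≤? 3000)) (weights true  alongX)} tt
rows-light true  alongY = toWitness {a? = All.all? (All.all? (ℕ._≤? 3000)) (weights true  alongY)} tt
rows-light false alongX = toWitness {a? = All.all? (All.all? (ℕ._≤? 3000)) (weights false alongX)} tt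
rows-light false alongY = toWitness {a? = All.all? (All.all? (ℕ._≤? 3000)) (weights false alongY)} tt

weight≤3000 : ∀ s → weight s ≤ 3000
weight≤3000 single             = ℕ.m≤m+n 1000 2000
weight≤3000 (double l o dx dy) = entry-All {P = _≤ 3000} z≤n (entry-All {P = All (_≤ 3000)} [] (rows-light l o) dx) dy

-- Exponential growth from a subharmonic weight.

module _ (p q bound : ℕ) .{{_ : NonZero p}} .{{_ : NonZero q}} (w : State → ℕ) (c : ℕ → State → ℕ)
         (w≤bound : ∀ s → w s ≤ bound)
         (supported : ∀ n s → 0 < w s → 0 < c (3 + n) s)
         (recurrence : ∀ n s → c (2 + n) s ≡ length (steps₁ s) * c (suc n) single + Σ[ steps₂ s ] (λ st → c n (target st)))
         (sub : ∀ s → p * p * w s ≤ p * q * (length (steps₁ s) * w single) + q * q * Σ[ steps₂ s ] (w ∘ target))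
  where

  private
    -- The factor p⁴ takes care of the initial cases.
    initialScale : ℕ
    initialScale = p ^ 4 * bound

    initial : ∀ n s → 3 + n ≤ 4 → p ^ (3 + n) * w s ≤ initialScale * (q ^ (3 + n) * c (3 + n) s)
    initial n s n≤ with w s in eq
    ... | zero  = subst (_≤ initialScale * (q ^ (3 + n) * c (3 + n) s)) (sym (ℕ.*-zeroʳ (p ^ (3 + n)))) z≤n
    ... | suc v = begin
      p ^ (3 + n) * suc v                     ≤⟨ ℕ.*-mono-≤ (ℕ.^-monoʳ-≤ p n≤) (subst (_≤ bound) eq (w≤bound s)) ⟩
      initialScale                                   ≡⟨ ℕ.*-identityʳ initialScale ⟨
      initialScale * 1                               ≤⟨ ℕ.*-monoʳ-≤ initialScale (ℕ.*-mono-≤ (ℕ.m^n>0 q (3 + n)) (supported n s (subst (0 <_) (sym eq) (s≤s z≤n)))) ⟩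
      initialScale * (q ^ (3 + n) * c (3 + n) s) ∎
      where open ℕ.≤-Reasoning

  -- Two-step induction, matching the recurrence. It starts at 3 because from there on every state
  -- of positive weight has a tower, which makes the initial cases a matter of the constant.
  subharmonic-growth : ∀ n s → p ^ (3 + n) * w s ≤ p ^ 4 * bound * (q ^ (3 + n) * c (3 + n) s)
  subharmonic-growth zero          s = initial 0 s (ℕ.m≤m+n 3 1)
  subharmonic-growth (suc zero)    s = initial 1 s ℕ.≤-refl
  subharmonic-growth (suc (suc n)) s = begin
    p * (p * x) * w s                                ≡⟨ e₁ p x (w s) ⟩
    x * (p * p * w s)                                ≤⟨ ℕ.*-monoʳ-≤ x (sub s) ⟩
    x * (p * q * (k * w single) + q * q * Σ[ steps₂ s ] (w ∘ target)) ≡⟨ e₂ p q x k (w single) (Σ[ steps₂ s ] (w ∘ target)) ⟩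
    q * (k * (p * x * w single)) + q * q * (x * Σ[ steps₂ s ] (w ∘ target))
      ≡⟨ cong (λ t → q * (k * (p * x * w single)) + q * q * t) (Σ-*ˡ x (steps₂ s) (w ∘ target)) ⟨
    q * (k * (p * x * w single)) + q * q * Σ[ steps₂ s ] (λ st → x * w (target st))
      ≤⟨ ℕ.+-mono-≤ (ℕ.*-monoʳ-≤ q (ℕ.*-monoʳ-≤ k (subharmonic-growth (suc n) single)))
                    (ℕ.*-monoʳ-≤ (q * q) (Σ-mono (steps₂ s) (λ st → subharmonic-growth n (target st)))) ⟩
    q * (k * (initialScale * (q * y * c (4 + n) single))) + q * q * Σ[ steps₂ s ] (λ st → initialScale * (y * c (3 + n) (target st)))
      ≡⟨ cong (λ t → q * (k * (initialScale * (q * y * c (4 + n) single))) + q * q * t) (trans (Σ-*ˡ initialScale (steps₂ s) _) (cong (initialScale *_) (Σ-*ˡ y (steps₂ s) _))) ⟩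
    q * (k * (initialScale * (q * y * c (4 + n) single))) + q * q * (initialScale * (y * Σ[ steps₂ s ] (λ st → c (3 + n) (target st))))
      ≡⟨ e₃ q initialScale k y (c (4 + n) single) (Σ[ steps₂ s ] (λ st → c (3 + n) (target st))) ⟩
    initialScale * (q * (q * y) * (k * c (4 + n) single + Σ[ steps₂ s ] (λ st → c (3 + n) (target st))))
      ≡⟨ cong (λ t → initialScale * (q * (q * y) * t)) (recurrence (3 + n) s) ⟨
    initialScale * (q * (q * y) * c (5 + n) s)          ∎
    where
    open ℕ.≤-Reasoning
    x = p ^ (3 + n)
    y = q ^ (3 + n)
    k = length (steps₁ s)
    e₁ : ∀ p x w → p * (p * x) * w ≡ x * (p * p * w)
    e₁ = ℕ-Solver.solve-∀
    e₂ : ∀ p q x k w z → x * (p * q * (k * w) + q * q * z) ≡ q * (k * (p * x * w)) + q * q * (x * z)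
    e₂ = ℕ-Solver.solve-∀
    e₃ : ∀ q d k y c z → q * (k * (d * (q * y * c))) + q * q * (d * (y * z)) ≡ d * (q * (q * y) * (k * c + z))
    e₃ = ℕ-Solver.solve-∀

opaque

  scale : ℕ
  scale = 392 ^ 4 * 3000

  scale≢0 : NonZero scale
  scale≢0 = _

  growth : ∀ n → 392 ^ (3 + n) * weight single ≤ scale * (5 ^ (3 + n) * count (3 + n) single)
  growth n = subharmonic-growth 392 5 3000 weight count weight≤3000 count-positive count-recurrence
    (λ s → Checked.subharmonic (checked s)) n single

-- Buildings up to motion

half : Orientation → ℕ
half alongX = 2
half alongY = 1

half-pos : ∀ o → 0 ℕ.< half o
half-pos alongX = ℕ.s≤s ℕ.z≤n
half-pos alongY = ℕ.s≤s ℕ.z≤n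

lengthX≡ : ∀ o → lengthX o ≡ + half o ℤ.+ + half o
lengthX≡ alongX = refl
lengthX≡ alongY = refl

lengthY≡ : ∀ o → lengthY o ≡ + half (turn o) ℤ.+ + half (turn o)
lengthY≡ alongX = refl
lengthY≡ alongY = refl

reachX≡ : ∀ o o′ → reachX o o′ ≡ half o ℕ.+ half o′
reachX≡ alongX alongX = refl
reachX≡ alongX alongY = refl
reachX≡ alongY alongX = refl
reachX≡ alongY alongY = refl

toBlock : Brick → Block
toBlock (z , tile o x y) = block o (x ℤ.- + half o) (y ℤ.- + half (turn o)) (+ z)

Spans : ℤ → ℤ → ℤ → Set
Spans x l i = x ℤ.≤ i × i ℤ.< x ℤ.+ l

resize : ∀ {l l′} x i → l ≡ l′ → Spans x l i → Spans x l′ i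
resize x i e = subst (λ l → Spans x l i) e

dist-< : ∀ {x y n} → x ℤ.- y ℤ.< + n → y ℤ.- x ℤ.< + n → dist x y ℕ.< n
dist-< {x} {y} {n} p q = go (x ℤ.- y) p (subst (ℤ._< + n) (flip x y) q)
  where
  flip : ∀ x y → y ℤ.- x ≡ ℤ.- (x ℤ.- y)
  flip = ℤ-Solver.solve-∀
  go : ∀ d → d ℤ.< + n → ℤ.- d ℤ.< + n → ℤ.∣ d ∣ ℕ.< n
  go (+ m)    (ℤ.+<+ m<n) _           = m<n
  go -[1+ m ] _           (ℤ.+<+ m<n) = m<n

difference<dist : ∀ {x y n} → dist x y ℕ.< n → x ℤ.- y ℤ.< + n
difference<dist {x} {y} {n} = go (x ℤ.- y)
  where
  go : ∀ d → ℤ.∣ d ∣ ℕ.< n → d ℤ.< + n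
  go (+ m)    m<n = ℤ.+<+ m<n
  go -[1+ m ] _   = ℤ.-<+

module _ (h h′ : ℕ) (x x′ : ℤ) where

  private
    a  = x ℤ.- + h
    l  = + h ℤ.+ + h
    a′ = x′ ℤ.- + h′
    l′ = + h′ ℤ.+ + h′

  -- A common unit cell puts each left end strictly before the other right end; rewritten for the
  -- centres, these are the two inequalities for the distance.
  spans⇒dist : ∀ {i} → Spans a l i → Spans a′ l′ i → dist x x′ ℕ.< h ℕ.+ h′
  spans⇒dist (a≤i , i<a+l) (a′≤i , i<a′+l′) = dist-< {x} {x′}
    (subst₂ ℤ._<_ (e₁ x x′ (+ h)) (e₂ x′ (+ h) (+ h′))
      (ℤ.+-monoˡ-< (+ h ℤ.- x′) (ℤ.≤-<-trans a≤i i<a′+l′)))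
    (subst₂ ℤ._<_ (e₁ x′ x (+ h′)) (e₃ x (+ h) (+ h′))
      (ℤ.+-monoˡ-< (+ h′ ℤ.- x) (ℤ.≤-<-trans a′≤i i<a+l)))
    where
    e₁ : ∀ x x′ h → (x ℤ.- h) ℤ.+ (h ℤ.- x′) ≡ x ℤ.- x′
    e₁ = ℤ-Solver.solve-∀
    e₂ : ∀ x′ h h′ → (x′ ℤ.- h′ ℤ.+ (h′ ℤ.+ h′)) ℤ.+ (h ℤ.- x′) ≡ h ℤ.+ h′
    e₂ = ℤ-Solver.solve-∀
    e₃ : ∀ x h h′ → (x ℤ.- h ℤ.+ (h ℤ.+ h)) ℤ.+ (h′ ℤ.- x) ≡ h ℤ.+ h′
    e₃ = ℤ-Solver.solve-∀

  starts : 0 ℕ.< h → Spans a l a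
  starts 0<h = ℤ.≤-refl , subst (ℤ._< a ℤ.+ l) (ℤ.+-identityʳ a)
    (ℤ.+-monoʳ-< a (ℤ.+<+ (ℕ.<-≤-trans 0<h (ℕ.m≤m+n h h))))

  within-reach : dist x x′ ℕ.< h ℕ.+ h′ → a′ ℤ.< a ℤ.+ l
  within-reach d = subst₂ ℤ._<_ (e₁ x x′ (+ h′)) (e₂ x (+ h) (+ h′))
    (ℤ.+-monoˡ-< (x ℤ.- + h′) (difference<dist {x′} {x} (subst (ℕ._< h ℕ.+ h′) (dist-sym x x′) d)))
    where
    e₁ : ∀ x x′ h′ → (x′ ℤ.- x) ℤ.+ (x ℤ.- h′) ≡ x′ ℤ.- h′
    e₁ = ℤ-Solver.solve-∀
    e₂ : ∀ x h h′ → (h ℤ.+ h′) ℤ.+ (x ℤ.- h′) ≡ x ℤ.- h ℤ.+ (h ℤ.+ h)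
    e₂ = ℤ-Solver.solve-∀

-- The larger of the two left ends is a common cell.
dist⇒spans : ∀ h h′ x x′ → 0 ℕ.< h → 0 ℕ.< h′ → dist x x′ ℕ.< h ℕ.+ h′ →
  ∃ λ i → Spans (x ℤ.- + h) (+ h ℤ.+ + h) i × Spans (x′ ℤ.- + h′) (+ h′ ℤ.+ + h′) i
dist⇒spans h h′ x x′ 0<h 0<h′ d with ℤ.≤-total (x ℤ.- + h) (x′ ℤ.- + h′)
... | inj₁ a≤a′ = _ , (a≤a′ , within-reach h h′ x x′ d) , starts h′ h x′ x 0<h′
... | inj₂ a′≤a = _ , starts h h′ x x′ 0<h
  , (a′≤a , within-reach h′ h x′ x (subst₂ ℕ._<_ (dist-sym x x′) (ℕ.+-comm h h′) d))

overlap⇒meets : ∀ b c → ProjectionsOverlap (toBlock b) (toBlock c) → T (meetsᶻ (proj₂ b) (proj₂ c))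
overlap⇒meets (_ , tile o x y) (_ , tile o′ x′ y′) (i , j , (xi , yj) , (xi′ , yj′)) = Equivalence.from T-∧
  ( ℕ.<⇒<ᵇ (subst (dist x x′ ℕ.<_) (sym (reachX≡ o o′))
      (spans⇒dist (half o) (half o′) x x′ (resize (x ℤ.- + half o) i (lengthX≡ o) xi) (resize (x′ ℤ.- + half o′) i (lengthX≡ o′) xi′)))
  , ℕ.<⇒<ᵇ (subst (dist y y′ ℕ.<_) (sym (reachX≡ (turn o) (turn o′)))
      (spans⇒dist (half (turn o)) (half (turn o′)) y y′ (resize (y ℤ.- + half (turn o)) j (lengthY≡ o) yj) (resize (y′ ℤ.- + half (turn o′)) j (lengthY≡ o′) yj′))))

meets⇒overlap : ∀ b c → T (meetsᶻ (proj₂ b) (proj₂ c)) → ProjectionsOverlap (toBlock b) (toBlock c)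
meets⇒overlap (_ , tile o x y) (_ , tile o′ x′ y′) m =
  let mx , my = Equivalence.to T-∧ m
      i , xi , xi′ = dist⇒spans (half o) (half o′) x x′ (half-pos o) (half-pos o′)
        (subst (dist x x′ ℕ.<_) (reachX≡ o o′) (ℕ.<ᵇ⇒< _ _ mx))
      j , yj , yj′ = dist⇒spans (half (turn o)) (half (turn o′)) y y′ (half-pos (turn o)) (half-pos (turn o′))
        (subst (dist y y′ ℕ.<_) (reachX≡ (turn o) (turn o′)) (ℕ.<ᵇ⇒< _ _ my))
  in i , j
   , (resize (x ℤ.- + half o) i (sym (lengthX≡ o)) xi , resize (y ℤ.- + half (turn o)) j (sym (lengthY≡ o)) yj)
   , (resize (x′ ℤ.- + half o′) i (sym (lengthX≡ o′)) xi′ , resize (y′ ℤ.- + half (turn o′)) j (sym (lengthY≡ o′)) yj′)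

touch⇒attached : ∀ b c → Touch b c → Attached (toBlock b) (toBlock c)
touch⇒attached b@(z , _) c@(z′ , _) (d , m) = levels d , meets⇒overlap b c m
  where
  consecutive : ∀ z → ℤ.∣ + suc z ℤ.- + z ∣ ≡ 1
  consecutive z = cong ℤ.∣_∣ (e (+ z))
    where
    e : ∀ z → (+ 1 ℤ.+ z) ℤ.- z ≡ + 1
    e = ℤ-Solver.solve-∀
  levels : z ≡ suc z′ ⊎ z′ ≡ suc z → ℤ.∣ + z ℤ.- + z′ ∣ ≡ 1
  levels (inj₁ refl) = consecutive z′
  levels (inj₂ refl) = trans (ℤ.∣i-j∣≡∣j-i∣ (+ z) (+ z′)) (consecutive z)

cancelʳ : ∀ x x′ h → x ℤ.- h ≡ x′ ℤ.- h → x ≡ x′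
cancelʳ x x′ h e = trans (sym (restore x h)) (trans (cong (ℤ._+ h) e) (restore x′ h))
  where
  restore : ∀ x h → (x ℤ.- h) ℤ.+ h ≡ x
  restore = ℤ-Solver.solve-∀

toBlock-injective : ∀ {b c} → toBlock b ≡ toBlock c → b ≡ c
toBlock-injective {z , tile o x y} {z′ , tile o′ x′ y′} e with ℤ.+-injective (cong Block.z e) | cong Block.orientation e
... | refl | refl with cancelʳ x x′ (+ half o) (cong Block.x e) | cancelʳ y y′ (+ half (turn o)) (cong Block.y e)
...   | refl | refl = refl

module Listing (xs : List Brick) where

  at : ∀ {m} → length xs ≡ m → Fin m → Brick
  at refl i = lookup xs i

  at-∈ : ∀ {m} (e : length xs ≡ m) i → at e i ∈ xs
  at-∈ refl i = ∈-lookup {xs = xs} i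

  at-onto : ∀ {m} (e : length xs ≡ m) {b} → b ∈ xs → ∃ λ i → at e i ≡ b
  at-onto refl b∈ = index b∈ , sym (lookup-index b∈)

  at-apart : ∀ {m} (e : length xs ≡ m) → AllPairs Apart xs → ∀ i j → i ≢ j → Apart (at e i) (at e j)
  at-apart refl ap = AllPairs-lookup (λ {b} {c} → Apart-sym {b} {c}) ap

module _ {n : ℕ} (τ : Tower n single) where

  open Listing (base single ++ above τ)

  bricks-length : length (base single ++ above τ) ≡ suc n
  bricks-length = cong suc (length-above τ)

  private
    brick : Fin (suc n) → Brick
    brick = at bricks-length
    apart : ∀ i j → i ≢ j → Apart (brick i) (brick j)
    apart = at-apart bricks-length (tower-apart ([] ∷ []) τ)

  brick-injective : ∀ {i j} → brick i ≡ brick j → i ≡ j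
  brick-injective {i} {j} e = decidable-stable (i Fin.≟ j) λ i≢j →
    apart i j i≢j (cong proj₁ e , subst (λ b → T (meetsᶻ (proj₂ (brick i)) (proj₂ b))) e (meetsᶻ-self (proj₂ (brick i))))

  building : Building (suc n)
  building = record
    { blocks   = toBlock ∘ brick
    ; disjoint = λ i j i≢j (e , o) → apart i j i≢j (ℤ.+-injective (level e) , overlap⇒meets (brick i) (brick j) o)
    }
    where
    level : ∀ {i j} → Block.z (toBlock (brick i)) ≡ Block.z (toBlock (brick j)) → + proj₁ (brick i) ≡ + proj₁ (brick j)
    level e = e

  -- Reachability from brick `i` spreads along touching bricks, so `tower-connected` applies to it.
  -- `Reached` speaks of all indices of a brick, which avoids choosing one.
  contiguous : Contiguous building
  contiguous i j = tower-connected τ Reached closed (λ { _ (here refl) (here refl) p → p })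
      (at-∈ bricks-length i) (at-∈ bricks-length j) (λ k e → subst (Star Edge i) (sym (brick-injective e)) Star.ε) j refl
    where
    Edge : Fin (suc n) → Fin (suc n) → Set
    Edge k l = Attached (blocks building k) (blocks building l)
    Reached : Brick → Set
    Reached b = ∀ k → brick k ≡ b → Star Edge i k
    closed : Closed Reached (base single ++ above τ)
    closed b∈ _ t reached l refl with at-onto bricks-length b∈
    ... | k , refl = reached k refl ◅◅ (touch⇒attached (brick k) (brick l) t ◅ Star.ε)

  block-of : ∀ i → ∃ λ b → b ∈ base single ++ above τ × blocks building i ≡ toBlock b
  block-of i = brick i , at-∈ bricks-length i , refl

  block-index : ∀ {b} → b ∈ base single ++ above τ → ∃ λ i → blocks building i ≡ toBlock b
  block-index b∈ = let i , e = at-onto bricks-length b∈ in i , cong toBlock e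

contiguousBuilding : ∀ {n} → Tower n single → ContiguousBuilding (suc n)
contiguousBuilding τ = building τ , contiguous τ

-- Motions: quarter turns followed by a translation.

spin : ℕ → Block → Block
spin zero    b = b
spin (suc k) b = quarterTurn · spin k b

spin-+ : ∀ k l b → spin (k ℕ.+ l) b ≡ spin k (spin l b)
spin-+ zero    l b = refl
spin-+ (suc k) l b = cong (quarterTurn ·_) (spin-+ k l b)

spin-*4 : ∀ m b → spin (m ℕ.* 4) b ≡ b
spin-*4 zero    b = refl
spin-*4 (suc m) b = trans (inverse-· quarterTurn (spin (m ℕ.* 4) b)) (spin-*4 m b)

spin-% : ∀ k b → spin k b ≡ spin (k ℕ.% 4) b
spin-% k b = trans (cong (λ k → spin k b) (ℕ.m≡m%n+[m/n]*n k 4))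
  (trans (spin-+ (k ℕ.% 4) ((k ℕ./ 4) ℕ.* 4) b) (cong (spin (k ℕ.% 4)) (spin-*4 (k ℕ./ 4) b)))

spin-translate : ∀ k u v w → ∃₂ λ u′ v′ → ∀ b → spin k (translate u v w · b) ≡ translate u′ v′ w · spin k b
spin-translate zero    u v w = u , v , λ b → refl
spin-translate (suc k) u v w = let u′ , v′ , h = spin-translate k u v w in
  ℤ.- v′ , u′ , λ b → trans (cong (quarterTurn ·_) (h b)) (turn-translate u′ v′ (spin k b))
  where
  rearrange : ∀ y v l → ℤ.- ((y ℤ.+ v) ℤ.+ l) ≡ ℤ.- (y ℤ.+ l) ℤ.+ ℤ.- v
  rearrange = ℤ-Solver.solve-∀
  turn-translate : ∀ u v b → quarterTurn · (translate u v w · b) ≡ translate (ℤ.- v) u w · (quarterTurn · b)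
  turn-translate u v (block o x y z) = block-cong (rearrange y v (lengthY o)) refl refl

turns : Motion → ℕ
turns (translate _ _ _) = 0
turns quarterTurn       = 1
turns (g ∘ᴹ h)          = turns g ℕ.+ turns h

-- A quarter turn moved past a translation only changes its vector, so all turns can be collected
-- next to the block; their number modulo 4 is all that remains of them.
normalForm : ∀ g → ∃ λ u → ∃₂ λ v w → ∀ b → g · b ≡ translate u v w · spin (turns g) b
normalForm (translate u v w) = u , v , w , λ b → refl
normalForm quarterTurn       = + 0 , + 0 , + 0 , λ b → sym
  (block-cong (ℤ.+-identityʳ _) (ℤ.+-identityʳ _) (ℤ.+-identityʳ _))
normalForm (g ∘ᴹ h) =
  let u , v , w , eg = normalForm g
      u′ , v′ , w′ , eh = normalForm h
      u″ , v″ , es = spin-translate (turns g) u′ v′ w′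
  in u″ ℤ.+ u , v″ ℤ.+ v , w′ ℤ.+ w , λ b → begin
    g · (h · b)                                                     ≡⟨ cong (g ·_) (eh b) ⟩
    g · (translate u′ v′ w′ · spin (turns h) b)                     ≡⟨ eg _ ⟩
    translate u v w · spin (turns g) (translate u′ v′ w′ · spin (turns h) b) ≡⟨ cong (translate u v w ·_) (es _) ⟩
    translate u v w · (translate u″ v″ w′ · spin (turns g) (spin (turns h) b)) ≡⟨ translate-translate {u} {v} {w} {u″} {v″} {w′} (spin (turns g) (spin (turns h) b)) ⟩
    translate (u″ ℤ.+ u) (v″ ℤ.+ v) (w′ ℤ.+ w) · spin (turns g) (spin (turns h) b) ≡⟨ cong (translate (u″ ℤ.+ u) (v″ ℤ.+ v) (w′ ℤ.+ w) ·_) (spin-+ (turns g) (turns h) b) ⟨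
    translate (u″ ℤ.+ u) (v″ ℤ.+ v) (w′ ℤ.+ w) · spin (turns g ℕ.+ turns h) b ∎
  where
  open ≡-Reasoning
  translate-translate : ∀ {u v w u′ v′ w′} b → translate u v w · (translate u′ v′ w′ · b) ≡ translate (u′ ℤ.+ u) (v′ ℤ.+ v) (w′ ℤ.+ w) · b
  translate-translate (block o x y z) = block-cong (ℤ.+-assoc x _ _) (ℤ.+-assoc y _ _) (ℤ.+-assoc z _ _)

same-turns : ∀ g h → turns g ℕ.% 4 ≡ turns h ℕ.% 4 →
             ∃ λ u → ∃₂ λ v w → ∀ b → h · b ≡ translate u v w · (g · b)
same-turns g h e =
  let u , v , w , eg = normalForm g
      u′ , v′ , w′ , eh = normalForm h
  in u′ ℤ.- u , v′ ℤ.- v , w′ ℤ.- w , λ b → begin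
    h · b                                      ≡⟨ eh b ⟩
    translate u′ v′ w′ · spin (turns h) b      ≡⟨ cong (translate u′ v′ w′ ·_) (trans (spin-% (turns h) b) (trans (cong (λ k → spin k b) (sym e)) (sym (spin-% (turns g) b)))) ⟩
    translate u′ v′ w′ · spin (turns g) b      ≡⟨ shift-difference {u} {v} {w} {u′} {v′} {w′} (spin (turns g) b) ⟩
    translate (u′ ℤ.- u) (v′ ℤ.- v) (w′ ℤ.- w) · (translate u v w · spin (turns g) b) ≡⟨ cong (translate (u′ ℤ.- u) (v′ ℤ.- v) (w′ ℤ.- w) ·_) (eg b) ⟨
    translate (u′ ℤ.- u) (v′ ℤ.- v) (w′ ℤ.- w) · (g · b) ∎
  where
  open ≡-Reasoning
  restore : ∀ x u u′ → x ℤ.+ u′ ≡ (x ℤ.+ u) ℤ.+ (u′ ℤ.- u)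
  restore = ℤ-Solver.solve-∀
  shift-difference : ∀ {u v w u′ v′ w′} b → translate u′ v′ w′ · b ≡ translate (u′ ℤ.- u) (v′ ℤ.- v) (w′ ℤ.- w) · (translate u v w · b)
  shift-difference (block o x y z) = block-cong (restore x _ _) (restore y _ _) (restore z _ _)

-- Congruent towers.

foundation : Brick
foundation = 0 , embed foot₁

Whole : ∀ {n} → Tower n single → List Brick
Whole τ = foundation ∷ above τ

module _ {n : ℕ} (τ τ′ : Tower n single) (u v w : ℤ)
         (forth : ∀ {b} → b ∈ Whole τ → ∃ λ b′ → b′ ∈ Whole τ′ × translate u v w · toBlock b ≡ toBlock b′)
         (back  : ∀ {b′} → b′ ∈ Whole τ′ → ∃ λ b → b ∈ Whole τ × translate u v w · toBlock b ≡ toBlock b′)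
  where

  private
    shifted : Block → Block
    shifted b = translate u v w · b
    ground : ∀ {t σ} → (0 , t) ∈ Whole {n} σ → (0 , t) ≡ foundation
    ground         (here e)   = e
    ground {σ = σ} (there b∈) = contradiction b∈ (above-raised σ)

    -- Only the foundation has level 0, so no vertical shift is possible.
    fixed : shifted (toBlock foundation) ≡ toBlock foundation
    fixed with forth (here refl) | back (here refl)
    ... | (z′ , t′) , b′∈ , e | (z , t) , _ , e′ with level≡0 (ℤ.+-identityˡ w) (cong Block.z e) (cong Block.z e′)
      where
      level≡0 : ∀ {z z′} → + 0 ℤ.+ w ≡ w → + 0 ℤ.+ w ≡ + z′ → + z ℤ.+ w ≡ + 0 → z′ ≡ 0
      level≡0 {z} {z′} e₀ e₁ e₂ = ℕ.m+n≡0⇒n≡0 z (ℤ.+-injective (trans (cong (λ d → + z ℤ.+ d) (trans (sym e₁) e₀)) e₂))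
    ...   | refl with ground {σ = τ′} b′∈
    ...     | refl = e

    shifted-identity : ∀ b → shifted b ≡ b
    shifted-identity (block o x y z) = block-cong (still x (cong Block.x fixed)) (still y (cong Block.y fixed)) (still z (cong Block.z fixed))
      where
      still : ∀ {a u} x → a ℤ.+ u ≡ a → x ℤ.+ u ≡ x
      still {a} {u} x e = trans (cong (λ d → x ℤ.+ d) u≡0) (ℤ.+-identityʳ x)
        where
        restore : ∀ a u → (a ℤ.+ u) ℤ.- a ≡ u
        restore = ℤ-Solver.solve-∀
        u≡0 : u ≡ + 0
        u≡0 = trans (sym (restore a u)) (trans (cong (ℤ._- a) e) (ℤ.+-inverseʳ a))

    raised : ∀ {σ σ′ : Tower n single} {b} → b ∈ above σ → b ∈ Whole σ′ → b ∈ above σ′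
    raised {σ} b∈ (here refl) = contradiction b∈ (above-raised σ)
    raised     b∈ (there b∈′) = b∈′

  -- The shift maps the foundation to itself, hence is the identity, and both towers have the same
  -- bricks.
  translated-equal : τ ≡ τ′
  translated-equal = above-injective τ τ′
    (⊑-intro λ {b} b∈ → let b′ , b′∈ , e = forth (there b∈) in
      raised {τ} {τ′} b∈ (subst (_∈ Whole τ′) (toBlock-injective (trans (sym e) (shifted-identity (toBlock b)))) b′∈))
    (⊑-intro λ {b′} b′∈ → let b , b∈ , e = back (there b′∈) in
      raised {τ′} {τ} b′∈ (subst (_∈ Whole τ) (toBlock-injective (trans (sym (shifted-identity (toBlock b))) e)) b∈))

module _ {n : ℕ} (R : Building (suc n)) (τ τ′ : Tower n single)
         (r : R ≅ building τ) (r′ : R ≅ building τ′)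
         (same : turns (proj₁ r) ℕ.% 4 ≡ turns (proj₁ r′) ℕ.% 4)
  where

  -- With equal turns modulo 4, the motion from one tower to the other through `R` is a translation.
  congruent-equal : τ ≡ τ′
  congruent-equal =
    let g , into , onto = r
        g′ , into′ , onto′ = r′
        u , v , w , e = same-turns g g′ same
    in translated-equal τ τ′ u v w
      (λ {b} b∈ →
        let i , bᵢ = block-index τ b∈
            k , gk = onto i
            j , g′k = into′ k
            b′ , b′∈ , bⱼ = block-of τ′ j
        in b′ , b′∈ , trans (cong (translate u v w ·_) (trans (sym bᵢ) (sym gk))) (trans (sym (e (blocks R k))) (trans g′k bⱼ)))
      (λ {b′} b′∈ →
        let j , bⱼ = block-index τ′ b′∈
            k , g′k = onto′ j
            i , gk = into k
            b , b∈ , bᵢ = block-of τ i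
        in b , b∈ , trans (cong (translate u v w ·_) (trans (sym bᵢ) (sym gk))) (trans (sym (e (blocks R k))) (trans g′k bⱼ)))

module _ {n t : ℕ} (card : HasCardinality (contiguousBuildings (suc n)) t) where

  open Bijection card using (to; surjective)

  private
    tower : Fin (count n single) → Tower n single
    tower = lookup (towers n single)
    class : Fin (count n single) → Fin t
    class i = proj₁ (surjective (contiguousBuilding (tower i)))
    represents : ∀ i → proj₁ (to (class i)) ≅ building (tower i)
    represents i = proj₂ (surjective (contiguousBuilding (tower i))) refl
    rotation : Fin (count n single) → Fin 4
    rotation i = Fin.fromℕ< (ℕ.m%n<n (turns (proj₁ (represents i))) 4)
    code : Fin (count n single) → Fin (t ℕ.* 4)
    code i = Fin.combine (class i) (rotation i)

    represented-equal : ∀ {c c′} → c ≡ c′ → ∀ {τ τ′} (r : proj₁ (to c) ≅ building τ) (r′ : proj₁ (to c′) ≅ building τ′) →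
      turns (proj₁ r) ℕ.% 4 ≡ turns (proj₁ r′) ℕ.% 4 → τ ≡ τ′
    represented-equal {c} refl r r′ = congruent-equal (proj₁ (to c)) _ _ r r′

    tower-injective : ∀ {i j} → tower i ≡ tower j → i ≡ j
    tower-injective {i} {j} e = decidable-stable (i Fin.≟ j)
      (λ i≢j → AllPairs-lookup ≢-sym (towers-unique n single) i j i≢j e)

    code-injective : ∀ {i j} → code i ≡ code j → i ≡ j
    code-injective {i} {j} e =
      let c , r = Fin.combine-injective (class i) (rotation i) (class j) (rotation j) e
      in tower-injective (represented-equal c (represents i) (represents j)
           (Fin.fromℕ<-injective _ _ (ℕ.m%n<n (turns (proj₁ (represents i))) 4) (ℕ.m%n<n (turns (proj₁ (represents j))) 4) r))

  -- A tower is determined by its congruence class together with the rotation that carries the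
  -- representative to it.
  count≤cardinality : count n single ℕ.≤ t ℕ.* 4
  count≤cardinality = Fin.injective⇒≤ code-injective

-- Comparison of growth rates

-- Bernoulli's inequality `1 + n/c ≤ (1 + 1/c)^n`, multiplied by the power `c^(n+1)`.
bernoulli : ∀ c n → c ^ n * (c + n) ≤ suc c ^ n * c
bernoulli c zero    = ℕ.≤-reflexive (cong (1 *_) (ℕ.+-identityʳ c))
bernoulli c (suc n) = begin
  c * c ^ n * (c + suc n)         ≤⟨ ℕ.m≤m+n _ (c ^ n * n) ⟩
  c * c ^ n * (c + suc n) + c ^ n * n ≡⟨ e₁ c (c ^ n) n ⟩
  suc c * (c ^ n * (c + n))       ≤⟨ ℕ.*-monoʳ-≤ (suc c) (bernoulli c n) ⟩
  suc c * (suc c ^ n * c)         ≡⟨ ℕ.*-assoc (suc c) (suc c ^ n) c ⟨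
  suc c * suc c ^ n * c           ∎
  where
  open ℕ.≤-Reasoning
  e₁ : ∀ c x n → c * x * (c + suc n) + x * n ≡ suc c * (x * (c + n))
  e₁ = ℕ-Solver.solve-∀

-- For integers `c < d` means `suc c ≤ d`, so `(d/c)^n` is at least `1 + n/c` by Bernoulli, hence at
-- least `K`.
power-dominates : ∀ c d K n → .{{NonZero c}} → c < d → c * K ≤ n → c ^ n * K ≤ d ^ n
power-dominates c d K n c<d cK≤n = ℕ.*-cancelʳ-≤ (c ^ n * K) (d ^ n) c (begin
  c ^ n * K * c     ≡⟨ e (c ^ n) K c ⟩
  c ^ n * (c * K)   ≤⟨ ℕ.*-monoʳ-≤ (c ^ n) (ℕ.≤-trans cK≤n (ℕ.m≤n+m n c)) ⟩
  c ^ n * (c + n)   ≤⟨ bernoulli c n ⟩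
  suc c ^ n * c     ≤⟨ ℕ.*-monoˡ-≤ c (ℕ.^-monoˡ-≤ n c<d) ⟩
  d ^ n * c         ∎)
  where
  open ℕ.≤-Reasoning
  e : ∀ x K c → x * K * c ≡ x * (c * K)
  e = ℕ-Solver.solve-∀

^-distribʳ-* : ∀ m n o → (m * n) ^ o ≡ m ^ o * n ^ o
^-distribʳ-* m n zero    = refl
^-distribʳ-* m n (suc o) = trans (cong (m * n *_) (^-distribʳ-* m n o)) (e m n (m ^ o) (n ^ o))
  where
  e : ∀ m n x y → m * n * (x * y) ≡ m * x * (n * y)
  e = ℕ-Solver.solve-∀

module _ (p q a b D V : ℕ) .{{_ : NonZero q}} .{{_ : NonZero a}} .{{_ : NonZero b}} .{{_ : NonZero D}} .{{_ : NonZero V}}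
         (T : ℕ → ℕ) (growth : ∀ n → p ^ (3 + n) * V ≤ D * (q ^ (3 + n) * (T (4 + n) * 4)))
         (qa<pb : q * a < p * b) where

  -- The constant to be beaten is `8 * D * a`: 4 for the rotations, 2 for the factor that the
  -- logarithm bound asks for, `D` from the growth estimate, and `a` for the passage from exponent
  -- `3 + n` to `4 + n`.
  outgrows : ∃ λ N → ∀ n → N ≤ n → 2 * a ^ (4 + n) ≤ T (4 + n) * b ^ (4 + n)
  outgrows = q * a * (8 * D * a) , λ n N≤n →
    let N = 3 + n
        x = p ^ N ; y = q ^ N ; α = a ^ N ; β = b ^ N ; t = T (4 + n)
    in ℕ.*-cancelˡ-≤ (4 * D * y) {{ℕ.m*n≢0 (4 * D) y {{ℕ.m*n≢0 4 D}} {{ℕ.m^n≢0 q N}}}} (begin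
      4 * D * y * (2 * (a * α))            ≡⟨ e₁ D y a α ⟩
      (y * α) * (8 * D * a)                ≡⟨ cong (_* (8 * D * a)) (^-distribʳ-* q a N) ⟨
      (q * a) ^ N * (8 * D * a)            ≤⟨ power-dominates (q * a) (p * b) (8 * D * a) N {{ℕ.m*n≢0 q a}} qa<pb (ℕ.≤-trans N≤n (ℕ.m≤n+m n 3)) ⟩
      (p * b) ^ N                          ≡⟨ ^-distribʳ-* p b N ⟩
      x * β                                ≡⟨ e₀ (x * β) ⟩
      x * β * (1 * 1)                      ≤⟨ ℕ.*-monoʳ-≤ (x * β) (ℕ.*-mono-≤ (>-nonZero⁻¹ V) (>-nonZero⁻¹ b)) ⟩
      x * β * (V * b)                      ≡⟨ e₂ x β V b ⟩
      (x * V) * (b * β)                    ≤⟨ ℕ.*-monoˡ-≤ (b * β) (growth n) ⟩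
      D * (y * (t * 4)) * (b * β)          ≡⟨ e₃ D y t (b * β) ⟩
      4 * D * y * (t * (b * β))            ∎)
    where
    open ℕ.≤-Reasoning
    e₀ : ∀ x → x ≡ x * (1 * 1)
    e₀ = ℕ-Solver.solve-∀
    e₁ : ∀ D y a α → 4 * D * y * (2 * (a * α)) ≡ (y * α) * (8 * D * a)
    e₁ = ℕ-Solver.solve-∀
    e₂ : ∀ x β V b → x * β * (V * b) ≡ (x * V) * (b * β)
    e₂ = ℕ-Solver.solve-∀
    e₃ : ∀ D y t z → D * (y * (t * 4)) * z ≡ 4 * D * y * (t * z)
    e₃ = ℕ-Solver.solve-∀

-- Numerical bounds and conclusion.

opaque

  -- The grid has step 1/10000. On it, 43616 is the largest numerator for which `exp-upper-bound`
  -- holds with the growth rate 392/5. Both numbers are opaque because the powers built from them,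
  -- and the threshold of `outgrows`, must stay unevaluated elsewhere.
  denominator numerator : ℕ
  denominator = 9999
  numerator = 43615

  denominator-pos : 1 ℕ.≤ denominator
  denominator-pos = ℕ.≤ᵇ⇒≤ 1 9999 tt

  numerator-factors : 715 ℕ.* 61 ≡ numerator
  numerator-factors = refl

  suc-numerator-factors : 928 ℕ.* 47 ≡ suc numerator
  suc-numerator-factors = refl

  -- The exponents are factored to keep the evaluation of the powers shallow.
  exp-upper-bound : 5 ℕ.* suc denominator ℕ.^ suc numerator ℕ.< 392 ℕ.* denominator ℕ.^ suc numerator
  exp-upper-bound = subst (λ e → 5 ℕ.* suc denominator ℕ.^ e ℕ.< 392 ℕ.* denominator ℕ.^ e) suc-numerator-factors
    (subst₂ (λ u v → 5 ℕ.* u ℕ.< 392 ℕ.* v) (ℕ.^-*-assoc (suc denominator) 928 47) (ℕ.^-*-assoc denominator 928 47)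
      (ℕ.<ᵇ⇒< (5 ℕ.* (suc denominator ℕ.^ 928) ℕ.^ 47) (392 ℕ.* (denominator ℕ.^ 928) ℕ.^ 47) tt))

  -- The value 78.33 lies 1/100 above the bound to be proved, leaving room for the 1/200 of
  -- `margin`.
  exp-lower-bound : 7833 ℕ.* suc denominator ℕ.^ numerator ℕ.< 100 ℕ.* (2 ℕ.+ denominator) ℕ.^ numerator
  exp-lower-bound = subst (λ e → 7833 ℕ.* suc denominator ℕ.^ e ℕ.< 100 ℕ.* (2 ℕ.+ denominator) ℕ.^ e) numerator-factors
    (subst₂ (λ u v → 7833 ℕ.* u ℕ.< 100 ℕ.* v) (ℕ.^-*-assoc (suc denominator) 715 61) (ℕ.^-*-assoc (2 ℕ.+ denominator) 715 61)
      (ℕ.<ᵇ⇒< (7833 ℕ.* (suc denominator ℕ.^ 715) ℕ.^ 61) (100 ℕ.* ((2 ℕ.+ denominator) ℕ.^ 715) ℕ.^ 61) tt))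

margin : (+ 7832 / 100 ℚ.+ + 1 / 200) ℚ.* RationalLemmas.ι 100 ℚ.< RationalLemmas.ι 7833
margin = toWitness {a? = ((+ 7832 / 100 ℚ.+ + 1 / 200) ℚ.* RationalLemmas.ι 100) ℚ.<? RationalLemmas.ι 7833} tt

module _ (T : ℕ → ℕ) (card : ∀ n → HasCardinality (contiguousBuildings n) (T n)) where

  -- The foundation is not counted in the index of a tower, so `3 + n` there corresponds to `4 + n`
  -- blocks.
  cardinality-growth : ∀ n → 392 ℕ.^ (3 ℕ.+ n) ℕ.* weight single
                             ℕ.≤ scale ℕ.* (5 ℕ.^ (3 ℕ.+ n) ℕ.* (T (4 ℕ.+ n) ℕ.* 4))
  cardinality-growth n = enlarge {392 ℕ.^ (3 ℕ.+ n) ℕ.* weight single} {scale} {5 ℕ.^ (3 ℕ.+ n)}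
    (growth n) (count≤cardinality (card (4 ℕ.+ n)))
    where
    enlarge : ∀ {x d y c t} → x ℕ.≤ d ℕ.* (y ℕ.* c) → c ℕ.≤ t → x ℕ.≤ d ℕ.* (y ℕ.* t)
    enlarge {d = d} {y} h c≤t = ℕ.≤-trans h (ℕ.*-monoʳ-≤ d (ℕ.*-monoʳ-≤ y c≤t))

  log-averages : ∃ λ N → ∀ n → N ℕ.≤ n → ∃ λ K → ∀ k → K ℕ.≤ k →
                 LogLemmas.grid denominator (suc numerator) ℚ.≤ seq (log (T (suc n)) ÷ᴿ suc n) k
  log-averages =
    let N , large = outgrows 392 5 (suc denominator ℕ.^ suc numerator) (denominator ℕ.^ suc numerator)
          scale (weight single)
          {{_}} {{ℕ.m^n≢0 (suc denominator) (suc numerator)}} {{ℕ.m^n≢0 denominator (suc numerator) {{ℕ.>-nonZero denominator-pos}}}} {{scale≢0}}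
          T cardinality-growth exp-upper-bound
    -- `outgrows` speaks of `4 + n` blocks and the averages of `suc n`, so `n` is written as
    -- `3 + (n ∸ 3)`.
    in 3 ℕ.+ N , λ n N≤n → subst
      (λ n → ∃ λ K → ∀ k → K ℕ.≤ k → LogLemmas.grid denominator (suc numerator) ℚ.≤ seq (log (T (suc n)) ÷ᴿ suc n) k)
      (ℕ.m+[n∸m]≡n (ℕ.≤-trans (ℕ.m≤m+n 3 N) N≤n))
      (log-average denominator (suc numerator) T (3 ℕ.+ (n ℕ.∸ 3))
        (large (n ℕ.∸ 3) (ℕ.m+n≤o⇒m≤o∸n N (subst (ℕ._≤ n) (ℕ.+-comm 3 N) N≤n))) denominator-pos)

theorem4p1 : (T : ℕ → ℕ) → (∀ n → HasCardinality (contiguousBuildings n) (T n)) →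
    (s : ℝ) → (λ n → log (T (suc n)) ÷ᴿ suc n) ⟶ s →
    fromℚ (+ 7832 / 100) <ᴿ exp s
-- The arguments 7833 and 99 stand for the fraction 7833/100, since `exp-lower` takes the
-- predecessor of the denominator.
theorem4p1 T card s converges = exp-lower denominator numerator 7833 99 (+ 7832 / 100) (+ 1 / 200)
  (ℚ.positive⁻¹ (+ 1 / 200)) (ℕ.<⇒≤ exp-lower-bound) margin s
  (limit-lower denominator numerator (λ n → log (T (suc n)) ÷ᴿ suc n) s converges (log-averages T card))
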